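{- Let $k\ge3$, $m\ge3$ and $0<\alpha<1$. Among all $k$-uniform linear unicyclic hypergraphs with $m$ hyperedges, the first hypergraph in $S_\alpha$-order is the hypercycle $C_m^{(k)}$.
   Context: Hypergraphs are finite; $k$-uniform means every hyperedge has exactly $k$ vertices; linear means any two distinct hyperedges share at most one vertex; unicyclic means connected with exactly one cycle. The hypercycle $C_m^{(k)}$ is obtained from the cycle graph with $m$ edges by inserting $k-2$ new vertices (of degree one) into each edge. For a $k$-uniform hypergraph $\mathcal{H}$ on $[n]$, $\mathcal{A}(\mathcal{H})$ is the $k$-order $n$-dimensional tensor with entry $\frac1{(k-1)!}$ at $(i_1,\dots,i_k)$ if $\{i_1,\dots,i_k\}\in E(\mathcal{H})$ and $0$ otherwise; $\mathcal{D}(\mathcal{H})$ is the diagonal tensor of vertex degrees; $\mathcal{A}_\alpha(\mathcal{H})=\alpha\mathcal{D}(\mathcal{H})+(1-\alpha)\mathcal{A}(\mathcal{H})$. For a tensor $\mathcal{T}$, $\mathrm{Tr}_d(\mathcal{T})$ is the sum of the $d$-th powers of all $n(k-1)^{n-1}$ eigenvalues of $\mathcal{T}$ (roots of its characteristic polynomial, with multiplicity); in particular $\mathrm{Tr}_0(\mathcal{T})=n(k-1)^{n-1}$, and for $d\ge1$ $$\mathrm{Tr}_{d}(\mathcal{T})=(k-1)^{n-1}\sum_{d_1+\cdots+d_n=d}\ \prod_{i=1}^{n}\frac{1}{(d_i(k-1))!}\Big(\sum_{\gamma\in[n]^{k-1}}(\mathcal{T})_{i\gamma}\frac{\partial}{\partial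 a_{i\gamma}}\Big)^{d_i}\mathrm{tr}\big(A^{d(k-1)}\big),$$ with $A=(a_{ij})$ an $n\times n$ matrix of indeterminates, $d_i\ge0$ integers, $\frac{\partial}{\partial a_{i\gamma}}=\frac{\partial}{\partial a_{i i_2}}\cdots\frac{\partial}{\partial a_{i i_k}}$ for $\gamma=i_2\cdots i_k$. $S_\alpha$-order: for $k$-uniform hypergraphs $\mathcal{H}_1,\mathcal{H}_2$ with $n$ vertices, $\mathcal{H}_1\prec_\alpha\mathcal{H}_2$ if there is $d\in\{1,\dots,n(k-1)^{n-1}-1\}$ with $\mathrm{Tr}_t(\mathcal{A}_\alpha(\mathcal{H}_1))=\mathrm{Tr}_t(\mathcal{A}_\alpha(\mathcal{H}_2))$ for $t=0,\dots,d-1$ and $\mathrm{Tr}_d(\mathcal{A}_\alpha(\mathcal{H}_1))<\mathrm{Tr}_d(\mathcal{A}_\alpha(\mathcal{H}_2))$. "$X$ is the first hypergraph in a class" means $X$ is in the class and $X\prec_\alpha\mathcal{H}$ for every $\mathcal{H}$ in the class not isomorphic to $X$. -}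

module Defs where

open import Level using (_⊔_) renaming (suc to lsuc)

open import Algebra.Apartness.Bundles using (HeytingField)
open import Data.Bool.Base using (true; if_then_else_)
import Data.Bool.Properties as Bool
open import Data.Fin.Base using (Fin; toℕ; fromℕ<; combine; remQuot)
open import Data.Fin.Properties using (_≟_; any?; remQuot-combine; toℕ-fromℕ<)
open import Data.Fin.Subset using (Subset; ⁅_⁆; ⋃; _∩_; ∣_∣; _∈_)
open import Data.List.Base as List using (List; []; _∷_; _++_; allFin; upTo)
open import Data.Nat.Base as ℕ using (ℕ; zero; suc; _∸_; _!)
open import Data.Nat.DivMod using (_mod_)
open import Data.Nat.GeneralisedArithmetic using (fold)
import Data.Nat.Properties as ℕ
open import Data.Product.Base using (Σ-syntax; ∃-syntax; _×_; _,_; proj₁; proj₂)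
import Data.Product.Properties as Product
open import Data.Sum.Base using (_⊎_; inj₁; inj₂)
open import Data.Vec.Base as Vec using (Vec; []; _∷_; tabulate; lookup; replicate)
import Data.Vec.Properties as Vec
open import Function.Base using (_∘_)
open import Function.Bundles using (_⇔_; _↔_; Inverse; Equivalence)
open import Function.Definitions using (Injective)
open import Relation.Binary.Core using (Rel)
open import Relation.Binary.Construct.Closure.ReflexiveTransitive using (Star)
open import Relation.Binary.Definitions using (DecidableEquality)
open import Relation.Binary.PropositionalEquality.Core
  using (_≡_; _≢_; refl; sym; trans; cong)
open import Relation.Binary.Structures using (IsStrictPartialOrder)
open import Relation.Nullary using (¬_; Dec; yes; does)
open import Relation.Nullary.Decidable using (_⊎-dec_; _×-dec_; dec-true)

------------------------------------------------------------------------
-- Ordered fields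

-- The real numbers, constructively (with _#_ their apartness) as well as
-- classically (with _#_ the relation ≉), are an instance.  Cotransitivity
-- of _<_ follows from that of _#_.
record OrderedField c ℓ₁ ℓ₂ ℓ₃ : Set (lsuc (c ⊔ ℓ₁ ⊔ ℓ₂ ⊔ ℓ₃)) where
  infix 4 _<_
  field
    heytingField : HeytingField c ℓ₁ ℓ₂

  open HeytingField heytingField public

  field
    _<_                  : Rel Carrier ℓ₃
    isStrictPartialOrder : IsStrictPartialOrder _≈_ _<_
    #⇔<⊎>                : ∀ {x y} → x # y ⇔ (x < y ⊎ y < x)
    +-monoˡ-<            : ∀ {x y} z → x < y → x + z < y + z
    *-pos                : ∀ {x y} → 0# < x → 0# < y → 0# < x * y
    0<1                  : 0# < 1#

  open IsStrictPartialOrder isStrictPartialOrder public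
    using (<-respʳ-≈; <-respˡ-≈)
    renaming (irrefl to <-irrefl; trans to <-trans)

------------------------------------------------------------------------
-- Hypergraphs with vertex set Fin n and m (distinct) hyperedges

record Hypergraph (n m : ℕ) : Set where
  field
    edge           : Fin m → Subset n
    edge-injective : Injective _≡_ _≡_ edge

open Hypergraph public

-- Successor modulo n.
next : ∀ {n} → Fin n → Fin n
next {suc n} i = suc (toℕ i) mod suc n

module _ {n m : ℕ} (H : Hypergraph n m) where

  Uniform : ℕ → Set
  Uniform k = ∀ e → ∣ edge H e ∣ ≡ k

  Linear : Set
  Linear = ∀ {e f} → e ≢ f → ∣ edge H e ∩ edge H f ∣ ℕ.≤ 1

  Adjacent : Rel (Fin n) _
  Adjacent x y = ∃[ e ] (x ∈ edge H e × y ∈ edge H e)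

  Connected : Set
  Connected = ∀ x y → Star Adjacent x y

  -- A (Berge) cycle v₀ e₀ v₁ e₁ … v₀, with distinct vertices and distinct
  -- hyperedges.
  record Cycle : Set where
    field
      len        : ℕ
      2≤len      : 2 ℕ.≤ len
      vtx        : Fin len → Fin n
      hedge      : Fin len → Fin m
      vtx-inj    : Injective _≡_ _≡_ vtx
      hedge-inj  : Injective _≡_ _≡_ hedge
      vtx∈       : ∀ i → vtx i ∈ edge H (hedge i)
      next-vtx∈  : ∀ i → vtx (next i) ∈ edge H (hedge i)

    Traverses : Fin n → Fin m → Set
    Traverses x e = ∃[ i ] (e ≡ hedge i × (x ≡ vtx i ⊎ x ≡ vtx (next i)))

  -- The starting point and the direction of a cycle are immaterial: two
  -- sequences are rotations or reflections of each other exactly when they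
  -- traverse the same vertex-hyperedge incidences.
  SameCycle : Rel Cycle _
  SameCycle C C′ = ∀ x e → Cycle.Traverses C x e ⇔ Cycle.Traverses C′ x e

  Unicyclic : Set
  Unicyclic = Connected × Σ[ C ∈ Cycle ] (∀ C′ → SameCycle C C′)

  degree : Fin n → ℕ
  degree x = ∣ tabulate (λ e → lookup (edge H e) x) ∣

  IsEdge? : (S : Subset n) → Dec (∃[ e ] edge H e ≡ S)
  IsEdge? S = any? (λ e → Vec.≡-dec Bool._≟_ (edge H e) S)

LinearUnicyclic : ℕ → ∀ {n m} → Hypergraph n m → Set
LinearUnicyclic k H = Uniform H k × Linear H × Unicyclic H

record _≅_ {n₁ m₁ n₂ m₂} (H₁ : Hypergraph n₁ m₁) (H₂ : Hypergraph n₂ m₂) : Set where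
  field
    onVertices : Fin n₁ ↔ Fin n₂
    onEdges    : Fin m₁ ↔ Fin m₂
    incidence  : ∀ x e → x ∈ edge H₁ e ⇔
                   Inverse.to onVertices x ∈ edge H₂ (Inverse.to onEdges e)

------------------------------------------------------------------------
-- The hypercycle

-- The vertex numbered combine i r, with i < m and r < k - 1, is the i-th
-- vertex of the m-cycle if r = 0, and one of the k - 2 vertices inserted into
-- the i-th edge otherwise.  The i-th edge of the m-cycle joins its i-th and
-- (i+1)-st vertices.
module _ (k m : ℕ) where

  InHyperedge? : (i : Fin m) (v : Fin (m ℕ.* (k ∸ 1))) →
                 let (j , r) = remQuot {m} (k ∸ 1) v in
                 Dec (j ≡ i ⊎ (j ≡ next i × toℕ r ≡ 0))
  InHyperedge? i v = let (j , r) = remQuot {m} (k ∸ 1) v in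
    (j ≟ i) ⊎-dec ((j ≟ next i) ×-dec (toℕ r ℕ.≟ 0))

  hyperedge : Fin m → Subset (m ℕ.* (k ∸ 1))
  hyperedge i = tabulate (λ v → does (InHyperedge? i v))

  hyperedge-injective : 3 ℕ.≤ k → Injective _≡_ _≡_ hyperedge
  hyperedge-injective 3≤k {i} {j} eq = i≡j
    where
    1<k-1 : 1 ℕ.< k ∸ 1
    1<k-1 = ℕ.∸-monoˡ-≤ 1 3≤k

    v : Fin (m ℕ.* (k ∸ 1))
    v = combine i (fromℕ< 1<k-1)

    remQuot-v : remQuot {m} (k ∸ 1) v ≡ (i , fromℕ< 1<k-1)
    remQuot-v = remQuot-combine i (fromℕ< 1<k-1)

    v∈i : does (InHyperedge? i v) ≡ true
    v∈i = dec-true (InHyperedge? i v) (inj₁ (cong proj₁ remQuot-v))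

    v∈j : does (InHyperedge? j v) ≡ true
    v∈j = trans (sym (Vec.lookup∘tabulate _ v))
         (trans (sym (cong (λ S → lookup S v) eq))
         (trans (Vec.lookup∘tabulate _ v) v∈i))

    from-does : ∀ {A : Set} (A? : Dec A) → does A? ≡ true → A
    from-does (yes a) _ = a

    i≡j : i ≡ j
    i≡j with from-does (InHyperedge? j v) v∈j
    ... | inj₁ p = trans (sym (cong proj₁ remQuot-v)) p
    ... | inj₂ (_ , r≡0)
      with () ← trans (sym (toℕ-fromℕ< 1<k-1))
                  (trans (sym (cong (toℕ ∘ proj₂) remQuot-v)) r≡0)

-- Only k ≥ 3 is needed for the hyperedges to be distinct; the restriction
-- m ≥ 3 makes the m-cycle a simple graph.
hypercycle : ∀ {k m} → 3 ℕ.≤ k → 3 ℕ.≤ m → Hypergraph (m ℕ.* (k ∸ 1)) m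
hypercycle {k} {m} 3≤k _ = record
  { edge           = hyperedge k m
  ; edge-injective = hyperedge-injective k m 3≤k
  }

------------------------------------------------------------------------
-- Enumerations

-- All of [n]^r.
tuples : ∀ n r → List (Vec (Fin n) r)
tuples n zero    = [] ∷ []
tuples n (suc r) = List.cartesianProductWith _∷_ (allFin n) (tuples n r)

-- All (d₁ , … , dₙ) with dᵢ ≥ 0 and d₁ + ⋯ + dₙ = d.
compositions : ∀ n → ℕ → List (Vec ℕ n)
compositions zero    zero    = [] ∷ []
compositions zero    (suc d) = []
compositions (suc n) d       =
  List.concatMap (λ e → List.map (e ∷_) (compositions n (d ∸ e))) (upTo (suc d))

module _ {c ℓ₁ ℓ₂ ℓ₃} (F : OrderedField c ℓ₁ ℓ₂ ℓ₃) where

  open OrderedField F hiding (refl; sym; trans)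
  private module F = OrderedField F

  ----------------------------------------------------------------------
  -- Scalars

  ∑ : List Carrier → Carrier
  ∑ = List.foldr _+_ 0#

  fromℕ : ℕ → Carrier
  fromℕ zero    = 0#
  fromℕ (suc n) = 1# + fromℕ n

  0<fromℕ : ∀ n → .{{ℕ.NonZero n}} → 0# < fromℕ n
  0<fromℕ (suc zero)    = <-respʳ-≈ (F.sym (+-identityʳ 1#)) 0<1
  0<fromℕ (suc (suc n)) = <-trans (0<fromℕ (suc n))
    (<-respˡ-≈ (+-identityˡ _) (+-monoˡ-< (fromℕ (suc n)) 0<1))

  -- The inverse of n! (which #⇒invertible sees as n! - 0).
  1/_! : ℕ → Carrier
  1/ n ! = proj₁ (#⇒invertible {fromℕ (n !)} {0#}
    (Equivalence.from #⇔<⊎> (inj₂ (0<fromℕ (n !) {{n ℕ.!≢0}}))))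

  ----------------------------------------------------------------------
  -- Polynomials in indeterminates X: formal sums of terms, where the
  -- monomial x₁x₂⋯xᵣ is listed factor by factor, in any order.

  Monomial : Set → Set
  Monomial X = List X

  Poly : Set → Set c
  Poly X = List (Carrier × Monomial X)

  module _ {X : Set} where

    constant : Carrier → Poly X
    constant a = (a , []) ∷ []

    indeterminate : X → Poly X
    indeterminate x = (1# , x ∷ []) ∷ []

    infixr 7 _•_
    _•_ : Carrier → Poly X → Poly X
    a • p = List.map (λ (b , w) → a * b , w) p

    ∑ᴾ : List (Poly X) → Poly X
    ∑ᴾ = List.concat

    infixl 7 _*ᴾ_
    _*ᴾ_ : Poly X → Poly X → Poly X
    _*ᴾ_ = List.cartesianProductWith (λ (a , w) (b , w′) → a * b , w ++ w′)

    constantTerm : Poly X → Carrier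
    constantTerm []                 = 0#
    constantTerm ((a , [])    ∷ p)  = a + constantTerm p
    constantTerm ((a , _ ∷ _) ∷ p)  = constantTerm p

  module Derivative {X : Set} (_≟ˣ_ : DecidableEquality X) where

    -- Leibniz rule: one summand for each occurrence of x in the monomial.
    ∂ᴹ : X → Monomial X → List (Monomial X)
    ∂ᴹ x []      = []
    ∂ᴹ x (y ∷ w) =
      (if does (x ≟ˣ y) then w ∷ [] else []) ++ List.map (y ∷_) (∂ᴹ x w)

    ∂ : X → Poly X → Poly X
    ∂ x = List.concatMap (λ (a , w) → List.map (a ,_) (∂ᴹ x w))

  ----------------------------------------------------------------------
  -- Tensors and their traces

  -- The entry at (i₁ , i₂ , … , iₖ) of a tensor T of order k ≥ 1 and
  -- dimension n is T i₁ (i₂ ∷ … ∷ iₖ ∷ []).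
  Tensor : ℕ → ℕ → Set c
  Tensor k n = Fin n → Vec (Fin n) (k ∸ 1) → Carrier

  module Trace (k : ℕ) {n : ℕ} (T : Tensor k n) where

    Entry : Set
    Entry = Fin n × Fin n

    open Derivative {Entry} (Product.≡-dec _≟_ _≟_) using (∂)

    -- Powers of the matrix A = (aᵢⱼ) of indeterminates.
    A^ : ℕ → Fin n → Fin n → Poly Entry
    A^ zero    i j = constant (if does (i ≟ j) then 1# else 0#)
    A^ (suc N) i j =
      ∑ᴾ (List.map (λ l → indeterminate (i , l) *ᴾ A^ N l j) (allFin n))

    trA^ : ℕ → Poly Entry
    trA^ N = ∑ᴾ (List.map (λ i → A^ N i i) (allFin n))

    ∂γ : ∀ {r} → Fin n → Vec (Fin n) r → Poly Entry → Poly Entry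
    ∂γ i []      p = p
    ∂γ i (j ∷ γ) p = ∂ (i , j) (∂γ i γ p)

    -- ∑_γ T_{iγ} ∂/∂a_{iγ}
    Δ : Fin n → Poly Entry → Poly Entry
    Δ i p = ∑ᴾ (List.map (λ γ → T i γ • ∂γ i γ p) (tuples n (k ∸ 1)))

    -- ∏ᵢ 1/(dᵢ(k-1))! Δᵢ^{dᵢ}
    ∏Δ : Vec ℕ n → Poly Entry → Poly Entry
    ∏Δ ds p = List.foldr
      (λ i q → (1/ lookup ds i ℕ.* (k ∸ 1) !) • fold q (Δ i) (lookup ds i))
      p (allFin n)

    -- The polynomial tr(A^{d(k-1)}) is homogeneous of the same degree d(k-1)
    -- as the operators applied to it, so that the result is a constant
    -- polynomial, of which constantTerm is the value.
    Tr : ℕ → Carrier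
    Tr zero      = fromℕ (n ℕ.* (k ∸ 1) ℕ.^ (n ∸ 1))
    Tr d@(suc _) = fromℕ ((k ∸ 1) ℕ.^ (n ∸ 1)) *
      ∑ (List.map (λ ds → constantTerm (∏Δ ds (trA^ (d ℕ.* (k ∸ 1)))))
                  (compositions n d))

  open Trace public using (Tr)

  module _ (k : ℕ) {n m : ℕ} (H : Hypergraph n m) where

    adjacency : Tensor k n
    adjacency i γ =
      if does (IsEdge? H (⋃ (List.map ⁅_⁆ (i ∷ Vec.toList γ))))
      then 1/ (k ∸ 1) !
      else 0#

    degreeTensor : Tensor k n
    degreeTensor i γ =
      if does (Vec.≡-dec _≟_ γ (replicate (k ∸ 1) i))
      then fromℕ (degree H i)
      else 0#

    𝒜 : Carrier → Tensor k n
    𝒜 α i γ = α * degreeTensor i γ + (1# - α) * adjacency i γ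

  ----------------------------------------------------------------------
  -- The S_α-order

  -- The relation holds between hypergraphs with the same number of vertices
  -- only.
  Precedes : (k : ℕ) (α : Carrier) → ∀ {n₁ m₁ n₂ m₂} →
             Hypergraph n₁ m₁ → Hypergraph n₂ m₂ → Set (ℓ₁ ⊔ ℓ₃)
  Precedes k α {n₁} {_} {n₂} H₁ H₂ =
    n₁ ≡ n₂ ×
    ∃[ d ] (1 ℕ.≤ d × d ℕ.≤ n₁ ℕ.* (k ∸ 1) ℕ.^ (n₁ ∸ 1) ∸ 1 ×
            (∀ t → t ℕ.< d → Tr k (𝒜 k H₁ α) t ≈ Tr k (𝒜 k H₂ α) t) ×
            Tr k (𝒜 k H₁ α) d < Tr k (𝒜 k H₂ α) d)

  IsFirst : (k : ℕ) (α : Carrier) {m : ℕ} →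
            (∀ {n} → Hypergraph n m → Set) →
            ∀ {n} → Hypergraph n m → Set (ℓ₁ ⊔ ℓ₃)
  IsFirst k α {m} Class X =
    Class X ×
    (∀ {n} (H : Hypergraph n m) → Class H → ¬ (H ≅ X) → Precedes k α X H)

{-# OPTIONS --safe #-}
module Submission where

-- The constant term of a product of derivatives of tr(A^N) counts the orderings
-- of the arcs (i , j), one for each ∂/∂aᵢⱼ, that form a closed walk.  Hence, up
-- to factors depending only on t, k and n, Tr_t is a sum over words of t letters
-- (i , γ), each weighted by entries of the tensor, where a word contributes only
-- if its arcs form a balanced connected digraph.  For t ≤ k + 2 linearity leaves
-- two kinds of contributing words: loops at a single vertex, and the k rootings
-- of one hyperedge e together with t − k ≤ 2 loops at vertices of e.  With d the
-- degrees, and D(e) the sum of the degrees of the vertices of e, this gives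
--   Tr₂ = A Σᵢ dᵢ² and Tr_{k+2} = (a function of the degree sequence) + B Σₑ D(e)²
-- with A, B > 0, the latter because complete digraphs are Eulerian; the traces
-- Tr_t with t < k + 2 depend on the degree sequence only.
--
-- A linear unicyclic hypergraph has n = m(k − 1) vertices, so that Σ dᵢ = mk
-- is fixed.  If some degree exceeds 2, then Σ dᵢ² is larger than for the
-- hypercycle, and d = 2 decides.  Otherwise the degree sequences agree,
-- Σₑ D(e) = Σ dᵢ² = m(k + 2), and Σₑ D(e)² is larger unless D(e) = k + 2 for all
-- e, in which case following the cycle identifies the hypergraph with the
-- hypercycle.

open import Data.Nat.Base using (ℕ; _≤_)
open import Defs

open import Data.Bool.Base using (Bool; true; false; if_then_else_)
open import Data.Empty using (⊥-elim)
open import Data.Fin.Base as Fin using (Fin; zero; suc)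
open import Data.Fin.Properties using (_≟_)
open import Data.List.Base as List using (List; []; _∷_; _++_; allFin; length)
open import Data.Nat.Base as ℕ using (zero; suc; s≤s; z≤n)
open import Data.Product.Base as Product using (∃-syntax; Σ-syntax; _×_; _,_; proj₁; proj₂)
open import Data.Sum.Base as Sum using (_⊎_; inj₁; inj₂)
open import Data.Vec.Base as Vec using (Vec; []; _∷_; lookup; tabulate; replicate; toList)
open import Function.Base using (_∘_; id; case_of_)
open import Function.Bundles using (_⇔_; mk⇔; Equivalence)
open import Function.Definitions using (Injective)
open import Relation.Binary.PropositionalEquality as ≡ using (_≡_; _≢_; cong; cong₂; subst)
open import Relation.Nullary using (¬_; Dec; yes; no; does)
open import Relation.Nullary.Decidable using (dec-true; dec-false; does-⇔; _⊎-dec_)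
import Data.List.Membership.Propositional as List
import Data.List.Properties as List
import Data.Nat.Properties as ℕ
import Data.Vec.Properties as Vec

-- Which words survive is a matter of divisibility. Balance at a vertex z makes the number of edge
-- letters through z equal to k times the number rooted at z. Below length 2k the quotient is 0 or
-- 1, and double counting with linearity leaves k letters of one hyperedge. The bound 2k exceeds k +
-- 2 exactly when k ≥ 3.
--
-- The constants A and B are never computed. Relabelling along an enumeration of a hyperedge moves
-- its contribution to a hypergraph with a single hyperedge, so the coefficients depend neither on
-- the hypergraph nor on e. Permuting the k vertices there leaves two coefficients for two loops:
-- equal roots and distinct roots. The quadratic form in the loop weights is then a multiple of the
-- sum of squares plus a multiple of D(e)². Only the second multiple needs a sign, and a single word
-- with a nonzero count supplies it.
--
-- The order of the field is not decidable, so signs come from sums of terms that are visibly zero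
-- or positive.
--
-- The count n = m(k - 1) comes from adding hyperedges one at a time to a connected part: each new
-- one meets it in one vertex, except a single one that meets it in two.

module FiniteSums where

  -- Finite sums in commutative monoids and their restriction along injections

  open import Algebra.Bundles using (CommutativeMonoid)
  open import Data.Fin.Properties using (any?)
  open import Data.List.Base using (concatMap; cartesianProductWith)
  open import Data.List.Membership.Propositional using (_∈_)
  open import Data.List.Properties using (map-tabulate)
  open import Data.List.Relation.Binary.Permutation.Propositional as Perm using (_↭_)
  open import Data.List.Relation.Unary.Any using (here; there)
  open import Relation.Binary.PropositionalEquality using (refl)
  import Level

  allFin-suc : ∀ n → allFin (suc n) ≡ zero ∷ List.map suc (allFin n)
  allFin-suc n = cong (zero ∷_) (≡.sym (map-tabulate id suc))

  module FiniteSum {c ℓ} (M : CommutativeMonoid c ℓ) where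

    open CommutativeMonoid M renaming (refl to ≈-refl; sym to ≈-sym; trans to ≈-trans; reflexive to ≈-reflexive)
    open import Relation.Binary.Reasoning.Setoid setoid
    open import Algebra.Properties.CommutativeSemigroup commutativeSemigroup using (interchange; x∙yz≈y∙xz)

    private variable
      a b : Level.Level
      A B C : Set a

    -- Instantiated three times: at addition of naturals, at addition in the field, and at
    -- multiplication in the field, where it is called `product`. Lists as index sets fit the
    -- enumerations in the definition of the trace.
    sum : List A → (A → Carrier) → Carrier
    sum []       f = ε
    sum (x ∷ xs) f = f x ∙ sum xs f

    infix 5 _when_
    _when_ : Carrier → Bool → Carrier
    x when b = if b then x else ε

    sum-cong : ∀ (xs : List A) {f g : A → Carrier} → (∀ x → f x ≈ g x) → sum xs f ≈ sum xs g
    sum-cong []       eq = ≈-refl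
    sum-cong (x ∷ xs) eq = ∙-cong (eq x) (sum-cong xs eq)

    sum-cong-∈ : ∀ (xs : List A) {f g : A → Carrier} → (∀ x → x ∈ xs → f x ≈ g x) → sum xs f ≈ sum xs g
    sum-cong-∈ []       eq = ≈-refl
    sum-cong-∈ (x ∷ xs) eq = ∙-cong (eq x (here refl)) (sum-cong-∈ xs λ y y∈ → eq y (there y∈))

    sum-ε : ∀ (xs : List A) {f : A → Carrier} → (∀ x → f x ≈ ε) → sum xs f ≈ ε
    sum-ε []       eq = ≈-refl
    sum-ε (x ∷ xs) eq = ≈-trans (∙-cong (eq x) (sum-ε xs eq)) (identityˡ ε)

    sum-∙ : ∀ (xs : List A) (f g : A → Carrier) → sum xs (λ x → f x ∙ g x) ≈ sum xs f ∙ sum xs g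
    sum-∙ []       f g = ≈-sym (identityˡ ε)
    sum-∙ (x ∷ xs) f g = ≈-trans (∙-congˡ (sum-∙ xs f g)) (interchange _ _ _ _)

    sum-++ : ∀ (xs ys : List A) (f : A → Carrier) → sum (xs ++ ys) f ≈ sum xs f ∙ sum ys f
    sum-++ []       ys f = ≈-sym (identityˡ _)
    sum-++ (x ∷ xs) ys f = ≈-trans (∙-congˡ (sum-++ xs ys f)) (≈-sym (assoc _ _ _))

    sum-map : ∀ (h : A → B) xs (f : B → Carrier) → sum (List.map h xs) f ≡ sum xs (f ∘ h)
    sum-map h []       f = refl
    sum-map h (x ∷ xs) f = cong (f (h x) ∙_) (sum-map h xs f)

    sum-concatMap : ∀ (h : A → List B) xs (f : B → Carrier) → sum (concatMap h xs) f ≈ sum xs (λ x → sum (h x) f)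
    sum-concatMap h []       f = ≈-refl
    sum-concatMap h (x ∷ xs) f = ≈-trans (sum-++ (h x) _ f) (∙-congˡ (sum-concatMap h xs f))

    sum-cartesian : ∀ (h : A → B → C) xs ys (f : C → Carrier) →
      sum (cartesianProductWith h xs ys) f ≈ sum xs (λ x → sum ys (λ y → f (h x y)))
    sum-cartesian h []       ys f = ≈-refl
    sum-cartesian h (x ∷ xs) ys f = ≈-trans (sum-++ (List.map (h x) ys) _ f)
      (∙-cong (≈-reflexive (sum-map (h x) ys f)) (sum-cartesian h xs ys f))

    sum-swap : ∀ (xs : List A) (ys : List B) (f : A → B → Carrier) →
      sum xs (λ x → sum ys (f x)) ≈ sum ys (λ y → sum xs (λ x → f x y))
    sum-swap []       ys f = ≈-sym (sum-ε ys (λ _ → ≈-refl))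
    sum-swap (x ∷ xs) ys f = ≈-trans (∙-congˡ (sum-swap xs ys f)) (≈-sym (sum-∙ ys _ _))

    sum-↭ : ∀ {xs ys : List A} (f : A → Carrier) → xs ↭ ys → sum xs f ≈ sum ys f
    sum-↭ f Perm.refl         = ≈-refl
    sum-↭ f (Perm.prep x p)   = ∙-congˡ (sum-↭ f p)
    sum-↭ f (Perm.swap x y p) = ≈-trans (x∙yz≈y∙xz _ _ _) (∙-congˡ (∙-congˡ (sum-↭ f p)))
    sum-↭ f (Perm.trans p q)  = ≈-trans (sum-↭ f p) (sum-↭ f q)

    sum-when : ∀ (xs : List A) (f : A → Carrier) b → sum xs (λ x → f x when b) ≈ (sum xs f when b)
    sum-when xs f true  = ≈-refl
    sum-when xs f false = sum-ε xs (λ _ → ≈-refl)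

    sum-allFin-suc : ∀ n (f : Fin (suc n) → Carrier) → sum (allFin (suc n)) f ≈ f zero ∙ sum (allFin n) (f ∘ suc)
    sum-allFin-suc n f = ∙-congˡ (≈-reflexive
      (≡.trans (cong (λ l → sum l f) (≡.sym (map-tabulate id suc))) (sum-map suc (allFin n) f)))

    sum-delta : ∀ {n} (i : Fin n) (f : Fin n → Carrier) → sum (allFin n) (λ j → f j when does (j ≟ i)) ≈ f i
    sum-delta {suc n} zero    f = ≈-trans (sum-allFin-suc n _)
      (≈-trans (∙-congˡ (sum-ε (allFin n) (λ _ → ≈-refl))) (identityʳ _))
    sum-delta {suc n} (suc i) f = ≈-trans (sum-allFin-suc n _)
      (≈-trans (identityˡ _) (sum-delta i (f ∘ suc)))

    when-cong : ∀ {x y} b → x ≈ y → (x when b) ≈ (y when b)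
    when-cong true  eq = eq
    when-cong false eq = ≈-refl

    -- If `f` vanishes off the image of `ι`, its sum may be taken over `bs`. This carries sums over
    -- all words on the vertices of a hypergraph to words on the vertices of one hyperedge.
    Restricts : {A : Set a} {B : Set b} → (B → A) → List B → List A → Set _
    Restricts {A = A} ι bs as = ∀ (f : A → Carrier) → (∀ x → (∀ y → x ≢ ι y) → f x ≈ ε) →
      sum as f ≈ sum bs (f ∘ ι)

    -- Each term is spread over the indices `j` with `i ≡ ι j`, of which injectivity allows at most
    -- one. After the sums are exchanged, `sum-delta` evaluates the inner one.
    restricts-allFin : ∀ {k n} (ι : Fin k → Fin n) → Injective _≡_ _≡_ ι →
      Restricts ι (allFin k) (allFin n)
    restricts-allFin {k} {n} ι ι-inj f f-off = begin
      sum (allFin n) f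
        ≈⟨ sum-cong (allFin n) split ⟩
      sum (allFin n) (λ i → sum (allFin k) (λ j → f i when does (i ≟ ι j)))
        ≈⟨ sum-swap (allFin n) (allFin k) _ ⟩
      sum (allFin k) (λ j → sum (allFin n) (λ i → f i when does (i ≟ ι j)))
        ≈⟨ sum-cong (allFin k) (λ j → sum-delta (ι j) f) ⟩
      sum (allFin k) (f ∘ ι) ∎
      where
      split : ∀ i → f i ≈ sum (allFin k) (λ j → f i when does (i ≟ ι j))
      split i with any? (λ j → i ≟ ι j)
      ... | no off = ≈-trans (f-off i λ j eq → off (j , eq))
        (≈-sym (sum-ε (allFin k) λ j →
          ≈-reflexive (cong (f i when_) (dec-false (i ≟ ι j) λ eq → off (j , eq)))))
      ... | yes (j₀ , refl) = ≈-sym (≈-trans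
        (sum-cong (allFin k) λ j → ≈-reflexive (cong (f i when_) (same j)))
        (sum-delta j₀ (λ _ → f i)))
        where
        same : ∀ j → does (ι j₀ ≟ ι j) ≡ does (j ≟ j₀)
        same j with j ≟ j₀
        ... | yes refl = dec-true (ι j ≟ ι j) refl
        ... | no  j≢   = dec-false (ι j₀ ≟ ι j) λ eq → j≢ (≡.sym (ι-inj eq))

    -- By `inv`, a pair with one component off its image is off the image of `ι`, so the two sums
    -- restrict one after the other.
    restricts-cartesian : ∀ {a₁ a₂ b₁ b₂ c₁ c₂} {A₁ : Set a₁} {A₂ : Set a₂} {B₁ : Set b₁} {B₂ : Set b₂}
      {C : Set c₁} {D : Set c₂} {ι₁ : B₁ → A₁} {ι₂ : B₂ → A₂} {ι : D → C}
      bs₁ as₁ bs₂ as₂ (h : A₁ → A₂ → C) (h′ : B₁ → B₂ → D) →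
      (∀ x y → ι (h′ x y) ≡ h (ι₁ x) (ι₂ y)) →
      (∀ x y z → h x y ≡ ι z → (∃[ x′ ] x ≡ ι₁ x′) × (∃[ y′ ] y ≡ ι₂ y′)) →
      Restricts ι₁ bs₁ as₁ → Restricts ι₂ bs₂ as₂ →
      Restricts ι (cartesianProductWith h′ bs₁ bs₂) (cartesianProductWith h as₁ as₂)
    restricts-cartesian {ι₁ = ι₁} {ι₂} {ι} bs₁ as₁ bs₂ as₂ h h′ hom inv r₁ r₂ f f-off = begin
      sum (cartesianProductWith h as₁ as₂) f
        ≈⟨ sum-cartesian h as₁ as₂ f ⟩
      sum as₁ (λ x → sum as₂ (λ y → f (h x y)))
        ≈⟨ r₁ _ (λ x off → sum-ε as₂ λ y → f-off _ λ z eq →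
             let ((x′ , eq′) , _) = inv x y z eq in off x′ eq′) ⟩
      sum bs₁ (λ x → sum as₂ (λ y → f (h (ι₁ x) y)))
        ≈⟨ sum-cong bs₁ (λ x → r₂ _ λ y off → f-off _ λ z eq →
             let (_ , (y′ , eq′)) = inv (ι₁ x) y z eq in off y′ eq′) ⟩
      sum bs₁ (λ x → sum bs₂ (λ y → f (h (ι₁ x) (ι₂ y))))
        ≈⟨ sum-cong bs₁ (λ x → sum-cong bs₂ λ y → ≈-reflexive (cong f (≡.sym (hom x y)))) ⟩
      sum bs₁ (λ x → sum bs₂ (λ y → f (ι (h′ x y))))
        ≈⟨ sum-cartesian h′ bs₁ bs₂ (f ∘ ι) ⟨
      sum (cartesianProductWith h′ bs₁ bs₂) (f ∘ ι) ∎

    restricts-tuples : ∀ {k n} (ι : Fin k → Fin n) → Injective _≡_ _≡_ ι → ∀ r →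
      Restricts (Vec.map ι) (tuples k r) (tuples n r)
    restricts-tuples ι ι-inj zero    f f-off = ≈-refl
    restricts-tuples {k} {n} ι ι-inj (suc r) = restricts-cartesian (allFin k) (allFin n) (tuples k r) (tuples n r) _∷_ _∷_ (λ _ _ → refl)
      (λ { x y (x′ ∷ y′) refl → (x′ , refl) , (y′ , refl) })
      (restricts-allFin ι ι-inj) (restricts-tuples ι ι-inj r)

-- Counting the orderings of arcs that form walks

module Walks where

  open import Data.List.Relation.Binary.Permutation.Propositional as Perm using (_↭_)
  import Data.List.Relation.Binary.Permutation.Propositional.Properties as Perm
  open import Data.List.Membership.Propositional using (_∈_)
  open import Data.List.Membership.Propositional.Properties using (∈-map⁻)
  open import Data.List.Relation.Unary.Any using (here; there)
  open import Data.Nat.Base using (_+_)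
  open import Relation.Binary.PropositionalEquality using (refl; sym; trans)
  open FiniteSums

  module ℕ∑ = FiniteSum ℕ.+-0-commutativeMonoid
  open ℕ∑ using (_when_)
  open ℕ∑ public using () renaming (sum to ∑ℕ)

  -- Equal entries at different positions are picked separately, as in the Leibniz rule, where each
  -- occurrence of an indeterminate gives its own summand.
  picks : ∀ {a} {A : Set a} → List A → List (A × List A)
  picks []       = []
  picks (x ∷ xs) = (x , xs) ∷ List.map (Product.map₂ (x ∷_)) (picks xs)

  picks-map : ∀ {a b} {A : Set a} {B : Set b} (h : A → B) xs →
    picks (List.map h xs) ≡ List.map (Product.map h (List.map h)) (picks xs)
  picks-map h []       = refl
  picks-map h (x ∷ xs) = cong ((h x , List.map h xs) ∷_) (trans (cong (List.map _) (picks-map h xs))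
    (trans (sym (map-∘ (picks xs))) (map-∘ (picks xs))))
    where open import Data.List.Properties using (map-∘)

  picks-↭ : ∀ {a} {A : Set a} (xs : List A) {y ys} → (y , ys) ∈ picks xs → y ∷ ys ↭ xs
  picks-↭ (x ∷ xs) (here refl) = Perm.refl
  picks-↭ (x ∷ xs) (there p) with ∈-map⁻ _ p
  ... | (z , zs) , q , refl = Perm.trans (Perm.swap z x Perm.refl) (Perm.prep x (picks-↭ xs q))

  -- Invariance of `f` in the remainder is what the induction hypothesis of `walks-↭` supplies. For
  -- a swap, the two picks at the front trade places and all others keep both entries.
  ∑-picks-↭ : ∀ {a} {A : Set a} {xs ys : List A} (f : A × List A → ℕ) →
    (∀ y {zs zs′} → zs ↭ zs′ → f (y , zs) ≡ f (y , zs′)) → xs ↭ ys →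
    ∑ℕ (picks xs) f ≡ ∑ℕ (picks ys) f
  ∑-picks-↭ f f-inv Perm.refl = refl
  ∑-picks-↭ f f-inv (Perm.prep {xs} {ys} x p) = cong₂ _+_ (f-inv x p)
    (trans (ℕ∑.sum-map (Product.map₂ (x ∷_)) (picks xs) f)
    (trans (∑-picks-↭ (f ∘ Product.map₂ (x ∷_)) (λ y q → f-inv y (Perm.prep x q)) p)
           (sym (ℕ∑.sum-map (Product.map₂ (x ∷_)) (picks ys) f))))
  ∑-picks-↭ f f-inv (Perm.swap {xs} {ys} x y p) =
    trans (cong (λ z → f (x , y ∷ xs) + (f (y , x ∷ xs) + z)) (twice x y xs))
    (trans (cong₂ (λ a b → a + (b + rest xs)) (f-inv x (Perm.prep y p)) (f-inv y (Perm.prep x p)))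
    (trans (cong (λ z → f (x , y ∷ ys) + (f (y , x ∷ ys) + z))
      (trans (∑-picks-↭ _ (λ z q → f-inv z (Perm.prep x (Perm.prep y q))) p)
      (trans (ℕ∑.sum-cong (picks ys) (λ (z , zs) → f-inv z (Perm.swap x y Perm.refl)))
             (sym (twice y x ys)))))
    (x∙yz≈y∙xz (f (x , y ∷ ys)) (f (y , x ∷ ys)) _)))
    where
    open import Algebra.Properties.CommutativeSemigroup ℕ.+-commutativeSemigroup using (x∙yz≈y∙xz)
    rest : List _ → ℕ
    rest zs = ∑ℕ (picks zs) (f ∘ Product.map₂ (λ z → x ∷ y ∷ z))
    twice : ∀ x y zs →
      ∑ℕ (List.map (Product.map₂ (x ∷_)) (List.map (Product.map₂ (y ∷_)) (picks zs))) f ≡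
      ∑ℕ (picks zs) (f ∘ Product.map₂ (λ z → x ∷ y ∷ z))
    twice x y zs = trans (ℕ∑.sum-map _ (List.map _ (picks zs)) f) (ℕ∑.sum-map _ (picks zs) _)
  ∑-picks-↭ f f-inv (Perm.trans p q) = trans (∑-picks-↭ f f-inv p) (∑-picks-↭ f f-inv q)

  Arc : ℕ → Set
  Arc n = Fin n × Fin n

  -- The number of orderings of the N arcs v that form a walk from i to j.
  walks : ∀ {n} → ℕ → List (Arc n) → Fin n → Fin n → ℕ
  walks zero    []      i j = 1 when does (i ≟ j)
  walks zero    (_ ∷ _) i j = 0
  walks (suc N) v       i j = ∑ℕ (picks v) λ ((a , b) , v′) → walks N v′ b j when does (a ≟ i)

  -- The number of orderings of the N + 1 arcs v that form a closed walk.
  closedWalks : ∀ {n} → ℕ → List (Arc n) → ℕ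
  closedWalks N v = ∑ℕ (picks v) λ ((a , b) , v′) → walks N v′ b a

  walks-↭ : ∀ {n} N {v v′ : List (Arc n)} i j → v ↭ v′ → walks N v i j ≡ walks N v′ i j
  walks-↭ zero {[]} {v′} i j p with refl ← Perm.↭-empty-inv (Perm.↭-sym p) = refl
  walks-↭ zero {x ∷ v} {[]} i j p with () ← Perm.↭-empty-inv p
  walks-↭ zero {x ∷ v} {_ ∷ _} i j p = refl
  walks-↭ (suc N) i j p = ∑-picks-↭ _
    (λ (a , b) q → ℕ∑.when-cong (does (a ≟ i)) (walks-↭ N b j q)) p

  closedWalks-↭ : ∀ {n} N {v v′ : List (Arc n)} → v ↭ v′ → closedWalks N v ≡ closedWalks N v′
  closedWalks-↭ N p = ∑-picks-↭ _ (λ (a , b) q → walks-↭ N b a q) p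

  Letter : ℕ → ℕ → Set
  Letter n r = Fin n × Vec (Fin n) r

  Word : ℕ → ℕ → Set
  Word n r = List (Letter n r)

  arcs : ∀ {n r} → Fin n → Vec (Fin n) r → List (Arc n)
  arcs i γ = List.map (i ,_) (toList γ)

  wordArcs : ∀ {n r} → Word n r → List (Arc n)
  wordArcs = List.concatMap λ (i , γ) → arcs i γ

  does-sym : ∀ {n} (i j : Fin n) → does (i ≟ j) ≡ does (j ≟ i)
  does-sym i j with i ≟ j
  ... | yes refl = sym (dec-true (i ≟ i) refl)
  ... | no i≢j   = sym (dec-false (j ≟ i) (i≢j ∘ sym))

  mapArc : ∀ {k n} → (Fin k → Fin n) → Arc k → Arc n
  mapArc ι = Product.map ι ι

  module _ {k n} (ι : Fin k → Fin n) (ι-inj : Injective _≡_ _≡_ ι) where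

    does-injective : ∀ i j → does (ι i ≟ ι j) ≡ does (i ≟ j)
    does-injective i j with i ≟ j
    ... | yes refl = dec-true (ι i ≟ ι i) refl
    ... | no  i≢j  = dec-false (ι i ≟ ι j) (i≢j ∘ ι-inj)

    walks-map : ∀ N v i j → walks N (List.map (mapArc ι) v) (ι i) (ι j) ≡ walks N v i j
    walks-map zero    []      i j = cong (1 when_) (does-injective i j)
    walks-map zero    (x ∷ v) i j = refl
    walks-map (suc N) v       i j = trans
      (cong (λ l → ∑ℕ l _) (picks-map (mapArc ι) v)) (trans
      (ℕ∑.sum-map _ (picks v) _)
      (ℕ∑.sum-cong (picks v) λ ((a , b) , v′) →
        cong₂ _when_ (walks-map N v′ b j) (does-injective a i)))

    closedWalks-map : ∀ N v → closedWalks N (List.map (mapArc ι) v) ≡ closedWalks N v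
    closedWalks-map N v = trans
      (cong (λ l → ∑ℕ l _) (picks-map (mapArc ι) v)) (trans
      (ℕ∑.sum-map _ (picks v) _)
      (ℕ∑.sum-cong (picks v) λ ((a , b) , v′) → walks-map N v′ b a))

  -- A witness behind the count: a nonzero value of `walks` yields such an ordering, and such an
  -- ordering makes the value positive.
  data Walk {n} (j : Fin n) : Fin n → List (Arc n) → Set where
    []  : Walk j j []
    _∷_ : ∀ {b v} a → Walk j b v → Walk j a ((a , b) ∷ v)

  ∑ℕ≢0 : ∀ {a} {A : Set a} (xs : List A) {f : A → ℕ} → ∑ℕ xs f ≢ 0 → ∃[ x ] (x ∈ xs × f x ≢ 0)
  ∑ℕ≢0 []       ≢0 = ⊥-elim (≢0 refl)
  ∑ℕ≢0 (x ∷ xs) {f} ≢0 with f x ℕ.≟ 0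
  ... | no fx≢0 = x , here refl , fx≢0
  ... | yes fx≡0 with ∑ℕ≢0 xs (λ eq → ≢0 (cong₂ _+_ fx≡0 eq))
  ... | y , y∈ , fy≢0 = y , there y∈ , fy≢0

  walks≢0 : ∀ {n} N (v : List (Arc n)) i j → walks N v i j ≢ 0 → ∃[ u ] (u ↭ v × Walk j i u)
  walks≢0 zero [] i j ≢0 with i ≟ j
  ... | yes refl = [] , Perm.refl , []
  ... | no _     = ⊥-elim (≢0 refl)
  walks≢0 zero (_ ∷ _) i j ≢0 = ⊥-elim (≢0 refl)
  walks≢0 (suc N) v i j ≢0 with ∑ℕ≢0 (picks v) ≢0
  ... | ((a , b) , v′) , p , ≢0′ with a ≟ i
  ... | no _ = ⊥-elim (≢0′ refl)
  ... | yes refl with walks≢0 N v′ b j ≢0′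
  ... | u , u↭v′ , w = _ , Perm.trans (Perm.prep _ u↭v′) (picks-↭ v p) , a ∷ w

  closedWalks≢0 : ∀ {n} N (v : List (Arc n)) → closedWalks N v ≢ 0 → ∃[ i ] ∃[ u ] (u ↭ v × Walk i i u)
  closedWalks≢0 N v ≢0 with ∑ℕ≢0 (picks v) ≢0
  ... | ((a , b) , v′) , p , ≢0′ with walks≢0 N v′ b a ≢0′
  ... | u , u↭v′ , w = a , _ , Perm.trans (Perm.prep _ u↭v′) (picks-↭ v p) , a ∷ w

  0<walks : ∀ {n} {i j : Fin n} {u} → Walk j i u → 0 ℕ.< walks (List.length u) u i j
  0<walks {i = i} [] rewrite dec-true (i ≟ i) refl = ℕ.s≤s ℕ.z≤n
  0<walks {i = i} (_ ∷ w) rewrite dec-true (i ≟ i) refl = ℕ.<-≤-trans (0<walks w) (ℕ.m≤m+n _ _)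

  0<closedWalks : ∀ {n N} {i : Fin n} {u} → Walk i i u → List.length u ≡ suc N → 0 ℕ.< closedWalks N u
  0<closedWalks (_ ∷ w) refl = ℕ.<-≤-trans (0<walks w) (ℕ.m≤m+n _ _)

  walk-inside : ∀ {n} {i j : Fin n} {u} {P : Fin n → Set} → Walk j i u →
    (∀ {a b} → (a , b) ∈ u → P a → P b) → P i → ∀ {a b} → (a , b) ∈ u → P a
  walk-inside (_ ∷ w) fwd Pi (here refl) = Pi
  walk-inside (_ ∷ w) fwd Pi (there p)   = walk-inside w (fwd ∘ there) (fwd (here refl) Pi) p

  outdegree indegree : ∀ {n} → Fin n → List (Arc n) → ℕ
  outdegree z v = ∑ℕ v λ (a , b) → 1 when does (a ≟ z)
  indegree  z v = ∑ℕ v λ (a , b) → 1 when does (b ≟ z)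

  -- The start is left once more than it is entered, the end entered once more than it is left. Both
  -- corrections are added rather than subtracted; for a closed walk they cancel.
  walk-balance : ∀ {n} {i j : Fin n} {u} z → Walk j i u →
    outdegree z u + (1 when does (j ≟ z)) ≡ indegree z u + (1 when does (i ≟ z))
  walk-balance z [] = refl
  walk-balance {i = i} {j} {(a , b) ∷ v} z (_ ∷ w) = begin
    (p + outdegree z v) + s ≡⟨ ℕ.+-assoc p _ s ⟩
    p + (outdegree z v + s) ≡⟨ cong (p +_) (walk-balance z w) ⟩
    p + (indegree z v + q)  ≡⟨ ℕ.+-comm p _ ⟩
    (indegree z v + q) + p  ≡⟨ cong (_+ p) (ℕ.+-comm _ q) ⟩
    (q + indegree z v) + p  ∎
    where
    open ≡.≡-Reasoning
    p q s : ℕ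
    p = 1 when does (a ≟ z)
    q = 1 when does (b ≟ z)
    s = 1 when does (j ≟ z)

  closedWalks-balance : ∀ {n} N (v : List (Arc n)) → closedWalks N v ≢ 0 →
    ∀ z → outdegree z v ≡ indegree z v
  closedWalks-balance N v ≢0 z with closedWalks≢0 N v ≢0
  ... | i , u , u↭v , w = trans (ℕ∑.sum-↭ _ (Perm.↭-sym u↭v))
    (trans (ℕ.+-cancelʳ-≡ _ (outdegree z u) (indegree z u) (walk-balance z w)) (ℕ∑.sum-↭ _ u↭v))

  -- The ordering may start anywhere. If `P` holds at its start, it spreads forward to all arcs; if
  -- not, its negation spreads, by the contrapositive of `bwd`, and contradicts `P a`.
  closedWalks-connected : ∀ {n} N (v : List (Arc n)) → closedWalks N v ≢ 0 →
    (P : Fin n → Set) → (∀ x → Dec (P x)) →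
    (∀ {a b} → (a , b) ∈ v → P a → P b) → (∀ {a b} → (a , b) ∈ v → P b → P a) →
    ∀ {a b c d} → (a , b) ∈ v → P a → (c , d) ∈ v → P c
  closedWalks-connected N v ≢0 P P? fwd bwd ab∈ Pa cd∈ with closedWalks≢0 N v ≢0
  ... | i , u , u↭v , w with P? i
  ... | yes Pi = walk-inside w (fwd ∘ Perm.∈-resp-↭ u↭v) Pi (Perm.∈-resp-↭ (Perm.↭-sym u↭v) cd∈)
  ... | no ¬Pi = ⊥-elim (walk-inside {P = ¬_ ∘ P} w (λ e ¬Pa Pb → ¬Pa (bwd (Perm.∈-resp-↭ u↭v e) Pb)) ¬Pi
                   (Perm.∈-resp-↭ (Perm.↭-sym u↭v) ab∈) Pa)

-- The shape of the words that contribute to the trace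

module Words where

  import Data.Bool.Properties as Bool
  open import Data.Empty using (⊥)
  open import Data.Fin.Subset using (Subset; ⊤; ⁅_⁆; ⋃; _∩_; ∣_∣; _∈_)
  open import Data.Fin.Subset.Properties
    using (∉⊥; x∈⁅x⁆; x∈⁅y⁆⇒x≡y; x∈p∪q⁻; x∈p∪q⁺; ⊆-antisym; ∣⁅x⁆∣≡1; ∣⊤∣≡n; _∈?_)
  open import Data.List.Membership.Propositional using () renaming (find to find∈)
  open import Data.List.Membership.Propositional.Properties
    using (∈-allFin; ∈-map⁻; ∈-concatMap⁻; ∈-concatMap⁺)
  open import Data.List.Relation.Unary.All as All using (All; []; _∷_)
  open import Data.List.Relation.Unary.Any as Any using (Any; here; there)
  open import Data.Nat.Base using (_+_; _*_; _<_)
  open import Relation.Binary.PropositionalEquality using (refl; sym; trans)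
  open FiniteSums
  open Walks

  𝟙 : Bool → ℕ
  𝟙 b = 1 ℕ∑.when b

  ∈⇒lookup : ∀ {n x} {S : Subset n} → x ∈ S → lookup S x ≡ true
  ∈⇒lookup = Vec.[]=⇒lookup

  lookup⇒∈ : ∀ {n x} {S : Subset n} → lookup S x ≡ true → x ∈ S
  lookup⇒∈ {x = x} {S} = Vec.lookup⇒[]= x S

  ∣∣≡∑ : ∀ {n} (S : Subset n) → ∣ S ∣ ≡ ∑ℕ (allFin n) (λ x → 𝟙 (lookup S x))
  ∣∣≡∑ []          = refl
  ∣∣≡∑ {suc n} (true ∷ S)  = trans (cong suc (∣∣≡∑ S)) (sym (ℕ∑.sum-allFin-suc n (λ x → 𝟙 (lookup (true ∷ S) x))))
  ∣∣≡∑ {suc n} (false ∷ S) = trans (∣∣≡∑ S) (sym (ℕ∑.sum-allFin-suc n (λ x → 𝟙 (lookup (false ∷ S) x))))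

  ∑-mono : ∀ {a} {A : Set a} (xs : List A) {f g : A → ℕ} → (∀ x → f x ≤ g x) → ∑ℕ xs f ≤ ∑ℕ xs g
  ∑-mono []       le = z≤n
  ∑-mono (x ∷ xs) le = ℕ.+-mono-≤ (le x) (∑-mono xs le)

  ∑-mono-∈ : ∀ {a} {A : Set a} (xs : List A) {f g : A → ℕ} → (∀ x → x List.∈ xs → f x ≤ g x) → ∑ℕ xs f ≤ ∑ℕ xs g
  ∑-mono-∈ []       le = z≤n
  ∑-mono-∈ (x ∷ xs) le = ℕ.+-mono-≤ (le x (here refl)) (∑-mono-∈ xs λ y y∈ → le y (there y∈))

  term≤∑ : ∀ {a} {A : Set a} {xs : List A} {f : A → ℕ} {x} → x List.∈ xs → f x ≤ ∑ℕ xs f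
  term≤∑ (here refl) = ℕ.m≤m+n _ _
  term≤∑ {f = f} (there {x = y} p) = ℕ.≤-trans (term≤∑ p) (ℕ.m≤n+m _ (f y))

  ∑-mono-tight : ∀ {a} {A : Set a} (xs : List A) {f g : A → ℕ} → (∀ x → f x ≤ g x) →
    ∑ℕ xs g ≤ ∑ℕ xs f → ∀ {x} → x List.∈ xs → f x ≡ g x
  ∑-mono-tight (x ∷ xs) {f} {g} le eq (here refl) = ℕ.≤-antisym (le x)
    (ℕ.+-cancelʳ-≤ (∑ℕ xs f) (g x) (f x) (ℕ.≤-trans (ℕ.+-monoʳ-≤ (g x) (∑-mono xs le)) eq))
  ∑-mono-tight (x ∷ xs) {f} {g} le eq (there p) = ∑-mono-tight xs le
    (ℕ.+-cancelˡ-≤ (f x) _ _ (ℕ.≤-trans (ℕ.+-monoˡ-≤ (∑ℕ xs g) (le x)) eq)) p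

  ∑-*ˡ : ∀ {a} {A : Set a} c (xs : List A) (f : A → ℕ) → ∑ℕ xs (λ x → c * f x) ≡ c * ∑ℕ xs f
  ∑-*ˡ c []       f = sym (ℕ.*-zeroʳ c)
  ∑-*ˡ c (x ∷ xs) f = trans (cong (c * f x +_) (∑-*ˡ c xs f)) (sym (ℕ.*-distribˡ-+ c (f x) _))

  ∑-const : ∀ {a} {A : Set a} (xs : List A) c → ∑ℕ xs (λ _ → c) ≡ length xs * c
  ∑-const []       c = refl
  ∑-const (x ∷ xs) c = cong (c +_) (∑-const xs c)

  -- Written as in the adjacency tensor, so that the test for a hyperedge there is literally a test
  -- of this subset.
  support : ∀ {n r} → Fin n → Vec (Fin n) r → Subset n
  support i γ = ⋃ (List.map ⁅_⁆ (i ∷ toList γ))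

  ∈-⋃-singletons : ∀ {n} {x : Fin n} xs → x List.∈ xs → x ∈ ⋃ (List.map ⁅_⁆ xs)
  ∈-⋃-singletons (x ∷ xs) (here refl) = x∈p∪q⁺ (inj₁ (x∈⁅x⁆ x))
  ∈-⋃-singletons (y ∷ xs) (there p)   = x∈p∪q⁺ (inj₂ (∈-⋃-singletons xs p))

  ∈-⋃-singletons⁻ : ∀ {n} {x : Fin n} xs → x ∈ ⋃ (List.map ⁅_⁆ xs) → x List.∈ xs
  ∈-⋃-singletons⁻ []       p = ⊥-elim (∉⊥ p)
  ∈-⋃-singletons⁻ (y ∷ xs) p with x∈p∪q⁻ ⁅ y ⁆ _ p
  ... | inj₁ q = here (x∈⁅y⁆⇒x≡y y q)
  ... | inj₂ q = there (∈-⋃-singletons⁻ xs q)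

  ∈-toList-replicate : ∀ {a} {A : Set a} {x y : A} r → x List.∈ toList (replicate r y) → x ≡ y
  ∈-toList-replicate (suc r) (here eq) = eq
  ∈-toList-replicate (suc r) (there p) = ∈-toList-replicate r p

  occurrences : ∀ {n} → Fin n → List (Fin n) → ℕ
  occurrences z xs = ∑ℕ xs λ j → 𝟙 (does (j ≟ z))

  ∈⇒1≤occurrences : ∀ {n} {z : Fin n} {xs} → z List.∈ xs → 1 ≤ occurrences z xs
  ∈⇒1≤occurrences {z = z} p = ℕ.≤-trans (ℕ.≤-reflexive (cong 𝟙 (sym (dec-true (z ≟ z) refl)))) (term≤∑ p)

  ∑-occurrences : ∀ {n} (xs : List (Fin n)) → ∑ℕ (allFin n) (λ z → occurrences z xs) ≡ length xs
  ∑-occurrences {n} xs = trans (ℕ∑.sum-swap (allFin n) xs _)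
    (trans (ℕ∑.sum-cong xs (λ j → trans
      (ℕ∑.sum-cong (allFin n) (λ z → cong 𝟙 (does-sym j z))) (ℕ∑.sum-delta j (λ _ → 1))))
    (trans (∑-const xs 1) (ℕ.*-identityʳ _)))

  -- A support of full size leaves no room for repetitions: the indicator is at most the number of
  -- occurrences everywhere, and both sum to `suc r`.
  support-exact : ∀ {n r} (i : Fin n) (γ : Vec (Fin n) r) → ∣ support i γ ∣ ≡ suc r →
    ∀ z → 𝟙 (lookup (support i γ) z) ≡ occurrences z (i ∷ toList γ)
  support-exact {n} {r} i γ card z = ∑-mono-tight (allFin n) le
    (ℕ.≤-reflexive (trans (∑-occurrences (i ∷ toList γ))
      (trans (cong suc (Vec.length-toList γ)) (trans (sym card) (∣∣≡∑ (support i γ))))))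
    (∈-allFin z)
    where
    le : ∀ z → 𝟙 (lookup (support i γ) z) ≤ occurrences z (i ∷ toList γ)
    le z with lookup (support i γ) z in eq
    ... | false = z≤n
    ... | true  = ∈⇒1≤occurrences (∈-⋃-singletons⁻ (i ∷ toList γ) (lookup⇒∈ eq))

  -- The index of a diagonal entry; all its arcs are loops at `i`.
  IsLoop : ∀ {n r} → Letter n r → Set
  IsLoop {r = r} (i , γ) = γ ≡ replicate r i

  isLoop? : ∀ {n r} (ℓ : Letter n r) → Dec (IsLoop ℓ)
  isLoop? {r = r} (i , γ) = Vec.≡-dec _≟_ γ (replicate r i)

  loopRoots : ∀ {n r} → Word n r → List (Fin n)
  loopRoots []      = []
  loopRoots (ℓ ∷ w) = if does (isLoop? ℓ) then proj₁ ℓ ∷ loopRoots w else loopRoots w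

  nonloop : ∀ {n r} → Letter n r → ℕ
  nonloop ℓ = if does (isLoop? ℓ) then 0 else 1

  nonloops : ∀ {n r} → Word n r → ℕ
  nonloops w = ∑ℕ w nonloop

  loopRoots+nonloops : ∀ {n r} (w : Word n r) → length (loopRoots w) + nonloops w ≡ length w
  loopRoots+nonloops []      = refl
  loopRoots+nonloops (ℓ ∷ w) with does (isLoop? ℓ)
  ... | true  = cong suc (loopRoots+nonloops w)
  ... | false = trans (ℕ.+-suc _ _) (cong suc (loopRoots+nonloops w))

  module _ {n m} (H : Hypergraph n m) where

    IsEdge : ∀ {r} → Fin m → Letter n r → Set
    IsEdge e (i , γ) = edge H e ≡ support i γ

    isEdge? : ∀ {r} e (ℓ : Letter n r) → Dec (IsEdge e ℓ)
    isEdge? e (i , γ) = Vec.≡-dec Bool._≟_ (edge H e) (support i γ)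

    -- The clause with `Any` keeps out words made of loops alone, so that the two shapes of
    -- contributing words are disjoint.
    EdgeWord : ∀ {r} → Fin m → Word n r → Set
    EdgeWord e w = All (λ ℓ → IsLoop ℓ ⊎ IsEdge e ℓ) w × Any (IsEdge e) w

    edgeWord? : ∀ {r} e (w : Word n r) → Dec (EdgeWord e w)
    edgeWord? e w = All.all? (λ ℓ → isLoop? ℓ ⊎-dec isEdge? e ℓ) w ×-dec Any.any? (isEdge? e) w
      where open import Relation.Nullary.Decidable using (_×-dec_)

    module _ {r : ℕ} (1≤r : 1 ≤ r) (uniform : Uniform H (suc r)) where

      edge-notLoop : ∀ {e} {ℓ : Letter n r} → IsEdge e ℓ → ¬ IsLoop ℓ
      edge-notLoop {e} {i , γ} is-e refl = ℕ.<-irrefl refl (ℕ.<-≤-trans (s≤s 1≤r)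
        (ℕ.≤-reflexive (trans (sym (uniform e)) (trans (cong ∣_∣ (trans is-e ⊆-single)) (∣⁅x⁆∣≡1 i)))))
        where
        ⊆-single : support i (replicate r i) ≡ ⁅ i ⁆
        ⊆-single = ⊆-antisym
          (λ p → case ∈-⋃-singletons⁻ (i ∷ toList (replicate r i)) p of λ
             { (here refl) → x∈⁅x⁆ i
             ; (there q)   → subst (_∈ ⁅ i ⁆) (sym (∈-toList-replicate r q)) (x∈⁅x⁆ i) })
          (λ p → ∈-⋃-singletons (i ∷ toList (replicate r i)) (here (x∈⁅y⁆⇒x≡y i p)))

      nonloop-edge : ∀ {e} {ℓ : Letter n r} → IsEdge e ℓ → nonloop ℓ ≡ 1
      nonloop-edge {ℓ = ℓ} is-e rewrite dec-false (isLoop? ℓ) (edge-notLoop is-e) = refl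

      -- Nonloop contributions are moved so that no subtraction occurs.
      letter-balance : ∀ (ℓ : Letter n r) → IsLoop ℓ ⊎ (∃[ e ] IsEdge e ℓ) → ∀ z → let (i , γ) = ℓ in
        outdegree z (arcs i γ) + nonloop ℓ * 𝟙 (lookup (support i γ) z) ≡
        indegree z (arcs i γ) + suc r * (nonloop ℓ * 𝟙 (does (i ≟ z)))
      letter-balance (i , γ) kind z = trans
        (cong₂ _+_ (out γ) refl) (trans (lem kind) (cong (_+ suc r * (nonloop (i , γ) * 𝟙 (does (i ≟ z))))
          (sym (ℕ∑.sum-map (i ,_) (toList γ) _))))
        where
        out : ∀ {s} (γ : Vec (Fin n) s) → outdegree z (arcs i γ) ≡ s * 𝟙 (does (i ≟ z))
        out []      = refl
        out (j ∷ γ) = cong (𝟙 (does (i ≟ z)) +_) (out γ)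
        rep : ∀ s → occurrences z (toList (replicate s i)) ≡ s * 𝟙 (does (i ≟ z))
        rep zero    = refl
        rep (suc s) = cong (𝟙 (does (i ≟ z)) +_) (rep s)
        lem : IsLoop (i , γ) ⊎ (∃[ e ] IsEdge e (i , γ)) →
          r * 𝟙 (does (i ≟ z)) + nonloop (i , γ) * 𝟙 (lookup (support i γ) z) ≡
          occurrences z (toList γ) + suc r * (nonloop (i , γ) * 𝟙 (does (i ≟ z)))
        lem (inj₁ refl) rewrite dec-true (isLoop? (i , replicate r i)) refl | ℕ.*-zeroʳ r =
          cong (_+ 0) (sym (rep r))
        lem (inj₂ (e , is-e)) rewrite nonloop-edge {ℓ = i , γ} is-e
          | support-exact i γ (trans (cong ∣_∣ (sym is-e)) (uniform e)) z
          | ℕ.*-identityˡ (𝟙 (does (i ≟ z))) | ℕ.*-identityˡ (𝟙 (does (i ≟ z)) + occurrences z (toList γ)) =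
          x+[y+w]≡w+[y+x] (r * 𝟙 (does (i ≟ z))) (𝟙 (does (i ≟ z))) _
          where
          x+[y+w]≡w+[y+x] : ∀ x y w → x + (y + w) ≡ w + (y + x)
          x+[y+w]≡w+[y+x] x y w = trans (ℕ.+-comm x _) (trans (cong (_+ x) (ℕ.+-comm y w)) (ℕ.+-assoc w y x))

      -- At `z`, an edge letter rooted there has r arcs out, an edge letter through `z` rooted
      -- elsewhere has one arc in, and loops balance themselves. Equating the two and adding the
      -- letters rooted at `z` to both sides gives the factor `suc r`.
      word-balance : ∀ (w : Word n r) → All (λ ℓ → IsLoop ℓ ⊎ (∃[ e ] IsEdge e ℓ)) w → ∀ N →
        closedWalks N (wordArcs w) ≢ 0 → ∀ z →
        ∑ℕ w (λ ℓ → nonloop ℓ * 𝟙 (lookup (support (proj₁ ℓ) (proj₂ ℓ)) z)) ≡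
        suc r * ∑ℕ w (λ ℓ → nonloop ℓ * 𝟙 (does (proj₁ ℓ ≟ z)))
      word-balance w kinds N ≢0 z = ℕ.+-cancelˡ-≡ (outdegree z (wordArcs w)) _ _ (trans (sums w kinds)
        (cong (_+ suc r * B w) (sym (closedWalks-balance N (wordArcs w) ≢0 z))))
        where
        open import Algebra.Properties.CommutativeSemigroup ℕ.+-commutativeSemigroup using (interchange)
        A B : Word n r → ℕ
        A w = ∑ℕ w (λ ℓ → nonloop ℓ * 𝟙 (lookup (support (proj₁ ℓ) (proj₂ ℓ)) z))
        B w = ∑ℕ w (λ ℓ → nonloop ℓ * 𝟙 (does (proj₁ ℓ ≟ z)))
        sums : ∀ w → All (λ ℓ → IsLoop ℓ ⊎ (∃[ e ] IsEdge e ℓ)) w →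
          outdegree z (wordArcs w) + A w ≡ indegree z (wordArcs w) + suc r * B w
        sums []      []           = sym (ℕ.*-zeroʳ r)
        sums ((i , γ) ∷ w) (kind ∷ kinds) = trans
          (cong (_+ A ((i , γ) ∷ w)) (ℕ∑.sum-++ (arcs i γ) (wordArcs w) _))
          (trans (interchange (outdegree z (arcs i γ)) _ (nonloop (i , γ) * 𝟙 (lookup (support i γ) z)) _)
          (trans (cong₂ _+_ (letter-balance (i , γ) kind z) (sums w kinds))
          (trans (interchange (indegree z (arcs i γ)) _ (indegree z (wordArcs w)) _)
          (cong₂ _+_ (sym (ℕ∑.sum-++ (arcs i γ) (wordArcs w) _))
            (sym (ℕ.*-distribˡ-+ (suc r) (nonloop (i , γ) * 𝟙 (does (i ≟ z))) (B w)))))))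

    module _ {k : ℕ} (3≤k : 3 ≤ k) (uniform : Uniform H k) (linear : Linear H) where

      private
        multiplicityOf : ∀ (E : List (Fin m)) → Fin m → ℕ
        multiplicityOf E e = ∑ℕ E λ f → 𝟙 (does (f ≟ e))

        others : List (Fin m) → Fin m → ℕ
        others E e = ∑ℕ E λ f → 1 ℕ∑.when Data.Bool.Base.not (does (f ≟ e))

        covers : List (Fin m) → Fin n → ℕ
        covers E z = ∑ℕ E λ f → 𝟙 (lookup (edge H f) z)

      edge-nonempty : ∀ e → ∃[ z ] z ∈ edge H e
      edge-nonempty e with ∑ℕ≢0 (allFin n) {λ x → 𝟙 (lookup (edge H e) x)}
        (λ eq → ℕ.<-irrefl (trans (sym eq) (trans (sym (∣∣≡∑ (edge H e))) (uniform e))) (ℕ.≤-trans (s≤s z≤n) 3≤k))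
      ... | z , _ , ≢0 with lookup (edge H e) z in eq
      ... | true  = z , lookup⇒∈ eq
      ... | false = ⊥-elim (≢0 refl)

      module _ (E : List (Fin m)) (short : length E < k + k)
               (covered : ∀ {e z} → e List.∈ E → z ∈ edge H e → covers E z ≡ k) where

        private
          -- Double counting: each of the k vertices of `e` is covered k times by the members of
          -- `E`.
          ∩-sum : ∀ e → e List.∈ E → ∑ℕ E (λ f → ∣ edge H f ∩ edge H e ∣) ≡ k * k
          ∩-sum e e∈ = trans (ℕ∑.sum-cong E (λ f → ∣∣≡∑ (edge H f ∩ edge H e)))
            (trans (ℕ∑.sum-swap E (allFin n) _)
            (trans (ℕ∑.sum-cong (allFin n) pointwise)
            (trans (∑-*ˡ k (allFin n) _) (cong (k *_) (trans (sym (∣∣≡∑ (edge H e))) (uniform e))))))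
            where
            pointwise : ∀ z → ∑ℕ E (λ f → 𝟙 (lookup (edge H f ∩ edge H e) z)) ≡ k * 𝟙 (lookup (edge H e) z)
            pointwise z with lookup (edge H e) z in eq
            ... | false = trans (ℕ∑.sum-ε E λ f → cong 𝟙 (trans
                    (Vec.lookup-zipWith _ z (edge H f) (edge H e))
                    (trans (cong (_ Data.Bool.Base.∧_) eq) (Bool.∧-zeroʳ _)))) (sym (ℕ.*-zeroʳ k))
            ... | true = trans (ℕ∑.sum-cong E λ f → cong 𝟙 (trans
                    (Vec.lookup-zipWith _ z (edge H f) (edge H e))
                    (trans (cong (_ Data.Bool.Base.∧_) eq) (Bool.∧-identityʳ _))))
                    (trans (covered e∈ (lookup⇒∈ eq)) (sym (ℕ.*-identityʳ k)))

          split : ∀ e → multiplicityOf E e + others E e ≡ length E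
          split e = trans (sym (ℕ∑.sum-∙ E _ _)) (trans (ℕ∑.sum-cong E λ f → one (does (f ≟ e)))
            (trans (∑-const E 1) (ℕ.*-identityʳ _)))
            where
            one : ∀ b → 𝟙 b + (1 ℕ∑.when Data.Bool.Base.not b) ≡ 1
            one true  = refl
            one false = refl

          -- A copy of `e` meets `e` in k vertices, any other hyperedge in at most one by linearity.
          ∩-bound : ∀ e → ∑ℕ E (λ f → ∣ edge H f ∩ edge H e ∣) ≤ k * multiplicityOf E e + others E e
          ∩-bound e = ℕ.≤-trans (∑-mono E bound)
            (ℕ.≤-reflexive (trans (ℕ∑.sum-∙ E _ _) (cong (_+ others E e) (∑-*ˡ k E _))))
            where
            bound : ∀ f → ∣ edge H f ∩ edge H e ∣ ≤ k * 𝟙 (does (f ≟ e)) + (1 ℕ∑.when Data.Bool.Base.not (does (f ≟ e)))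
            bound f with f ≟ e
            ... | yes refl = ℕ.≤-trans (∣p∩q∣≤∣p∣ (edge H f) (edge H f))
                    (ℕ.≤-reflexive (trans (uniform f) (sym (trans (ℕ.+-identityʳ _) (ℕ.*-identityʳ k)))))
              where open import Data.Fin.Subset.Properties using (∣p∩q∣≤∣p∣)
            ... | no f≢e = ℕ.≤-trans (linear f≢e) (ℕ.≤-reflexive (cong (_+ 1) (sym (ℕ.*-zeroʳ k))))

          -- If `e` occurs a times and a + 2 ≤ k, the bound gives k² ≤ k a + (number of others) < k
          -- a + 2k = k (a + 2) ≤ k².
          nearlyFull : ∀ e → e List.∈ E → k ≤ suc (multiplicityOf E e)
          nearlyFull e e∈ = ℕ.≮⇒≥ λ lt → ℕ.<-irrefl refl (begin-strict
            k * k                                       ≡⟨ ∩-sum e e∈ ⟨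
            ∑ℕ E (λ f → ∣ edge H f ∩ edge H e ∣)        ≤⟨ ∩-bound e ⟩
            k * multiplicityOf E e + others E e         <⟨ ℕ.+-monoʳ-< (k * multiplicityOf E e)
                (ℕ.≤-<-trans (ℕ.≤-trans (ℕ.m≤n+m _ (multiplicityOf E e)) (ℕ.≤-reflexive (split e))) short) ⟩
            k * multiplicityOf E e + (k + k)            ≡⟨ arith k (multiplicityOf E e) ⟩
            k * (suc (suc (multiplicityOf E e)))        ≤⟨ ℕ.*-monoʳ-≤ k lt ⟩
            k * k                                       ∎)
            where
            open ℕ.≤-Reasoning
            arith : ∀ k a → k * a + (k + k) ≡ k * suc (suc a)
            arith k a = sym (trans (ℕ.*-suc k (suc a)) (trans (cong (k +_) (ℕ.*-suc k a))
              (trans (sym (ℕ.+-assoc k k (k * a))) (ℕ.+-comm (k + k) (k * a)))))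

          both : ∀ {e f} → e ≢ f → multiplicityOf E e + multiplicityOf E f ≤ length E
          both {e} {f} e≢f = ℕ.≤-trans (ℕ.≤-reflexive (sym (ℕ∑.sum-∙ E _ _)))
            (ℕ.≤-trans (∑-mono E (disjoint e≢f)) (ℕ.≤-reflexive (trans (∑-const E 1) (ℕ.*-identityʳ _))))
            where
            disjoint : ∀ {e f} → e ≢ f → ∀ g → 𝟙 (does (g ≟ e)) + 𝟙 (does (g ≟ f)) ≤ 1
            disjoint {e} {f} e≢f g with g ≟ e | g ≟ f
            ... | yes refl | yes refl = ⊥-elim (e≢f refl)
            ... | yes _    | no _     = ℕ.≤-refl
            ... | no _     | yes _    = ℕ.≤-refl
            ... | no _     | no _     = z≤n

          -- If no other member of `E` contains the vertex `z` of `e`, the copies of `e` alone must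
          -- cover it k times. Another hyperedge through `z` would be nearly full as well, and 2 (k
          -- - 1) > k for k ≥ 3 is more than the cover of `z`.
          full : ∀ e → e List.∈ E → k ≤ multiplicityOf E e
          full e e∈ = ℕ.≮⇒≥ λ lt → contra lt
            where
            z = proj₁ (edge-nonempty e)
            z∈e = proj₂ (edge-nonempty e)
            contra : multiplicityOf E e < k → ⊥
            contra lt with Any.any? (λ f → (z ∈? edge H f) ×-dec ¬? (f ≟ e)) E
              where open import Relation.Nullary.Decidable using (_×-dec_; ¬?)
            ... | no none = ℕ.<-irrefl (covered e∈ z∈e) (ℕ.≤-<-trans (∑-mono-∈ E only) lt)
              where
              only : ∀ f → f List.∈ E → 𝟙 (lookup (edge H f) z) ≤ 𝟙 (does (f ≟ e))
              only f f∈ with lookup (edge H f) z in eq | f ≟ e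
              ... | false | _     = z≤n
              ... | true  | yes _ = ℕ.≤-refl
              ... | true  | no f≢e = ⊥-elim (none (List.lose f∈ (lookup⇒∈ eq , f≢e)))
            ... | yes some with find∈ some
            ... | f , f∈ , z∈f , f≢e = ℕ.<-irrefl refl (begin-strict
                k                                            <⟨ twice 3≤k (nearlyFull e e∈) (nearlyFull f f∈) ⟩
                multiplicityOf E e + multiplicityOf E f      ≡⟨ ℕ∑.sum-∙ E _ _ ⟨
                _                                            ≤⟨ ∑-mono E under ⟩
                covers E z                                   ≡⟨ covered e∈ z∈e ⟩
                k                                            ∎)
              where
              open ℕ.≤-Reasoning
              twice : ∀ {k a b} → 3 ≤ k → k ≤ suc a → k ≤ suc b → k < a + b
              twice {k} {a} {b} 3≤k p q = ℕ.s≤s⁻¹ (ℕ.s≤s⁻¹ (ℕ.≤-trans (ℕ.+-monoˡ-≤ k 3≤k)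
                (ℕ.≤-trans (ℕ.+-mono-≤ p q) (ℕ.≤-reflexive (cong suc (ℕ.+-suc a b))))))
              under : ∀ g → 𝟙 (does (g ≟ e)) + 𝟙 (does (g ≟ f)) ≤ 𝟙 (lookup (edge H g) z)
              under g with g ≟ e | g ≟ f
              ... | yes refl | yes refl = ⊥-elim (f≢e refl)
              ... | yes refl | no _     = ℕ.≤-reflexive (cong 𝟙 (sym (∈⇒lookup z∈e)))
              ... | no _     | yes refl = ℕ.≤-reflexive (cong 𝟙 (sym (∈⇒lookup z∈f)))
              ... | no _     | no _     = z≤n

        -- Two different hyperedges would occur k times each, against `short`.
        cover-one-edge : ∀ {e f} → e List.∈ E → f List.∈ E → e ≡ f
        cover-one-edge {e} {f} e∈ f∈ with e ≟ f
        ... | yes e≡f = e≡f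
        ... | no  e≢f = ⊥-elim (ℕ.<-irrefl refl
                (ℕ.<-≤-trans short (ℕ.≤-trans (ℕ.+-mono-≤ (full e e∈) (full f f∈)) (both e≢f))))

        -- All members being equal to `e`, each of them covers a given vertex of `e`, and that
        -- vertex is covered k times.
        cover-length : ∀ {e} → e List.∈ E → length E ≡ k
        cover-length {e} e∈ = trans (sym (trans (∑-const E 1) (ℕ.*-identityʳ _)))
          (trans (ℕ∑.sum-cong-∈ E λ f f∈ → cong 𝟙 (sym (∈⇒lookup
            (subst (λ f → z ∈ edge H f) (cover-one-edge e∈ f∈) z∈e)))) (covered e∈ z∈e))
          where
          z = proj₁ (edge-nonempty e)
          z∈e = proj₂ (edge-nonempty e)

  ∈-arcs⁻ : ∀ {n r} {i : Fin n} {γ : Vec (Fin n) r} {a b} → (a , b) List.∈ arcs i γ → a ≡ i × b List.∈ toList γ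
  ∈-arcs⁻ {i = i} p with ∈-map⁻ (i ,_) p
  ... | j , j∈ , refl = refl , j∈

  root-arc : ∀ {n r} (i : Fin n) (γ : Vec (Fin n) (suc r)) {w : Word n (suc r)} → (i , γ) List.∈ w →
    ∃[ b ] (i , b) List.∈ wordArcs w
  root-arc i (j ∷ γ) p = j , ∈-concatMap⁺ (λ (i , γ) → arcs i γ) (List.lose p (here refl))

  arc-letter : ∀ {n r} {a b : Fin n} (w : Word n r) → (a , b) List.∈ wordArcs w →
    ∃[ γ ] ((a , γ) List.∈ w × b List.∈ toList γ)
  arc-letter w p with find∈ (∈-concatMap⁻ (λ (i , γ) → arcs i γ) {xs = w} p)
  ... | (i , γ) , ℓ∈ , q with ∈-arcs⁻ {γ = γ} q
  ... | refl , b∈ = γ , ℓ∈ , b∈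

  module _ {n m} (H : Hypergraph n m) {r : ℕ} where

    -- Arcs of edge letters stay within `e` and arcs of loops do not move, so membership in `e` is
    -- constant along arcs. Connectedness carries it from one edge letter to the root of every loop.
    EdgeWord-inside : ∀ {e} {w : Word n (suc r)} N → EdgeWord H e w → closedWalks N (wordArcs w) ≢ 0 →
      ∀ {i γ} → (i , γ) List.∈ w → ∀ {j} → j List.∈ (i ∷ toList γ) → j ∈ edge H e
    EdgeWord-inside {e} {w} N (all , some) ≢0 {i} {γ} ℓ∈ j∈ = case All.lookup all ℓ∈ of λ where
        (inj₂ is-e) → inEdge {_} {γ} is-e j∈
        (inj₁ refl) → subst (_∈ edge H e) (sym (loopVertex j∈)) (rootInside ℓ∈)
      where
      inEdge : ∀ {i} {γ : Vec (Fin n) (suc r)} → IsEdge H e (i , γ) → ∀ {j} → j List.∈ (i ∷ toList γ) → j ∈ edge H e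
      inEdge is-e j∈ = subst (_ ∈_) (sym is-e) (∈-⋃-singletons _ j∈)
      loopVertex : ∀ {i j : Fin n} → j List.∈ (i ∷ toList (replicate (suc r) i)) → j ≡ i
      loopVertex (here eq) = eq
      loopVertex (there p) = ∈-toList-replicate (suc r) p
      step : ∀ {a b} → (a , b) List.∈ wordArcs w → (a ∈ edge H e → b ∈ edge H e) × (b ∈ edge H e → a ∈ edge H e)
      step p with arc-letter w p
      ... | γ , ℓ∈ , b∈ with All.lookup all ℓ∈
      ... | inj₁ refl with refl ← ∈-toList-replicate (suc r) b∈ = id , id
      ... | inj₂ is-e = (λ _ → inEdge {γ = γ} is-e (there b∈)) , (λ _ → inEdge {γ = γ} is-e (here refl))
      rootInside : ∀ {i γ} → (i , γ) List.∈ w → i ∈ edge H e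
      rootInside {i} {γ} ℓ∈ with find∈ some
      ... | (i₀ , γ₀) , ℓ₀∈ , is-e = closedWalks-connected N (wordArcs w) ≢0 (_∈ edge H e) (_∈? edge H e)
        (proj₁ ∘ step) (proj₂ ∘ step) (proj₂ (root-arc i₀ γ₀ ℓ₀∈)) (inEdge {γ = γ₀} is-e (here refl))
        (proj₂ (root-arc i γ ℓ∈))

  loopLetter : ∀ {n} r → Fin n → Letter n r
  loopLetter r i = i , replicate r i

  LoopsAt : ∀ {n r} → Fin n → Word n r → Set
  LoopsAt {r = r} i w = All (_≡ loopLetter r i) w

  data Shape {n m} (H : Hypergraph n m) {r} (w : Word n r) : Set where
    loopsAt : ∀ i → LoopsAt i w → Shape H w
    inEdge  : ∀ e → EdgeWord H e w → nonloops w ≡ suc r → Shape H w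

  -- Loops join a vertex only to itself, so connectedness leaves a single vertex.
  loops-connected : ∀ {n r} N (w : Word n (suc r)) → All IsLoop w → closedWalks N (wordArcs w) ≢ 0 →
    ∀ {i γ} → (i , γ) List.∈ w → LoopsAt i w
  loops-connected {r = r} N w loops ≢0 {i} {γ} ℓ∈ = All.tabulate λ {(j , δ)} ℓ′∈ →
    case closedWalks-connected N (wordArcs w) ≢0 (_≡ i) (_≟ i)
      (λ p → subst (_≡ i) (sym (step p))) (λ p → subst (_≡ i) (step p))
      (proj₂ (root-arc i γ ℓ∈)) refl (proj₂ (root-arc j δ ℓ′∈)) of λ where
      refl → cong (i ,_) (All.lookup loops ℓ′∈)
    where
    step : ∀ {a b} → (a , b) List.∈ wordArcs w → b ≡ a
    step p with arc-letter w p
    ... | γ , ℓ∈ , b∈ with refl ← All.lookup loops ℓ∈ = ∈-toList-replicate (suc r) b∈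

  module _ {n m} (H : Hypergraph n m) {r : ℕ} (2≤r : 2 ≤ r) (uniform : Uniform H (suc r)) (linear : Linear H) where

    private
      edgesOf : (w : Word n r) → All (λ ℓ → IsLoop ℓ ⊎ (∃[ e ] IsEdge H e ℓ)) w → List (Fin m)
      edgesOf []      []                    = []
      edgesOf (ℓ ∷ w) (inj₁ _       ∷ ks) = edgesOf w ks
      edgesOf (ℓ ∷ w) (inj₂ (e , _) ∷ ks) = e ∷ edgesOf w ks

      1≤r : 1 ≤ r
      1≤r = ℕ.≤-trans (s≤s z≤n) 2≤r

      length-edgesOf : ∀ w ks → length (edgesOf w ks) ≡ nonloops w
      length-edgesOf []      []                    = refl
      length-edgesOf (ℓ ∷ w) (inj₁ loop ∷ ks) rewrite dec-true (isLoop? ℓ) loop = length-edgesOf w ks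
      length-edgesOf (ℓ ∷ w) (inj₂ (e , is-e) ∷ ks) rewrite nonloop-edge H 1≤r uniform {ℓ = ℓ} is-e =
        cong suc (length-edgesOf w ks)

      covers-edgesOf : ∀ w ks z → ∑ℕ (edgesOf w ks) (λ f → 𝟙 (lookup (edge H f) z)) ≡
        ∑ℕ w (λ ℓ → nonloop ℓ * 𝟙 (lookup (support (proj₁ ℓ) (proj₂ ℓ)) z))
      covers-edgesOf []      []                    z = refl
      covers-edgesOf (ℓ ∷ w) (inj₁ loop ∷ ks) z rewrite dec-true (isLoop? ℓ) loop = covers-edgesOf w ks z
      covers-edgesOf (ℓ ∷ w) (inj₂ (e , is-e) ∷ ks) z rewrite nonloop-edge H 1≤r uniform {ℓ = ℓ} is-e =
        cong₂ _+_ (trans (cong (λ S → 𝟙 (lookup S z)) is-e) (sym (ℕ.*-identityˡ _))) (covers-edgesOf w ks z)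

      edgeWord : ∀ w ks e → (∀ {f} → f List.∈ edgesOf w ks → f ≡ e) → All (λ ℓ → IsLoop ℓ ⊎ IsEdge H e ℓ) w
      edgeWord []      []                    e all = []
      edgeWord (ℓ ∷ w) (inj₁ loop ∷ ks)        e all = inj₁ loop ∷ edgeWord w ks e all
      edgeWord (ℓ ∷ w) (inj₂ (f , is-f) ∷ ks) e all =
        inj₂ (subst (λ f → IsEdge H f ℓ) (all (here refl)) is-f) ∷ edgeWord w ks e (all ∘ there)

      someEdge : ∀ w ks {e es} → edgesOf w ks ≡ e ∷ es → Any (IsEdge H e) w
      someEdge (ℓ ∷ w) (inj₁ _ ∷ ks)          eq   = there (someEdge w ks eq)
      someEdge (ℓ ∷ w) (inj₂ (e , is-e) ∷ ks) refl = here is-e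

      noEdge : ∀ w ks → edgesOf w ks ≡ [] → All IsLoop w
      noEdge []      []                 eq = []
      noEdge (ℓ ∷ w) (inj₁ loop ∷ ks) eq = loop ∷ noEdge w ks eq

    -- A contributing word has, at every vertex of its edges, exactly one letter
    -- rooted there and suc r letters through it.
    shape : ∀ N (w : Word n r) → All (λ ℓ → IsLoop ℓ ⊎ (∃[ e ] IsEdge H e ℓ)) w →
      closedWalks N (wordArcs w) ≢ 0 → 1 ≤ length w → length w < suc r + suc r → Shape H w
    shape N w ks ≢0 nonempty short = go (edgesOf w ks) refl
      where
      E : List (Fin m)
      E = edgesOf w ks
      lengthE : length E ≤ length w
      lengthE = ℕ.≤-trans (ℕ.≤-reflexive (length-edgesOf w ks))
        (ℕ.≤-trans (ℕ.m≤n+m _ (length (loopRoots w))) (ℕ.≤-reflexive (loopRoots+nonloops w)))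
      covered : ∀ {e z} → e List.∈ E → z ∈ edge H e → ∑ℕ E (λ f → 𝟙 (lookup (edge H f) z)) ≡ suc r
      covered {e} {z} e∈ z∈e = only (∑ℕ w (λ ℓ → nonloop ℓ * 𝟙 (does (proj₁ ℓ ≟ z))))
        (trans (covers-edgesOf w ks z) (word-balance H 1≤r uniform w ks N ≢0 z))
        where
        1≤ : 1 ≤ ∑ℕ E (λ f → 𝟙 (lookup (edge H f) z))
        1≤ = ℕ.≤-trans (ℕ.≤-reflexive (cong 𝟙 (sym (∈⇒lookup z∈e)))) (term≤∑ e∈)
        ≤E : ∑ℕ E (λ f → 𝟙 (lookup (edge H f) z)) ≤ length E
        ≤E = ℕ.≤-trans (∑-mono E λ f → 𝟙≤1 (lookup (edge H f) z)) (ℕ.≤-reflexive (trans (∑-const E 1) (ℕ.*-identityʳ _)))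
          where
          𝟙≤1 : ∀ b → 𝟙 b ≤ 1
          𝟙≤1 true  = ℕ.≤-refl
          𝟙≤1 false = z≤n
        -- The quotient in the balance is 1: it is not 0 because `e` covers `z`, and 2 or more would
        -- require more letters than `w` has.
        only : ∀ q → ∑ℕ E (λ f → 𝟙 (lookup (edge H f) z)) ≡ suc r * q →
          ∑ℕ E (λ f → 𝟙 (lookup (edge H f) z)) ≡ suc r
        only zero          eq = ⊥-elim (ℕ.<-irrefl (sym (trans eq (ℕ.*-zeroʳ r))) 1≤)
        only (suc zero)    eq = trans eq (ℕ.*-identityʳ (suc r))
        only (suc (suc q)) eq = ⊥-elim (ℕ.<-irrefl refl (ℕ.<-≤-trans
          (ℕ.≤-<-trans (ℕ.≤-trans ≤E lengthE) short) (ℕ.≤-trans (ℕ.≤-reflexive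
            (trans (cong (suc r +_) (sym (ℕ.+-identityʳ _))) (ℕ.*-comm 2 (suc r))))
          (ℕ.≤-trans (ℕ.*-monoʳ-≤ (suc r) {2} (s≤s (s≤s z≤n))) (ℕ.≤-reflexive (sym eq))))))
      go : ∀ es → E ≡ es → Shape H w
      go [] eq = someLoop 2≤r w (noEdge w ks eq) nonempty ≢0
        where
        someLoop : ∀ {r} → 2 ≤ r → (w : Word n r) → All IsLoop w → 1 ≤ length w →
          closedWalks N (wordArcs w) ≢ 0 → Shape H w
        someLoop {suc r} _ ((i , γ) ∷ w) loops _ ≢0 = loopsAt i (loops-connected N _ loops ≢0 (here refl))
      go (e ∷ es) eq = inEdge e
        (edgeWord w ks e (λ f∈ → cover-one-edge H (s≤s 2≤r) uniform linear E (ℕ.≤-<-trans lengthE short) covered f∈ e∈)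
        , someEdge w ks eq)
        (trans (sym (length-edgesOf w ks))
          (cover-length H (s≤s 2≤r) uniform linear E (ℕ.≤-<-trans lengthE short) covered e∈))
        where
        e∈ : e List.∈ E
        e∈ = subst (e List.∈_) (sym eq) (here refl)

  -- The model to which every hyperedge of every hypergraph is relabelled; the universal
  -- coefficients of the traces are computed on it.
  oneEdge : ∀ k → Hypergraph k 1
  oneEdge k = record { edge = λ _ → ⊤ ; edge-injective = λ { {zero} {zero} _ → refl } }

  oneEdge-uniform : ∀ k → Uniform (oneEdge k) k
  oneEdge-uniform k _ = ∣⊤∣≡n k

  oneEdge-linear : ∀ k → Linear (oneEdge k)
  oneEdge-linear k {zero} {zero} 0≢0 = ⊥-elim (0≢0 refl)

  record Enumerates {n m k} (H : Hypergraph n m) (e : Fin m) (ι : Fin k → Fin n) : Set where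
    field
      injective  : Injective _≡_ _≡_ ι
      inside     : ∀ i → ι i ∈ edge H e
      surjective : ∀ {x} → x ∈ edge H e → ∃[ i ] x ≡ ι i

  enumerate : ∀ {n} (S : Subset n) → ∃[ ι ] (Injective _≡_ _≡_ ι × (∀ (i : Fin ∣ S ∣) → ι i ∈ S) ×
    (∀ {x} → x ∈ S → ∃[ i ] x ≡ ι i))
  enumerate []          = (λ ()) , (λ { {()} }) , (λ ()) , λ ()
  enumerate (false ∷ S) with enumerate S
  ... | ι , inj , ins , sur = suc ∘ ι , inj ∘ suc-injective , there ∘ ins ,
    λ { (there p) → Product.map₂ (cong suc) (sur p) }
    where
    open import Data.Fin.Properties using (suc-injective)
    open import Data.Vec.Base using (here; there)
  enumerate (true ∷ S) with enumerate S
  ... | ι , inj , ins , sur = ι′ , inj′ _ _ , ins′ , sur′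
    where
    open import Data.Fin.Properties using (suc-injective)
    open import Data.Vec.Base using (here; there)
    ι′ : Fin (suc ∣ S ∣) → Fin _
    ι′ zero    = zero
    ι′ (suc i) = suc (ι i)
    inj′ : ∀ i j → ι′ i ≡ ι′ j → i ≡ j
    inj′ zero    zero    eq = refl
    inj′ (suc i) (suc j) eq = cong suc (inj (suc-injective eq))
    ins′ : ∀ i → ι′ i ∈ (true ∷ S)
    ins′ zero    = here
    ins′ (suc i) = there (ins i)
    sur′ : ∀ {x} → x ∈ (true ∷ S) → ∃[ i ] x ≡ ι′ i
    sur′ here      = zero , refl
    sur′ (there p) = Product.map suc (cong suc) (sur p)

  enumerate-edge : ∀ {n m k} (H : Hypergraph n m) → Uniform H k → ∀ e → Σ[ ι ∈ (Fin k → Fin n) ] Enumerates H e ι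
  enumerate-edge H uniform e = subst (λ k → Σ[ ι ∈ (Fin k → Fin _) ] Enumerates H e ι) (uniform e)
    (let (ι , inj , ins , sur) = enumerate (edge H e) in
     ι , record { injective = inj ; inside = ins ; surjective = sur })

-- Degrees of vertices and degree sums of hyperedges

module Degrees where

  open import Algebra.Bundles using (CommutativeMonoid)
  open import Data.Fin.Subset using (∣_∣; _∈_)
  open FiniteSums
  open Walks
  open Words

  degree≡∑ : ∀ {n m} (H : Hypergraph n m) x → degree H x ≡ ∑ℕ (allFin m) (λ e → 𝟙 (lookup (edge H e) x))
  degree≡∑ {m = m} H x = ≡.trans (∣∣≡∑ (tabulate (λ e → lookup (edge H e) x)))
    (ℕ∑.sum-cong (allFin m) λ e → cong 𝟙 (Vec.lookup∘tabulate _ e))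

  module EdgeSum {a ℓ} (M : CommutativeMonoid a ℓ) where
    open CommutativeMonoid M using () renaming (Carrier to C; _≈_ to _≈ᴹ_; trans to transᴹ; reflexive to reflexiveᴹ)
    private module S = FiniteSum M
    open S using () renaming (_when_ to _whenᴹ_)

    sum-edge : ∀ {n m k} (H : Hypergraph n m) e {ι : Fin k → Fin n} → Enumerates H e ι → ∀ (f : Fin n → C) →
      S.sum (allFin n) (λ i → f i whenᴹ lookup (edge H e) i) ≈ᴹ S.sum (allFin k) (f ∘ ι)
    sum-edge {k = k} H e {ι} en f = transᴹ
      (S.restricts-allFin ι injective _ λ x out → reflexiveᴹ (cong (f x whenᴹ_) (outside x out)))
      (S.sum-cong (allFin k) λ i → reflexiveᴹ (cong (f (ι i) whenᴹ_) (∈⇒lookup (inside i))))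
      where
      open Enumerates en
      outside : ∀ x → (∀ i → x ≢ ι i) → lookup (edge H e) x ≡ false
      outside x out with lookup (edge H e) x in eq
      ... | false = ≡.refl
      ... | true  = ⊥-elim (let (i , x≡) = surjective (lookup⇒∈ eq) in out i x≡)

  open EdgeSum ℕ.+-0-commutativeMonoid public using () renaming (sum-edge to ∑ℕ-edge)

  edgeDegree : ∀ {n m} → Hypergraph n m → Fin m → ℕ
  edgeDegree {n} H e = ∑ℕ (allFin n) λ i → degree H i ℕ∑.when lookup (edge H e) i

  degreeSum : ∀ {n m} → Hypergraph n m → (ℕ → ℕ) → ℕ
  degreeSum {n} H f = ∑ℕ (allFin n) (f ∘ degree H)

  degree-sum : ∀ {n m k} (H : Hypergraph n m) → Uniform H k → degreeSum H id ≡ m ℕ.* k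
  degree-sum {n} {m} {k} H uniform = ≡.trans (ℕ∑.sum-cong (allFin n) (degree≡∑ H))
    (≡.trans (ℕ∑.sum-swap (allFin n) (allFin m) _)
    (≡.trans (ℕ∑.sum-cong (allFin m) λ e → ≡.trans (≡.sym (∣∣≡∑ (edge H e))) (uniform e))
    (≡.trans (∑-const (allFin m) k) (cong (ℕ._* k) (List.length-tabulate {n = m} id)))))

  -- Vertex `i` adds its degree to each of the `degree H i` hyperedges that contain it.
  edgeDegree-sum : ∀ {n m} (H : Hypergraph n m) → ∑ℕ (allFin m) (edgeDegree H) ≡ degreeSum H (λ d → d ℕ.* d)
  edgeDegree-sum {n} {m} H = ≡.trans (ℕ∑.sum-swap (allFin m) (allFin n) _)
    (ℕ∑.sum-cong (allFin n) λ i → ≡.trans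
      (ℕ∑.sum-cong (allFin m) (λ e → indicator (degree H i) (lookup (edge H e) i)))
      (≡.trans (∑-*ˡ (degree H i) (allFin m) _) (cong (degree H i ℕ.*_) (≡.sym (degree≡∑ H i)))))
    where
    indicator : ∀ d b → (d ℕ∑.when b) ≡ d ℕ.* 𝟙 b
    indicator d true  = ≡.sym (ℕ.*-identityʳ d)
    indicator d false = ≡.sym (ℕ.*-zeroʳ d)

-- Permutations that move two given points

module Permutations where

  open import Data.Fin.Permutation using (Permutation′; transpose; _∘ₚ_; _⟨$⟩ʳ_; _⟨$⟩ˡ_; inverseˡ)
  open import Relation.Binary.PropositionalEquality using (refl; sym; trans)

  transpose-left : ∀ {k} (i j : Fin k) → transpose i j ⟨$⟩ʳ i ≡ j
  transpose-left i j rewrite dec-true (i ≟ i) refl = refl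

  transpose-other : ∀ {k} {i j l : Fin k} → l ≢ i → l ≢ j → transpose i j ⟨$⟩ʳ l ≡ l
  transpose-other {i = i} {j} {l} l≢i l≢j rewrite dec-false (l ≟ i) l≢i | dec-false (l ≟ j) l≢j = refl

  permutation-injective : ∀ {k} (π : Permutation′ k) {i j} → π ⟨$⟩ʳ i ≡ π ⟨$⟩ʳ j → i ≡ j
  permutation-injective π eq = trans (sym (inverseˡ π)) (trans (cong (π ⟨$⟩ˡ_) eq) (inverseˡ π))

  -- One transposition takes 0 to `i`; the next takes the image `b` of 1 to `j`. The second leaves
  -- `i` alone, since `i` differs from `b` by injectivity and from `j` by assumption.
  moveTwo : ∀ {k} {i j : Fin (suc (suc k))} → i ≢ j → Σ[ π ∈ Permutation′ (suc (suc k)) ] (π ⟨$⟩ʳ zero ≡ i × π ⟨$⟩ʳ suc zero ≡ j)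
  moveTwo {i = i} {j} i≢j = τ ∘ₚ transpose b j ,
    trans (transpose-other (λ a≡b → case permutation-injective τ {zero} {suc zero} a≡b of λ ())
      (λ a≡j → i≢j (trans (sym (transpose-left zero i)) a≡j))) (transpose-left zero i) ,
    transpose-left b j
    where
    τ : Permutation′ _
    τ = transpose zero i
    b : Fin _
    b = τ ⟨$⟩ʳ suc zero

-- Euler circuits of complete digraphs

module EulerCircuits where

  open import Data.Fin.Base using (punchIn; punchOut)
  open import Data.Fin.Properties using (punchIn-punchOut)
  open import Data.Fin.Subset using (⊤)
  open import Data.Fin.Subset.Properties using (∈⊤; ⊆-antisym)
  open import Data.List.Base using (concatMap; map)
  open import Data.List.Membership.Propositional.Properties using (∈-tabulate⁺)
  open import Data.List.Relation.Binary.Permutation.Propositional as Perm using (_↭_)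
  import Data.List.Relation.Binary.Permutation.Propositional.Properties as Perm
  open import Data.List.Relation.Unary.All as All using (All; []; _∷_)
  import Data.List.Relation.Unary.All.Properties as All
  open import Data.List.Relation.Unary.Any using (here; there)
  open import Relation.Binary.PropositionalEquality using (refl; sym; trans)
  open FiniteSums
  open Walks
  open Words

  open Perm.PermutationReasoning

  walk-++ : ∀ {n} {i j l : Fin n} {u v} → Walk j i u → Walk l j v → Walk l i (u ++ v)
  walk-++ []       w = w
  walk-++ (a ∷ w₁) w = a ∷ walk-++ w₁ w

  walk-map : ∀ {k n} (ι : Fin k → Fin n) {i j u} → Walk j i u → Walk (ι j) (ι i) (map (mapArc ι) u)
  walk-map ι []      = []
  walk-map ι (a ∷ w) = ι a ∷ walk-map ι w

  walk-loops : ∀ {n} r {i : Fin n} → Walk i i (List.replicate r (i , i))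
  walk-loops zero    = []
  walk-loops (suc r) = _ ∷ walk-loops r

  concatMap-∷-↭ : ∀ {a b} {A : Set a} {B : Set b} (f : A → B) (g : A → List B) xs →
    concatMap (λ x → f x ∷ g x) xs ↭ map f xs ++ concatMap g xs
  concatMap-∷-↭ f g []       = Perm.refl
  concatMap-∷-↭ f g (x ∷ xs) = Perm.prep (f x) (begin
    g x ++ concatMap (λ x → f x ∷ g x) xs     ↭⟨ Perm.++⁺ˡ (g x) (concatMap-∷-↭ f g xs) ⟩
    g x ++ map f xs ++ concatMap g xs         ↭⟨ Perm.shifts (g x) (map f xs) ⟩
    map f xs ++ g x ++ concatMap g xs         ∎)

  concatMap-[]≡map : ∀ {a b} {A : Set a} {B : Set b} (f : A → B) (xs : List A) → map f xs ++ concatMap (λ _ → []) xs ≡ map f xs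
  concatMap-[]≡map f []       = refl
  concatMap-[]≡map f (x ∷ xs) = cong (f x ∷_) (concatMap-[]≡map f xs)

  others : ∀ {r} → Fin (suc r) → List (Fin (suc r))
  others {r} i = map (punchIn i) (allFin r)

  -- Grouped by tail, in the order in which `wordArcs` lists the arcs of the star letters.
  completeArcs : ∀ r → List (Arc (suc r))
  completeArcs r = concatMap (λ i → map (i ,_) (others i)) (allFin (suc r))

  detour : ∀ {r} → Fin r → List (Arc (suc r))
  detour j = (zero , suc j) ∷ (suc j , zero) ∷ []

  -- Vertex 0 is split off: its outgoing arcs pair up with the arcs back to it, one from each other
  -- row, and the rest is the complete digraph on the other vertices.
  completeArcs-suc : ∀ r → completeArcs (suc r) ↭ concatMap detour (allFin (suc r)) ++ map (mapArc suc) (completeArcs r)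
  completeArcs-suc r = begin
    completeArcs (suc r)
      ≡⟨ cong (concatMap (λ i → map (i ,_) (others i))) (allFin-suc (suc r)) ⟩
    map (zero ,_) (others zero) ++ concatMap (λ i → map (i ,_) (others i)) (map suc (allFin (suc r)))
      ≡⟨ cong₂ _++_ (sym (List.map-∘ (allFin (suc r)))) (trans (List.concatMap-map (λ i → map (i ,_) (others i)) suc (allFin (suc r)))
           (List.concatMap-cong row (allFin (suc r)))) ⟩
    map out (allFin (suc r)) ++ concatMap (λ i → back i ∷ map (mapArc suc) (map (i ,_) (others i))) (allFin (suc r))
      ↭⟨ Perm.++⁺ˡ (map out (allFin (suc r))) (concatMap-∷-↭ back _ (allFin (suc r))) ⟩
    map out (allFin (suc r)) ++ map back (allFin (suc r)) ++ concatMap (λ i → map (mapArc suc) (map (i ,_) (others i))) (allFin (suc r))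
      ≡⟨ List.++-assoc (map out (allFin (suc r))) _ _ ⟨
    (map out (allFin (suc r)) ++ map back (allFin (suc r))) ++ concatMap (λ i → map (mapArc suc) (map (i ,_) (others i))) (allFin (suc r))
      ≡⟨ cong₂ (λ a b → (map out (allFin (suc r)) ++ a) ++ b) (sym (concatMap-[]≡map back (allFin (suc r))))
           (sym (List.map-concatMap (mapArc suc) (λ i → map (i ,_) (others i)) (allFin (suc r)))) ⟩
    (map out (allFin (suc r)) ++ map back (allFin (suc r)) ++ concatMap (λ _ → []) (allFin (suc r))) ++ map (mapArc suc) (completeArcs r)
      ↭⟨ Perm.++⁺ʳ _ (Perm.++⁺ˡ (map out (allFin (suc r))) (concatMap-∷-↭ back (λ _ → []) (allFin (suc r)))) ⟨
    (map out (allFin (suc r)) ++ concatMap (λ i → back i ∷ []) (allFin (suc r))) ++ map (mapArc suc) (completeArcs r)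
      ↭⟨ Perm.++⁺ʳ _ (concatMap-∷-↭ out (λ i → back i ∷ []) (allFin (suc r))) ⟨
    concatMap detour (allFin (suc r)) ++ map (mapArc suc) (completeArcs r) ∎
    where
    out back : Fin (suc r) → Arc (suc (suc r))
    out  j = zero , suc j
    back j = suc j , zero
    -- `punchIn (suc i)` fixes 0 and acts as `punchIn i` above it, so each row begins with the arc
    -- back to 0.
    row : ∀ i → map (suc i ,_) (others (suc i)) ≡ back i ∷ map (mapArc suc) (map (i ,_) (others i))
    row i = cong (back i ∷_) (trans (cong (map (suc i ,_)) (List.map-tabulate suc (punchIn (suc i))))
      (trans (List.map-tabulate _ _) (sym (trans (cong (map (mapArc suc)) (trans (cong (map (i ,_)) (List.map-tabulate id (punchIn i))) (List.map-tabulate _ _)))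
        (List.map-tabulate _ _)))))

  -- An Euler circuit of the complete digraph on suc r vertices is obtained from
  -- one on the vertices other than 0 by detours from 0 to every other vertex.
  eulerCircuit : ∀ r → List (Arc (suc r))
  eulerCircuit zero    = []
  eulerCircuit (suc r) = (zero , suc zero) ∷ map (mapArc suc) (eulerCircuit r) ++
    (suc zero , zero) ∷ concatMap detour (map suc (allFin r))

  eulerCircuit-walk : ∀ r → Walk zero zero (eulerCircuit r)
  eulerCircuit-walk zero    = []
  eulerCircuit-walk (suc r) = zero ∷ walk-++ (walk-map suc (eulerCircuit-walk r)) (suc zero ∷ detours (map suc (allFin r)))
    where
    detours : ∀ xs → Walk zero zero (concatMap detour xs)
    detours []       = []
    detours (x ∷ xs) = zero ∷ suc x ∷ detours xs

  -- The smaller circuit interrupts the detour to vertex 1. Moved to the end, it leaves that detour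
  -- whole, which gives the splitting of `completeArcs-suc`.
  eulerCircuit-↭ : ∀ r → eulerCircuit r ↭ completeArcs r
  eulerCircuit-↭ zero    = Perm.refl
  eulerCircuit-↭ (suc r) = begin
    (zero , suc zero) ∷ map (mapArc suc) (eulerCircuit r) ++ (suc zero , zero) ∷ concatMap detour (map suc (allFin r))
      ↭⟨ Perm.prep _ (Perm.++-comm (map (mapArc suc) (eulerCircuit r)) _) ⟩
    concatMap detour (zero ∷ map suc (allFin r)) ++ map (mapArc suc) (eulerCircuit r)
      ≡⟨ cong (λ l → concatMap detour l ++ map (mapArc suc) (eulerCircuit r)) (sym (allFin-suc r)) ⟩
    concatMap detour (allFin (suc r)) ++ map (mapArc suc) (eulerCircuit r)
      ↭⟨ Perm.++⁺ˡ (concatMap detour (allFin (suc r))) (Perm.map⁺ (mapArc suc) (eulerCircuit-↭ r)) ⟩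
    concatMap detour (allFin (suc r)) ++ map (mapArc suc) (completeArcs r)
      ↭⟨ completeArcs-suc r ⟨
    completeArcs (suc r) ∎

  toList-tabulate : ∀ {a} {A : Set a} {r} (f : Fin r → A) → toList (tabulate f) ≡ List.tabulate f
  toList-tabulate {r = zero}  f = refl
  toList-tabulate {r = suc r} f = cong (f zero ∷_) (toList-tabulate (f ∘ suc))

  length-wordArcs : ∀ {n r} (w : Word n r) → length (wordArcs w) ≡ length w ℕ.* r
  length-wordArcs []            = refl
  length-wordArcs ((i , γ) ∷ w) = trans (List.length-++ (arcs i γ)) (cong₂ ℕ._+_
    (trans (List.length-map (i ,_) (toList γ)) (Vec.length-toList γ)) (length-wordArcs w))

  module _ (r′ : ℕ) where

    private
      r k : ℕ
      r = suc r′
      k = suc r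
      K : Hypergraph k 1
      K = oneEdge k

    starLetter : Fin k → Letter k r
    starLetter i = i , tabulate (punchIn i)

    starLetter-edge : ∀ (i : Fin k) → ⊤ ≡ support i (tabulate (punchIn i))
    starLetter-edge i = ⊆-antisym (λ {z} _ → ∈-⋃-singletons (i ∷ toList (tabulate (punchIn i))) (member z)) (λ _ → ∈⊤)
      where
      member : ∀ z → z List.∈ (i ∷ toList (tabulate (punchIn i)))
      member z with i ≟ z
      ... | yes refl = here refl
      ... | no i≢z = there (subst (z List.∈_) (sym (toList-tabulate (punchIn i)))
              (subst (List._∈ List.tabulate (punchIn i)) (punchIn-punchOut i≢z) (∈-tabulate⁺ {f = punchIn i} (punchOut i≢z))))

    -- The witness that the coefficient of two loops with distinct roots is positive: each rooting
    -- of the hyperedge once, and loops at 0 and 1. By symmetry this pair stands for all pairs.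
    twoLoops : Word k r
    twoLoops = loopLetter r zero ∷ loopLetter r (suc zero) ∷ map starLetter (allFin k)

    length-twoLoops : length twoLoops ≡ 2 ℕ.+ k
    length-twoLoops = cong (2 ℕ.+_) (trans (List.length-map starLetter (allFin k)) (List.length-tabulate id))

    -- The edge letters contribute the complete digraph. Its circuit begins with the arc from 0 to
    -- 1, so the loops at 0 go before this arc and those at 1 right after it.
    twoLoops-walk : ∃[ u ] (u ↭ wordArcs twoLoops × Walk zero zero u)
    twoLoops-walk = _ , perm , walk
      where
      rest : List (Arc k)
      rest = map (mapArc suc) (eulerCircuit r′) ++ (suc zero , zero) ∷ concatMap detour (map suc (allFin r′))
      loops : ∀ i → List (Arc k)
      loops i = List.replicate r (i , i)
      walk : Walk zero zero (loops zero ++ (zero , suc zero) ∷ loops (suc zero) ++ rest)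
      walk with eulerCircuit-walk r
      ... | _ ∷ w = walk-++ (walk-loops r) (zero ∷ walk-++ (walk-loops r) w)
      loop-arcs : ∀ s (i : Fin k) → List.replicate s (i , i) ≡ arcs i (replicate s i)
      loop-arcs zero    i = refl
      loop-arcs (suc s) i = cong (_ ∷_) (loop-arcs s i)
      stars : wordArcs (map starLetter (allFin k)) ≡ completeArcs r
      stars = trans (List.concatMap-map (λ (i , γ) → arcs i γ) starLetter (allFin k)) (List.concatMap-cong
        (λ i → cong (map (i ,_)) (trans (toList-tabulate (punchIn i)) (sym (List.map-tabulate id (punchIn i))))) (allFin k))
      perm : loops zero ++ (zero , suc zero) ∷ loops (suc zero) ++ rest ↭ wordArcs twoLoops
      perm = begin
        loops zero ++ (zero , suc zero) ∷ loops (suc zero) ++ rest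
          ↭⟨ Perm.++⁺ˡ (loops zero) (Perm.↭-sym (Perm.shift (zero , suc zero) (loops (suc zero)) rest)) ⟩
        loops zero ++ loops (suc zero) ++ eulerCircuit r
          ↭⟨ Perm.++⁺ˡ (loops zero) (Perm.++⁺ˡ (loops (suc zero)) (eulerCircuit-↭ r)) ⟩
        loops zero ++ loops (suc zero) ++ completeArcs r
          ≡⟨ cong₂ _++_ (loop-arcs r zero) (cong₂ _++_ (loop-arcs r (suc zero)) (sym stars)) ⟩
        wordArcs twoLoops ∎

    twoLoops-closedWalks : ∀ N → suc N ≡ (2 ℕ.+ k) ℕ.* r → 0 ℕ.< closedWalks N (wordArcs twoLoops)
    twoLoops-closedWalks N eq with twoLoops-walk
    ... | u , p , w = subst (0 ℕ.<_) (closedWalks-↭ N p) (0<closedWalks w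
            (trans (Perm.↭-length p) (trans (length-wordArcs twoLoops)
            (trans (cong (ℕ._* r) length-twoLoops) (sym eq)))))

    twoLoops-edgeWord : EdgeWord K zero twoLoops
    twoLoops-edgeWord = (inj₁ refl ∷ inj₁ refl ∷ All.map⁺ (All.tabulate λ {i} _ → inj₂ (starLetter-edge i))) ,
      there (there (here (starLetter-edge zero)))

    twoLoops-loopRoots : Uniform K k → loopRoots twoLoops ≡ zero ∷ suc zero ∷ []
    twoLoops-loopRoots uniform
      rewrite dec-true (isLoop? (loopLetter {k} r zero)) refl | dec-true (isLoop? (loopLetter {k} r (suc zero))) refl =
      cong (λ l → zero ∷ suc zero ∷ l) (none (allFin k))
      where
      none : ∀ is → loopRoots (map starLetter is) ≡ []
      none []       = refl
      none (i ∷ is) rewrite dec-false (isLoop? (starLetter i))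
        (edge-notLoop K (s≤s z≤n) uniform {zero} {starLetter i} (starLetter-edge i)) = none is

-- Evaluation of the differential operators on powers of the generic matrix

module Evaluation {c ℓ₁ ℓ₂ ℓ₃} (F : OrderedField c ℓ₁ ℓ₂ ℓ₃) where

  open import Algebra.Apartness.Bundles using (HeytingField; module HeytingCommutativeRing)
  open import Data.List.Relation.Binary.Permutation.Propositional as Perm using (_↭_)
  import Data.List.Relation.Binary.Permutation.Propositional.Properties as Perm
  open import Data.Nat.Base using (_∸_)
  open import Data.Nat.GeneralisedArithmetic using (fold)
  import Data.Product.Properties as Product
  open import Relation.Binary.Definitions using (DecidableEquality)
  open FiniteSums
  open Walks
    using (picks; arcs; Arc; walks; closedWalks; walks-↭; closedWalks-↭; does-sym; ∑ℕ; module ℕ∑)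

  open import Algebra.Bundles using (CommutativeRing)

  field-commutativeRing : CommutativeRing c ℓ₁
  field-commutativeRing = HeytingCommutativeRing.commutativeRing
    (HeytingField.heytingCommutativeRing (OrderedField.heytingField F))

  open OrderedField F hiding (zero)
  open CommutativeRing field-commutativeRing public using (+-commutativeMonoid; *-commutativeMonoid)
  open import Relation.Binary.Reasoning.Setoid (CommutativeRing.setoid field-commutativeRing)
  open import Algebra.Properties.CommutativeSemigroup (CommutativeRing.*-commutativeSemigroup field-commutativeRing) using (x∙yz≈y∙xz)

  module F∑ = FiniteSum +-commutativeMonoid
  module F∏ = FiniteSum *-commutativeMonoid
  open F∑ public using (sum; _when_)
  open F∏ public using () renaming (sum to product)

  ∑-map : ∀ {a} {A : Set a} (f : A → Carrier) xs → ∑ F (List.map f xs) ≡ sum xs f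
  ∑-map f []       = ≡.refl
  ∑-map f (x ∷ xs) = cong (f x +_) (∑-map f xs)

  sum-*ˡ : ∀ {a} {A : Set a} x (xs : List A) f → x * sum xs f ≈ sum xs (λ y → x * f y)
  sum-*ˡ x []       f = zeroʳ x
  sum-*ˡ x (y ∷ ys) f = trans (distribˡ x _ _) (+-congˡ (sum-*ˡ x ys f))

  *-whenʳ : ∀ x y b → x * (y when b) ≈ (x * y when b)
  *-whenʳ x y true  = refl
  *-whenʳ x y false = zeroʳ x

  ⟨_⟩ : ℕ → Carrier
  ⟨_⟩ = fromℕ F

  fromℕ-+ : ∀ a b → ⟨ a ℕ.+ b ⟩ ≈ ⟨ a ⟩ + ⟨ b ⟩
  fromℕ-+ zero    b = sym (+-identityˡ _)
  fromℕ-+ (suc a) b = trans (+-congˡ (fromℕ-+ a b)) (sym (+-assoc _ _ _))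

  fromℕ-sum : ∀ {a} {A : Set a} (xs : List A) f → ⟨ ∑ℕ xs f ⟩ ≈ sum xs (⟨_⟩ ∘ f)
  fromℕ-sum []       f = refl
  fromℕ-sum (x ∷ xs) f = trans (fromℕ-+ (f x) _) (+-congˡ (fromℕ-sum xs f))

  fromℕ-when : ∀ a b → ⟨ a ℕ∑.when b ⟩ ≈ (⟨ a ⟩ when b)
  fromℕ-when a true  = refl
  fromℕ-when a false = refl

  module Evaluate {X : Set} (_≟ˣ_ : DecidableEquality X) where

    open Derivative F _≟ˣ_

    -- Formal sums have no normal form, so polynomials are compared only through these values: the
    -- constant terms left after differentiating by every entry of `v`.
    coeff : Poly F X → List X → Carrier
    coeff p []      = constantTerm F p
    coeff p (x ∷ v) = coeff (∂ x p) v

    -- The number of bijections between the positions of `v` and those of the monomial that match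
    -- equal indeterminates.
    coeffᴹ : List X → Monomial F X → ℕ
    coeffᴹ []      []      = 1
    coeffᴹ []      (_ ∷ _) = 0
    coeffᴹ (x ∷ v) w       = ∑ℕ (∂ᴹ x w) (coeffᴹ v)

    -- Exhibits `coeff` as a linear functional of the terms; its additivity and homogeneity then
    -- follow from the laws of `sum`.
    coeff-terms : ∀ p v → coeff p v ≈ sum p (λ (a , w) → a * ⟨ coeffᴹ v w ⟩)
    coeff-terms []               []      = refl
    coeff-terms ((a , [])    ∷ p) []      = +-cong
      (sym (trans (*-congˡ (+-identityʳ 1#)) (*-identityʳ a))) (coeff-terms p [])
    coeff-terms ((a , _ ∷ _) ∷ p) []      = trans (coeff-terms p [])
      (sym (trans (+-congʳ (zeroʳ a)) (+-identityˡ _)))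
    coeff-terms p                 (x ∷ v) = begin
      coeff (∂ x p) v
        ≈⟨ coeff-terms (∂ x p) v ⟩
      sum (∂ x p) (λ (a , w) → a * ⟨ coeffᴹ v w ⟩)
        ≈⟨ F∑.sum-concatMap _ p _ ⟩
      sum p (λ (a , w) → sum (List.map (a ,_) (∂ᴹ x w)) (λ (a , w) → a * ⟨ coeffᴹ v w ⟩))
        ≈⟨ F∑.sum-cong p (λ (a , w) → begin
             _ ≡⟨ F∑.sum-map (a ,_) (∂ᴹ x w) _ ⟩
             _ ≈⟨ sum-*ˡ a (∂ᴹ x w) _ ⟨
             _ ≈⟨ *-congˡ (fromℕ-sum (∂ᴹ x w) (coeffᴹ v)) ⟨
             a * ⟨ coeffᴹ (x ∷ v) w ⟩ ∎) ⟩
      sum p (λ (a , w) → a * ⟨ coeffᴹ (x ∷ v) w ⟩) ∎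

    coeff-∑ᴾ : ∀ ps v → coeff (∑ᴾ F ps) v ≈ sum ps (λ p → coeff p v)
    coeff-∑ᴾ []       v = coeff-terms [] v
    coeff-∑ᴾ (p ∷ ps) v = begin
      coeff (p ++ ∑ᴾ F ps) v                ≈⟨ coeff-terms (p ++ ∑ᴾ F ps) v ⟩
      _                                     ≈⟨ F∑.sum-++ p (∑ᴾ F ps) _ ⟩
      _                                     ≈⟨ +-cong (coeff-terms p v) (coeff-terms (∑ᴾ F ps) v) ⟨
      coeff p v + coeff (∑ᴾ F ps) v         ≈⟨ +-congˡ (coeff-∑ᴾ ps v) ⟩
      sum (p ∷ ps) (λ p → coeff p v)        ∎

    coeff-∑ᴾ-map : ∀ {a} {A : Set a} (g : A → Poly F X) xs v →
      coeff (∑ᴾ F (List.map g xs)) v ≈ sum xs (λ x → coeff (g x) v)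
    coeff-∑ᴾ-map g xs v = trans (coeff-∑ᴾ (List.map g xs) v) (reflexive (F∑.sum-map g xs _))

    coeff-• : ∀ b p v → coeff (_•_ F b p) v ≈ b * coeff p v
    coeff-• b p v = begin
      coeff (_•_ F b p) v                          ≈⟨ coeff-terms (_•_ F b p) v ⟩
      _                                            ≡⟨ F∑.sum-map _ p _ ⟩
      sum p (λ (a , w) → b * a * ⟨ coeffᴹ v w ⟩)   ≈⟨ F∑.sum-cong p (λ _ → *-assoc _ _ _) ⟩
      _                                            ≈⟨ sum-*ˡ b p _ ⟨
      _                                            ≈⟨ *-congˡ (coeff-terms p v) ⟨
      b * coeff p v                                ∎

    -- The same matchings counted from the other side. The definition consumes the head of `v`; here
    -- the head of the monomial chooses its partner in `v`, which is the recursion of `walks`.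
    coeffᴹ-∷ : ∀ v x w → coeffᴹ v (x ∷ w) ≡ ∑ℕ (picks v) (λ (y , v′) → coeffᴹ v′ w ℕ∑.when does (y ≟ˣ x))
    coeffᴹ-∷ []      x w = ≡.refl
    coeffᴹ-∷ (y ∷ v) x w = ≡.trans (ℕ∑.sum-++ (if does (y ≟ˣ x) then w ∷ [] else []) _ (coeffᴹ v))
      (cong₂ ℕ._+_ (head (does (y ≟ˣ x)))
      (≡.trans (ℕ∑.sum-map (x ∷_) (∂ᴹ y w) (coeffᴹ v))
      (≡.trans (ℕ∑.sum-cong (∂ᴹ y w) (λ w′ → coeffᴹ-∷ v x w′))
      (≡.trans (ℕ∑.sum-swap (∂ᴹ y w) (picks v) _)
      (≡.trans (ℕ∑.sum-cong (picks v) (λ (z , v′) → ℕ∑.sum-when (∂ᴹ y w) (coeffᴹ v′) (does (z ≟ˣ x))))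
      (≡.sym (ℕ∑.sum-map _ (picks v) _)))))))
      where
      head : ∀ b → ∑ℕ (if b then w ∷ [] else []) (coeffᴹ v) ≡ (coeffᴹ v w ℕ∑.when b)
      head true  = ℕ.+-identityʳ _
      head false = ≡.refl

  when-pair : ∀ {n} x (i j a b : Fin n) →
    (x when does (Product.≡-dec _≟_ _≟_ (i , j) (a , b))) ≡ ((x when does (i ≟ a)) when does (b ≟ j))
  when-pair x i j a b with i ≟ a | b ≟ j
  ... | yes ≡.refl | yes ≡.refl rewrite dec-true (j ≟ j) ≡.refl = ≡.refl
  ... | yes ≡.refl | no b≢j rewrite dec-false (j ≟ b) (b≢j ∘ ≡.sym) = ≡.refl
  ... | no _ | yes _ = ≡.refl
  ... | no _ | no _  = ≡.refl

  -- The operators seen from the side of the coefficients: a derivative of the polynomial is an arc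
  -- added to the list at which it is read. `v` accumulates these arcs.
  operate : ∀ {n r} → (Fin n → Vec (Fin n) r → Carrier) → List (Fin n) →
            (List (Arc n) → Carrier) → List (Arc n) → Carrier
  operate {n} {r} T []      f v = f v
  operate {n} {r} T (i ∷ σ) f v = sum (tuples n r) λ γ → T i γ * operate T σ f (arcs i γ ++ v)

  module _ {n r} (T : Fin n → Vec (Fin n) r → Carrier) where

    operate-cong : ∀ σ {f g} → (∀ v → f v ≈ g v) → ∀ v → operate T σ f v ≈ operate T σ g v
    operate-cong []      eq v = eq v
    operate-cong (i ∷ σ) eq v = F∑.sum-cong (tuples n r) λ γ → *-congˡ (operate-cong σ eq _)

    operate-++ : ∀ σ τ f v → operate T (σ ++ τ) f v ≈ operate T σ (operate T τ f) v
    operate-++ []      τ f v = refl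
    operate-++ (i ∷ σ) τ f v = F∑.sum-cong (tuples n r) λ γ → *-congˡ (operate-++ σ τ f _)

    operate-* : ∀ σ x f v → operate T σ (λ v → x * f v) v ≈ x * operate T σ f v
    operate-* []      x f v = refl
    operate-* (i ∷ σ) x f v = trans
      (F∑.sum-cong (tuples n r) λ γ → trans (*-congˡ (operate-* σ x f _)) (x∙yz≈y∙xz _ _ _))
      (sym (sum-*ˡ x (tuples n r) _))

    operate-inv : ∀ σ {f} → (∀ {v v′} → v ↭ v′ → f v ≈ f v′) → ∀ {v v′} → v ↭ v′ →
      operate T σ f v ≈ operate T σ f v′
    operate-inv []      inv p = inv p
    operate-inv (i ∷ σ) inv p = F∑.sum-cong (tuples n r) λ γ →
      *-congˡ (operate-inv σ inv (Perm.++⁺ˡ (arcs i γ) p))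

    -- The trace formula applies the operators sorted by root. Their commutation frees this order,
    -- so that the roots can later run over all words.
    operate-↭ : ∀ {σ τ f} → (∀ {v v′} → v ↭ v′ → f v ≈ f v′) → σ ↭ τ →
      ∀ v → operate T σ f v ≈ operate T τ f v
    operate-↭ inv Perm.refl v = refl
    operate-↭ inv (Perm.prep i p) v = F∑.sum-cong (tuples n r) λ γ → *-congˡ (operate-↭ inv p _)
    operate-↭ {f = f} inv (Perm.swap {xs} {ys} i j p) v = begin
      sum (tuples n r) (λ γ → T i γ * sum (tuples n r) (λ δ → T j δ * operate T xs f (arcs j δ ++ arcs i γ ++ v)))
        ≈⟨ F∑.sum-cong (tuples n r) (λ γ → sum-*ˡ (T i γ) (tuples n r) _) ⟩
      sum (tuples n r) (λ γ → sum (tuples n r) (λ δ → T i γ * (T j δ * operate T xs f (arcs j δ ++ arcs i γ ++ v))))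
        ≈⟨ F∑.sum-swap (tuples n r) (tuples n r) _ ⟩
      sum (tuples n r) (λ δ → sum (tuples n r) (λ γ → T i γ * (T j δ * operate T xs f (arcs j δ ++ arcs i γ ++ v))))
        ≈⟨ F∑.sum-cong (tuples n r) (λ δ → F∑.sum-cong (tuples n r) λ γ → trans (x∙yz≈y∙xz _ _ _)
             (*-congˡ (*-congˡ (trans (operate-inv xs inv (Perm.shifts (arcs j δ) (arcs i γ)))
                                      (operate-↭ inv p _))))) ⟩
      sum (tuples n r) (λ δ → sum (tuples n r) (λ γ → T j δ * (T i γ * operate T ys f (arcs i γ ++ arcs j δ ++ v))))
        ≈⟨ F∑.sum-cong (tuples n r) (λ δ → sum-*ˡ (T j δ) (tuples n r) _) ⟨
      _ ∎
    operate-↭ inv (Perm.trans p q) v = trans (operate-↭ inv p v) (operate-↭ inv q v)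

  module _ (k : ℕ) {n} (T : Tensor F k n) where

    open Evaluate {Arc n} (Product.≡-dec _≟_ _≟_)
    private module Tr = Trace F k T
    open Derivative F {Arc n} (Product.≡-dec _≟_ _≟_)

    -- The first factor (i , l) of a product in the matrix power must match an arc (x , y) of `v`,
    -- so x = i and y = l; the sum over `l` collapses to the recursion of `walks`.
    ∑walks : ∀ N i j v → coeff (Tr.A^ N i j) v ≈ ⟨ walks N v i j ⟩
    ∑walks zero i j [] with does (i ≟ j)
    ... | true  = refl
    ... | false = +-identityʳ 0#
    ∑walks zero i j (x ∷ v) = trans (coeff-terms (Tr.A^ zero i j) (x ∷ v)) (trans (+-identityʳ _) (zeroʳ _))
    ∑walks (suc N) i j v = begin
      coeff (Tr.A^ (suc N) i j) v
        ≈⟨ coeff-∑ᴾ-map _ (allFin n) v ⟩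
      sum (allFin n) (λ l → coeff (_*ᴾ_ F (indeterminate F (i , l)) (Tr.A^ N l j)) v)
        ≈⟨ F∑.sum-cong (allFin n) (λ l → begin
            _ ≈⟨ coeff-terms (_*ᴾ_ F (indeterminate F (i , l)) (Tr.A^ N l j)) v ⟩
            _ ≈⟨ F∑.sum-cartesian (λ (a , w) (b , w′) → a * b , w ++ w′) (indeterminate F (i , l)) (Tr.A^ N l j) _ ⟩
            _ ≈⟨ +-identityʳ _ ⟩
            sum (Tr.A^ N l j) (λ (a , w) → 1# * a * ⟨ coeffᴹ v ((i , l) ∷ w) ⟩)
              ≈⟨ F∑.sum-cong (Tr.A^ N l j) (λ (a , w) → begin
                 _ ≈⟨ *-congʳ (*-identityˡ a) ⟩
                 _ ≡⟨ cong (λ z → a * ⟨ z ⟩) (coeffᴹ-∷ v (i , l) w) ⟩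
                 _ ≈⟨ *-congˡ (fromℕ-sum (picks v) _) ⟩
                 _ ≈⟨ sum-*ˡ a (picks v) _ ⟩
                 sum (picks v) (λ (y , v′) → a * ⟨ coeffᴹ v′ w ℕ∑.when does (Product.≡-dec _≟_ _≟_ y (i , l)) ⟩)
                   ≈⟨ F∑.sum-cong (picks v) (λ (y , v′) → trans (*-congˡ (fromℕ-when (coeffᴹ v′ w) _)) (*-whenʳ a _ _)) ⟩
                 sum (picks v) (λ (y , v′) → a * ⟨ coeffᴹ v′ w ⟩ when does (Product.≡-dec _≟_ _≟_ y (i , l))) ∎) ⟩
            _ ≈⟨ F∑.sum-swap (Tr.A^ N l j) (picks v) _ ⟩
            sum (picks v) (λ (y , v′) → sum (Tr.A^ N l j) (λ (a , w) → a * ⟨ coeffᴹ v′ w ⟩ when does (Product.≡-dec _≟_ _≟_ y (i , l))))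
              ≈⟨ F∑.sum-cong (picks v) (λ ((x , y) , v′) → begin
                _ ≈⟨ F∑.sum-when (Tr.A^ N l j) _ (does (Product.≡-dec _≟_ _≟_ (x , y) (i , l))) ⟩
                _ ≈⟨ F∑.when-cong (does (Product.≡-dec _≟_ _≟_ (x , y) (i , l)))
                       (trans (sym (coeff-terms (Tr.A^ N l j) v′)) (∑walks N l j v′)) ⟩
                _ ≡⟨ when-pair _ x y i l ⟩
                ((⟨ walks N v′ l j ⟩ when does (x ≟ i)) when does (l ≟ y)) ∎) ⟩
            _ ∎) ⟩
      sum (allFin n) (λ l → sum (picks v) (λ ((x , y) , v′) →
        ((⟨ walks N v′ l j ⟩ when does (x ≟ i)) when does (l ≟ y))))
        ≈⟨ F∑.sum-swap (allFin n) (picks v) _ ⟩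
      sum (picks v) (λ ((x , y) , v′) → sum (allFin n) (λ l →
        ((⟨ walks N v′ l j ⟩ when does (x ≟ i)) when does (l ≟ y))))
        ≈⟨ F∑.sum-cong (picks v) (λ ((x , y) , v′) → trans (F∑.sum-delta y _)
             (sym (fromℕ-when (walks N v′ y j) (does (x ≟ i))))) ⟩
      sum (picks v) (λ ((x , y) , v′) → ⟨ walks N v′ y j ℕ∑.when does (x ≟ i) ⟩)
        ≈⟨ fromℕ-sum (picks v) _ ⟨
      ⟨ walks (suc N) v i j ⟩ ∎

    coeff-trA^ : ∀ N v → coeff (Tr.trA^ (suc N)) v ≈ ⟨ closedWalks N v ⟩
    coeff-trA^ N v = begin
      coeff (Tr.trA^ (suc N)) v
        ≈⟨ coeff-∑ᴾ-map _ (allFin n) v ⟩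
      sum (allFin n) (λ i → coeff (Tr.A^ (suc N) i i) v)
        ≈⟨ F∑.sum-cong (allFin n) (λ i → trans (∑walks (suc N) i i v) (fromℕ-sum (picks v) _)) ⟩
      sum (allFin n) (λ i → sum (picks v) (λ ((x , y) , v′) → ⟨ walks N v′ y i ℕ∑.when does (x ≟ i) ⟩))
        ≈⟨ F∑.sum-swap (allFin n) (picks v) _ ⟩
      sum (picks v) (λ ((x , y) , v′) → sum (allFin n) (λ i → ⟨ walks N v′ y i ℕ∑.when does (x ≟ i) ⟩))
        ≈⟨ F∑.sum-cong (picks v) (λ ((x , y) , v′) → trans
             (F∑.sum-cong (allFin n) (λ i → trans (fromℕ-when (walks N v′ y i) _)
               (reflexive (cong (⟨ walks N v′ y i ⟩ when_) (does-sym x i)))))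
             (F∑.sum-delta x _)) ⟩
      sum (picks v) (λ ((x , y) , v′) → ⟨ walks N v′ y x ⟩)
        ≈⟨ fromℕ-sum (picks v) _ ⟨
      ⟨ closedWalks N v ⟩ ∎

    coeff-∂γ : ∀ {r} i (γ : Vec (Fin n) r) p → (∀ {v v′} → v ↭ v′ → coeff p v ≈ coeff p v′) →
      ∀ v → coeff (Tr.∂γ i γ p) v ≈ coeff p (arcs i γ ++ v)
    coeff-∂γ i []      p inv v = refl
    coeff-∂γ i (j ∷ γ) p inv v = trans (coeff-∂γ i γ p inv ((i , j) ∷ v)) (inv (Perm.shift (i , j) (arcs i γ) v))

    coeff-Δ : ∀ i p → (∀ {v v′} → v ↭ v′ → coeff p v ≈ coeff p v′) →
      ∀ v → coeff (Tr.Δ i p) v ≈ operate T (i ∷ []) (coeff p) v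
    coeff-Δ i p inv v = trans (coeff-∑ᴾ-map _ (tuples n (k ∸ 1)) v)
      (F∑.sum-cong (tuples n (k ∸ 1)) λ γ → trans (coeff-• (T i γ) (Tr.∂γ i γ p) v) (*-congˡ (coeff-∂γ i γ p inv v)))

    coeff-fold : ∀ i d p → (∀ {v v′} → v ↭ v′ → coeff p v ≈ coeff p v′) →
      ∀ v → coeff (fold p (Tr.Δ i) d) v ≈ operate T (List.replicate d i) (coeff p) v
    coeff-fold i zero    p inv v = refl
    coeff-fold i (suc d) p inv v = trans
      (coeff-Δ i (fold p (Tr.Δ i) d) (λ p↭ → trans (coeff-fold i d p inv _)
        (trans (operate-inv T (List.replicate d i) inv p↭) (sym (coeff-fold i d p inv _)))) v)
      (operate-cong T (i ∷ []) (coeff-fold i d p inv) v)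

    sortedRoots : (Fin n → ℕ) → List (Fin n) → List (Fin n)
    sortedRoots ds = List.concatMap (λ i → List.replicate (ds i) i)

    constantTerm-∏Δ : ∀ ds p → (∀ {v v′} → v ↭ v′ → coeff p v ≈ coeff p v′) →
      constantTerm F (Tr.∏Δ ds p) ≈
        product (allFin n) (λ i → 1/_! F (lookup ds i ℕ.* (k ∸ 1))) *
        operate T (sortedRoots (lookup ds) (allFin n)) (coeff p) []
    constantTerm-∏Δ ds p inv = go (allFin n) []
      where
      q : List (Fin n) → Poly F (Arc n)
      q = List.foldr
        (λ i q → _•_ F (1/_! F (lookup ds i ℕ.* (k ∸ 1))) (fold q (Tr.Δ i) (lookup ds i))) p
      C : List (Fin n) → Carrier
      C is = product is (λ i → 1/_! F (lookup ds i ℕ.* (k ∸ 1)))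
      go : ∀ is v → coeff (q is) v ≈ C is * operate T (sortedRoots (lookup ds) is) (coeff p) v
      -- An intermediate polynomial inherits its invariance from its own evaluation, hence the
      -- mutual recursion with `go`.
      q-inv : ∀ is {v v′} → v ↭ v′ → coeff (q is) v ≈ coeff (q is) v′
      q-inv is p↭ = trans (go is _) (trans (*-congˡ (operate-inv T (sortedRoots (lookup ds) is) inv p↭)) (sym (go is _)))
      go []       v = sym (*-identityˡ _)
      go (i ∷ is) v = begin
        coeff (q (i ∷ is)) v
          ≈⟨ coeff-• c′ (fold (q is) (Tr.Δ i) d) v ⟩
        c′ * coeff (fold (q is) (Tr.Δ i) d) v
          ≈⟨ *-congˡ (coeff-fold i d (q is) (q-inv is) v) ⟩
        c′ * operate T (List.replicate d i) (coeff (q is)) v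
          ≈⟨ *-congˡ (operate-cong T (List.replicate d i) (go is) v) ⟩
        c′ * operate T (List.replicate d i) (λ v → C is * operate T rest (coeff p) v) v
          ≈⟨ *-congˡ (operate-* T (List.replicate d i) (C is) _ v) ⟩
        c′ * (C is * operate T (List.replicate d i) (operate T rest (coeff p)) v)
          ≈⟨ *-assoc _ _ _ ⟨
        c′ * C is * operate T (List.replicate d i) (operate T rest (coeff p)) v
          ≈⟨ *-congˡ (operate-++ T (List.replicate d i) rest (coeff p) v) ⟨
        C (i ∷ is) * operate T (sortedRoots (lookup ds) (i ∷ is)) (coeff p) v ∎
        where
        d = lookup ds i
        c′ = 1/_! F (d ℕ.* (k ∸ 1))
        rest = sortedRoots (lookup ds) is

-- The trace as a sum over words

module TraceFormula {c ℓ₁ ℓ₂ ℓ₃} (F : OrderedField c ℓ₁ ℓ₂ ℓ₃) where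

  open import Data.List.Base using (upTo; cartesianProductWith)
  open import Data.List.Relation.Binary.Permutation.Propositional as Perm using (_↭_)
  import Data.List.Relation.Binary.Permutation.Propositional.Properties as Perm
  open import Data.Nat.Base using (_∸_; _!)
  open FiniteSums
  open Walks using (Letter; Word; arcs; wordArcs; Arc; closedWalks; closedWalks-↭; ∑ℕ; module ℕ∑)
  open Evaluation F

  open import Algebra.Bundles using (CommutativeRing)

  open OrderedField F hiding (zero)
  open import Relation.Binary.Reasoning.Setoid (CommutativeRing.setoid field-commutativeRing)
  open import Algebra.Properties.CommutativeSemigroup (CommutativeRing.*-commutativeSemigroup field-commutativeRing) using (x∙yz≈y∙xz; interchange)

  fromℕ-* : ∀ a b → ⟨ a ℕ.* b ⟩ ≈ ⟨ a ⟩ * ⟨ b ⟩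
  fromℕ-* zero    b = sym (zeroˡ _)
  fromℕ-* (suc a) b = begin
    ⟨ b ℕ.+ a ℕ.* b ⟩         ≈⟨ fromℕ-+ b (a ℕ.* b) ⟩
    ⟨ b ⟩ + ⟨ a ℕ.* b ⟩       ≈⟨ +-cong (sym (*-identityˡ _)) (fromℕ-* a b) ⟩
    1# * ⟨ b ⟩ + ⟨ a ⟩ * ⟨ b ⟩  ≈⟨ distribʳ _ _ _ ⟨
    (1# + ⟨ a ⟩) * ⟨ b ⟩       ∎

  fromℕ-1 : ⟨ 1 ⟩ ≈ 1#
  fromℕ-1 = +-identityʳ 1#

  infix 9 _⁻¹!
  _⁻¹! : ℕ → Carrier
  n ⁻¹! = 1/_! F n

  x-0≈x : ∀ x → x - 0# ≈ x
  x-0≈x x = trans (+-congˡ (trans (sym (+-identityˡ _)) (-‿inverseʳ 0#))) (+-identityʳ x)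

  ⁻¹!-inverseˡ : ∀ n → n ⁻¹! * ⟨ n ! ⟩ ≈ 1#
  ⁻¹!-inverseˡ n = trans (*-congˡ (sym (x-0≈x _)))
    (proj₁ (proj₂ (#⇒invertible (Equivalence.from #⇔<⊎> (inj₂ (0<fromℕ F (n !) {{n ℕ.!≢0}}))))))

  ⁻¹!-cancel : ∀ n {x y} → ⟨ n ! ⟩ * x ≈ y → x ≈ n ⁻¹! * y
  ⁻¹!-cancel n {x} {y} eq = begin
    x                          ≈⟨ *-identityˡ x ⟨
    1# * x                     ≈⟨ *-congʳ (⁻¹!-inverseˡ n) ⟨
    n ⁻¹! * ⟨ n ! ⟩ * x        ≈⟨ *-assoc _ _ _ ⟩
    n ⁻¹! * (⟨ n ! ⟩ * x)      ≈⟨ *-congˡ eq ⟩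
    n ⁻¹! * y                  ∎

  suc*⁻¹! : ∀ n → ⟨ suc n ⟩ * (suc n) ⁻¹! ≈ n ⁻¹!
  suc*⁻¹! n = sym (begin
    n ⁻¹!                                              ≈⟨ *-identityˡ _ ⟨
    1# * n ⁻¹!                                         ≈⟨ *-congʳ (⁻¹!-inverseˡ (suc n)) ⟨
    (suc n) ⁻¹! * ⟨ suc n ℕ.* n ! ⟩ * n ⁻¹!            ≈⟨ *-congʳ (*-congˡ (fromℕ-* (suc n) (n !))) ⟩
    (suc n) ⁻¹! * (⟨ suc n ⟩ * ⟨ n ! ⟩) * n ⁻¹!        ≈⟨ *-congʳ (sym (*-assoc _ _ _)) ⟩
    (suc n) ⁻¹! * ⟨ suc n ⟩ * ⟨ n ! ⟩ * n ⁻¹!          ≈⟨ *-assoc _ _ _ ⟩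
    (suc n) ⁻¹! * ⟨ suc n ⟩ * (⟨ n ! ⟩ * n ⁻¹!)        ≈⟨ *-congˡ (trans (*-comm _ _) (⁻¹!-inverseˡ n)) ⟩
    (suc n) ⁻¹! * ⟨ suc n ⟩ * 1#                       ≈⟨ *-identityʳ _ ⟩
    (suc n) ⁻¹! * ⟨ suc n ⟩                            ≈⟨ *-comm _ _ ⟩
    ⟨ suc n ⟩ * (suc n) ⁻¹!                            ∎)

  antidiagonal : ℕ → (ℕ → ℕ → Carrier) → Carrier
  antidiagonal zero    f = f 0 0
  antidiagonal (suc t) f = f 0 (suc t) + antidiagonal t (f ∘ suc)

  antidiagonal-cong : ∀ t {f g} → (∀ e s → e ℕ.+ s ≡ t → f e s ≈ g e s) → antidiagonal t f ≈ antidiagonal t g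
  antidiagonal-cong zero    eq = eq 0 0 ≡.refl
  antidiagonal-cong (suc t) eq = +-cong (eq 0 (suc t) ≡.refl) (antidiagonal-cong t λ e s p → eq (suc e) s (cong suc p))

  antidiagonal-last : ∀ t f → antidiagonal (suc t) f ≈ antidiagonal t (λ e s → f e (suc s)) + f (suc t) 0
  antidiagonal-last zero    f = refl
  antidiagonal-last (suc t) f = trans (+-congˡ (antidiagonal-last t (f ∘ suc))) (sym (+-assoc _ _ _))

  antidiagonal-+ : ∀ t f g → antidiagonal t (λ e s → f e s + g e s) ≈ antidiagonal t f + antidiagonal t g
  antidiagonal-+ zero    f g = refl
  antidiagonal-+ (suc t) f g = trans (+-congˡ (antidiagonal-+ t (f ∘ suc) (g ∘ suc)))
    (interchange′ _ _ _ _)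
    where open import Algebra.Properties.CommutativeSemigroup
            (CommutativeRing.+-commutativeSemigroup field-commutativeRing) renaming (interchange to interchange′)

  antidiagonal-0 : ∀ t → antidiagonal t (λ _ _ → 0#) ≈ 0#
  antidiagonal-0 zero    = refl
  antidiagonal-0 (suc t) = trans (+-identityˡ _) (antidiagonal-0 t)

  antidiagonal-sum : ∀ {a} {A : Set a} t (xs : List A) (f : ℕ → ℕ → A → Carrier) →
    antidiagonal t (λ e s → sum xs (f e s)) ≈ sum xs (λ x → antidiagonal t (λ e s → f e s x))
  antidiagonal-sum t []       f = antidiagonal-0 t
  antidiagonal-sum t (x ∷ xs) f = trans (antidiagonal-+ t _ _) (+-congˡ (antidiagonal-sum t xs f))

  antidiagonal-* : ∀ t x f → x * antidiagonal t f ≈ antidiagonal t (λ e s → x * f e s)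
  antidiagonal-* zero    x f = refl
  antidiagonal-* (suc t) x f = trans (distribˡ _ _ _) (+-congˡ (antidiagonal-* t x (f ∘ suc)))

  -- `suc t` is written as e + s. The term with e = 0 drops out of the first half, the one with s =
  -- 0 out of the second; the halves become the words that begin with 0 and those that do not.
  antidiagonal-weighted : ∀ t f → ⟨ suc t ⟩ * antidiagonal (suc t) f ≈
    antidiagonal t (λ e s → ⟨ suc e ⟩ * f (suc e) s) + antidiagonal t (λ e s → ⟨ suc s ⟩ * f e (suc s))
  antidiagonal-weighted t f = begin
    ⟨ suc t ⟩ * antidiagonal (suc t) f
      ≈⟨ antidiagonal-* (suc t) ⟨ suc t ⟩ f ⟩
    antidiagonal (suc t) (λ e s → ⟨ suc t ⟩ * f e s)
      ≈⟨ antidiagonal-cong (suc t) (λ e s eq → trans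
           (*-congʳ (trans (reflexive (cong ⟨_⟩ (≡.sym eq))) (fromℕ-+ e s))) (distribʳ (f e s) _ _)) ⟩
    antidiagonal (suc t) (λ e s → ⟨ e ⟩ * f e s + ⟨ s ⟩ * f e s)
      ≈⟨ antidiagonal-+ (suc t) (λ e s → ⟨ e ⟩ * f e s) (λ e s → ⟨ s ⟩ * f e s) ⟩
    antidiagonal (suc t) (λ e s → ⟨ e ⟩ * f e s) + antidiagonal (suc t) (λ e s → ⟨ s ⟩ * f e s)
      ≈⟨ +-cong (trans (+-congʳ (zeroˡ _)) (+-identityˡ _))
           (trans (antidiagonal-last t (λ e s → ⟨ s ⟩ * f e s)) (trans (+-congˡ (zeroˡ _)) (+-identityʳ _))) ⟩
    _ ∎

  antidiagonal-upTo : ∀ (g : ℕ → ℕ) t (h : ℕ → Carrier) f → (∀ e → h (g e) ≈ f e (t ∸ e)) →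
    sum (List.applyUpTo g (suc t)) h ≈ antidiagonal t f
  antidiagonal-upTo g zero    h f eq = trans (+-identityʳ _) (eq 0)
  antidiagonal-upTo g (suc t) h f eq = +-cong (eq 0) (antidiagonal-upTo (g ∘ suc) t h (f ∘ suc) (eq ∘ suc))

  wordSum : ∀ n → ℕ → (List (Fin n) → Carrier) → Carrier
  wordSum n zero    φ = φ []
  wordSum n (suc t) φ = sum (allFin n) λ i → wordSum n t (φ ∘ (i ∷_))

  wordSum-cong : ∀ n t {φ ψ} → (∀ σ → φ σ ≈ ψ σ) → wordSum n t φ ≈ wordSum n t ψ
  wordSum-cong n zero    eq = eq []
  wordSum-cong n (suc t) eq = F∑.sum-cong (allFin n) λ i → wordSum-cong n t (eq ∘ (i ∷_))

  wordSum-sum : ∀ n {a} {A : Set a} t (xs : List A) (f : List (Fin n) → A → Carrier) →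
    wordSum n t (λ σ → sum xs (f σ)) ≈ sum xs (λ x → wordSum n t (λ σ → f σ x))
  wordSum-sum n zero    xs f = refl
  wordSum-sum n (suc t) xs f = trans (F∑.sum-cong (allFin n) λ i → wordSum-sum n t xs (λ σ → f (i ∷ σ)))
    (F∑.sum-swap (allFin n) xs _)

  Symmetric : ∀ {a} {A : Set a} → (List A → Carrier) → Set _
  Symmetric φ = ∀ {σ τ} → σ ↭ τ → φ σ ≈ φ τ

  module _ (n : ℕ) where

    private
      M : ℕ → ℕ → (List (Fin (suc n)) → Carrier) → Carrier
      M e s φ = wordSum n s (λ σ → φ (List.replicate e zero ++ List.map suc σ))

    -- The multinomial theorem, one letter at a time.
    wordSum-split : ∀ t φ → Symmetric φ →
      ⟨ t ! ⟩ * antidiagonal t (λ e s → e ⁻¹! * (s ⁻¹! * M e s φ)) ≈ wordSum (suc n) t φ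
    wordSum-split zero φ inv = begin
      ⟨ 1 ⟩ * (0 ⁻¹! * (0 ⁻¹! * φ []))  ≈⟨ trans (*-congʳ fromℕ-1) (*-identityˡ _) ⟩
      0 ⁻¹! * (0 ⁻¹! * φ [])            ≈⟨ ⁻¹!-cancel 0 (trans (*-congʳ fromℕ-1) (*-identityˡ _)) ⟨
      0 ⁻¹! * φ []                      ≈⟨ ⁻¹!-cancel 0 (trans (*-congʳ fromℕ-1) (*-identityˡ _)) ⟨
      φ []                              ∎
    wordSum-split (suc t) φ inv = begin
      ⟨ suc t ℕ.* t ! ⟩ * Z (suc t) φ
        ≈⟨ *-congʳ (trans (fromℕ-* (suc t) (t !)) (*-comm _ _)) ⟩
      ⟨ t ! ⟩ * ⟨ suc t ⟩ * Z (suc t) φ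
        ≈⟨ *-assoc _ _ _ ⟩
      ⟨ t ! ⟩ * (⟨ suc t ⟩ * Z (suc t) φ)
        ≈⟨ *-congˡ (antidiagonal-weighted t (λ e s → e ⁻¹! * (s ⁻¹! * M e s φ))) ⟩
      ⟨ t ! ⟩ * (antidiagonal t (λ e s → ⟨ suc e ⟩ * (suc e ⁻¹! * (s ⁻¹! * M (suc e) s φ))) +
                 antidiagonal t (λ e s → ⟨ suc s ⟩ * (e ⁻¹! * (suc s ⁻¹! * M e (suc s) φ))))
        ≈⟨ distribˡ _ _ _ ⟩
      _ ≈⟨ +-cong
           (trans (*-congˡ (antidiagonal-cong t λ e s _ → trans (sym (*-assoc _ _ _)) (*-congʳ (suc*⁻¹! e))))
             (wordSum-split t (φ ∘ (zero ∷_)) (λ p → inv (Perm.prep zero p))))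
           (begin
             _ ≈⟨ *-congˡ (antidiagonal-cong t λ e s _ → begin
                  _ ≈⟨ x∙yz≈y∙xz _ _ _ ⟩
                  e ⁻¹! * (⟨ suc s ⟩ * (suc s ⁻¹! * M e (suc s) φ)) ≈⟨ *-congˡ (sym (*-assoc _ _ _)) ⟩
                  e ⁻¹! * (⟨ suc s ⟩ * suc s ⁻¹! * M e (suc s) φ)   ≈⟨ *-congˡ (*-cong (suc*⁻¹! s) (peel e s)) ⟩
                  e ⁻¹! * (s ⁻¹! * sum (allFin n) (λ i → M e s (φ ∘ (suc i ∷_)))) ≈⟨ *-congˡ (sum-*ˡ _ (allFin n) _) ⟩
                  _ ≈⟨ sum-*ˡ _ (allFin n) _ ⟩
                  sum (allFin n) (λ i → e ⁻¹! * (s ⁻¹! * M e s (φ ∘ (suc i ∷_)))) ∎) ⟩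
             _ ≈⟨ *-congˡ (antidiagonal-sum t (allFin n) (λ e s i → e ⁻¹! * (s ⁻¹! * M e s (φ ∘ (suc i ∷_))))) ⟩
             _ ≈⟨ sum-*ˡ _ (allFin n) _ ⟩
             _ ≈⟨ F∑.sum-cong (allFin n) (λ i → wordSum-split t (φ ∘ (suc i ∷_)) (λ p → inv (Perm.prep (suc i) p))) ⟩
             _ ∎) ⟩
      _ ≈⟨ F∑.sum-allFin-suc n _ ⟨
      wordSum (suc n) (suc t) φ ∎
      where
      Z : ℕ → (List (Fin (suc n)) → Carrier) → Carrier
      Z t φ = antidiagonal t (λ e s → e ⁻¹! * (s ⁻¹! * M e s φ))
      -- Symmetry brings the first letter behind the zeros to the front, where the induction
      -- hypothesis applies to the remaining letters.
      peel : ∀ e s → M e (suc s) φ ≈ sum (allFin n) (λ i → M e s (φ ∘ (suc i ∷_)))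
      peel e s = F∑.sum-cong (allFin n) λ i → wordSum-cong n s λ σ →
        inv (Perm.shift (suc i) (List.replicate e zero) (List.map suc σ))

  sorted : ∀ {n} → Vec ℕ n → List (Fin n)
  sorted {n} ds = List.concatMap (λ i → List.replicate (lookup ds i) i) (allFin n)

  sorted-∷ : ∀ {n} e (ds : Vec ℕ n) → sorted (e ∷ ds) ≡ List.replicate e zero ++ List.map suc (sorted ds)
  sorted-∷ {n} e ds = cong (List.replicate e zero ++_)
    (≡.trans (cong (List.concatMap (λ i → List.replicate (lookup (e ∷ ds) i) i)) (≡.sym (List.map-tabulate id suc)))
    (≡.trans (List.concatMap-map (λ i → List.replicate (lookup (e ∷ ds) i) i) suc (allFin n))
    (≡.trans (List.concatMap-cong (λ i → ≡.sym (List.map-replicate suc (lookup ds i) i)) (allFin n))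
    (≡.sym (List.map-concatMap suc (λ i → List.replicate (lookup ds i) i) (allFin n))))))

  -- A composition (d₁ , ... , dₙ) is the content of t!/∏ dᵢ! words, and on all of them a symmetric
  -- `φ` has its value at the sorted word.
  compositions-sum : ∀ n t φ → Symmetric φ →
    ⟨ t ! ⟩ * sum (compositions n t) (λ ds → product (allFin n) (λ i → lookup ds i ⁻¹!) * φ (sorted ds)) ≈ wordSum n t φ
  compositions-sum zero    zero    φ inv =
    trans (*-congʳ fromℕ-1) (trans (*-identityˡ _) (trans (+-identityʳ _) (*-identityˡ _)))
  compositions-sum zero    (suc t) φ inv = zeroʳ _
  compositions-sum (suc n) t       φ inv = trans (*-congˡ (begin
    sum (compositions (suc n) t) (λ ds → W ds * φ (sorted ds))
      ≈⟨ F∑.sum-concatMap (λ e → List.map (e ∷_) (compositions n (t ∸ e))) (upTo (suc t)) _ ⟩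
    sum (upTo (suc t)) (λ e → sum (List.map (e ∷_) (compositions n (t ∸ e))) (λ ds → W ds * φ (sorted ds)))
      ≈⟨ F∑.sum-cong (upTo (suc t)) (λ e → begin
         _ ≡⟨ F∑.sum-map (e ∷_) (compositions n (t ∸ e)) _ ⟩
         sum (compositions n (t ∸ e)) (λ ds → W (e ∷ ds) * φ (sorted (e ∷ ds)))
           ≈⟨ F∑.sum-cong (compositions n (t ∸ e)) (λ ds → trans
              (*-cong (F∏.sum-allFin-suc n (λ i → lookup (e ∷ ds) i ⁻¹!)) (reflexive (cong φ (sorted-∷ e ds))))
              (*-assoc _ _ _)) ⟩
         _ ≈⟨ sum-*ˡ _ (compositions n (t ∸ e)) _ ⟨
         _ ≈⟨ *-congˡ (⁻¹!-cancel (t ∸ e) (compositions-sum n (t ∸ e)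
                (λ σ → φ (List.replicate e zero ++ List.map suc σ))
                (λ p → inv (Perm.++⁺ˡ (List.replicate e zero) (Perm.map⁺ suc p))))) ⟩
         _ ∎) ⟩
    _ ≈⟨ antidiagonal-upTo id t _ (λ e s → e ⁻¹! * (s ⁻¹! * wordSum n s (λ σ → φ (List.replicate e zero ++ List.map suc σ))))
           (λ e → refl) ⟩
    _ ∎)) (wordSum-split n t φ inv)
    where
    W : Vec ℕ (suc n) → Carrier
    W ds = product (allFin (suc n)) (λ i → lookup ds i ⁻¹!)

  count : ∀ {n} → Fin n → List (Fin n) → ℕ
  count i σ = ∑ℕ σ λ j → 1 ℕ∑.when does (j ≟ i)

  count-sorted : ∀ {n} (ds : Vec ℕ n) i → count i (sorted ds) ≡ lookup ds i
  count-sorted {n} ds i = ≡.trans (ℕ∑.sum-concatMap _ (allFin n) _)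
    (≡.trans (ℕ∑.sum-cong (allFin n) (λ j → rep (lookup ds j) j)) (ℕ∑.sum-delta i (lookup ds)))
    where
    rep : ∀ d j → count i (List.replicate d j) ≡ (d ℕ∑.when does (j ≟ i))
    rep zero    j with does (j ≟ i)
    ... | true  = ≡.refl
    ... | false = ≡.refl
    rep (suc d) j = ≡.trans (cong₂ ℕ._+_ ≡.refl (rep d j)) (lem (does (j ≟ i)))
      where
      lem : ∀ b → (1 ℕ∑.when b) ℕ.+ (d ℕ∑.when b) ≡ (suc d ℕ∑.when b)
      lem true  = ≡.refl
      lem false = ≡.refl

  letters : ∀ n r → List (Letter n r)
  letters n r = cartesianProductWith _,_ (allFin n) (tuples n r)

  words : ∀ n r → ℕ → List (Word n r)
  words n r zero    = [] ∷ []
  words n r (suc t) = cartesianProductWith _∷_ (letters n r) (words n r t)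

  roots : ∀ {n r} → Word n r → List (Fin n)
  roots = List.map proj₁

  -- `φ` and `v` are general for the sake of the induction: the first absorbs the tensor entries
  -- chosen so far, the second their arcs.
  wordSum-operate : ∀ {n r} (T : Fin n → Vec (Fin n) r → Carrier) t φ g v → Symmetric g →
    wordSum n t (λ σ → φ σ * operate T σ g v) ≈
    sum (words n r t) (λ w → φ (roots w) * (product w (λ (i , γ) → T i γ) * g (wordArcs w ++ v)))
  wordSum-operate T zero φ g v inv = sym (trans (+-identityʳ _) (*-congˡ (*-identityˡ _)))
  wordSum-operate {n} {r} T (suc t) φ g v inv = begin
    sum (allFin n) (λ i → wordSum n t (λ σ → φ (i ∷ σ) * sum (tuples n r) (λ γ → T i γ * operate T σ g (arcs i γ ++ v))))
      ≈⟨ F∑.sum-cong (allFin n) (λ i → trans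
           (wordSum-cong n t λ σ → trans (sum-*ˡ _ (tuples n r) _)
             (F∑.sum-cong (tuples n r) λ γ → sym (*-assoc _ _ _)))
           (wordSum-sum n t (tuples n r) (λ σ γ → φ (i ∷ σ) * T i γ * operate T σ g (arcs i γ ++ v)))) ⟩
    sum (allFin n) (λ i → sum (tuples n r) (λ γ → wordSum n t (λ σ → φ (i ∷ σ) * T i γ * operate T σ g (arcs i γ ++ v))))
      ≈⟨ F∑.sum-cong (allFin n) (λ i → F∑.sum-cong (tuples n r) λ γ →
           wordSum-operate T t (λ σ → φ (i ∷ σ) * T i γ) g (arcs i γ ++ v) inv) ⟩
    sum (allFin n) (λ i → sum (tuples n r) (λ γ → sum (words n r t) (λ w →
      φ (i ∷ roots w) * T i γ * (product w (λ (i , γ) → T i γ) * g (wordArcs w ++ (arcs i γ ++ v))))))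
      ≈⟨ F∑.sum-cong (allFin n) (λ i → F∑.sum-cong (tuples n r) λ γ → F∑.sum-cong (words n r t) λ w →
         trans (*-assoc _ _ _) (*-congˡ (trans (sym (*-assoc _ _ _)) (*-congˡ (inv (rearrange i γ w)))))) ⟩
    _ ≈⟨ F∑.sum-cartesian _,_ (allFin n) (tuples n r) _ ⟨
    _ ≈⟨ F∑.sum-cartesian _∷_ (letters n r) (words n r t) _ ⟨
    _ ∎
    where
    rearrange : ∀ i γ w → wordArcs w ++ (arcs i γ ++ v) ↭ (arcs i γ ++ wordArcs w) ++ v
    rearrange i γ w = Perm.trans (Perm.shifts (wordArcs w) (arcs i γ))
      (Perm.↭-reflexive (≡.sym (List.++-assoc (arcs i γ) (wordArcs w) v)))

  -- The factor by which sorting the roots of a word of given content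
  -- overcounts, times the normalising factorials of the trace formula.
  multiplicity : ∀ r {n} → List (Fin n) → Carrier
  multiplicity r {n} σ = product (allFin n) λ i → ⟨ count i σ ! ⟩ * (count i σ ℕ.* r) ⁻¹!

  multiplicity-↭ : ∀ r {n} → Symmetric (multiplicity r {n})
  multiplicity-↭ r {n} p = F∏.sum-cong (allFin n) λ i →
    reflexive (cong (λ d → ⟨ d ! ⟩ * (d ℕ.* r) ⁻¹!) (ℕ∑.sum-↭ _ p))

  term : ∀ {n r} → (Fin n → Vec (Fin n) r → Carrier) → ℕ → Word n r → Carrier
  term {r = r} T N w = multiplicity r (roots w) * (product w (λ (i , γ) → T i γ) * ⟨ closedWalks N (wordArcs w) ⟩)

  module _ (k′ : ℕ) where
    private
      k r : ℕ
      k = suc (suc k′)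
      r = suc k′

    trace-words : ∀ {n} (T : Tensor F k n) d →
      Trace.Tr F k {n} T (suc d) ≈
      ⟨ r ℕ.^ (n ∸ 1) ⟩ * (suc d ⁻¹! * sum (words n r (suc d)) (term T (k′ ℕ.+ d ℕ.* r)))
    trace-words {n} T d = *-congˡ (begin
      ∑ F (List.map (λ ds → constantTerm F (Tr.∏Δ ds (Tr.trA^ (suc N)))) (compositions n (suc d)))
        ≡⟨ ∑-map _ (compositions n (suc d)) ⟩
      sum (compositions n (suc d)) (λ ds → constantTerm F (Tr.∏Δ ds (Tr.trA^ (suc N))))
        ≈⟨ F∑.sum-cong (compositions n (suc d)) (λ ds → trans
             (constantTerm-∏Δ k {n} T ds (Tr.trA^ (suc N)) λ {v} {v′} p →
                trans (coeff-trA^ k {n} T N v) (trans (g-inv p) (sym (coeff-trA^ k {n} T N v′))))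
             (trans (*-congˡ (operate-cong T (sorted ds) (coeff-trA^ k {n} T N) []))
             (trans (*-congʳ (weights ds)) (*-assoc _ _ _)))) ⟩
      sum (compositions n (suc d)) (λ ds → product (allFin n) (λ i → lookup ds i ⁻¹!) * φ (sorted ds))
        ≈⟨ ⁻¹!-cancel (suc d) (compositions-sum n (suc d) φ φ-inv) ⟩
      suc d ⁻¹! * wordSum n (suc d) φ
        ≈⟨ *-congˡ (wordSum-operate T (suc d) (multiplicity r) g [] g-inv) ⟩
      _ ≈⟨ *-congˡ (F∑.sum-cong (words n r (suc d)) λ w → *-congˡ (*-congˡ
            (reflexive (cong g (List.++-identityʳ (wordArcs w)))))) ⟩
      suc d ⁻¹! * sum (words n r (suc d)) (term T N) ∎)
      where
      module Tr = Trace F k {n} T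
      -- Chosen so that `suc N` computes to `suc d ℕ.* r`, the exponent of the matrix and the number
      -- of arcs of the word.
      N = k′ ℕ.+ d ℕ.* r
      g : List (Arc n) → Carrier
      g v = ⟨ closedWalks N v ⟩
      g-inv : Symmetric g
      g-inv p = reflexive (cong ⟨_⟩ (closedWalks-↭ N p))
      φ : List (Fin n) → Carrier
      φ σ = multiplicity r σ * operate T σ g []
      φ-inv : Symmetric φ
      φ-inv p = *-cong (multiplicity-↭ r p) (operate-↭ T g-inv p [])
      -- Each factor is multiplied by 1, written as dᵢ! divided by itself. The inverse factorials
      -- are those of `compositions-sum`; the rest is `multiplicity`.
      weights : ∀ ds → product (allFin n) (λ i → (lookup ds i ℕ.* r) ⁻¹!) ≈
        product (allFin n) (λ i → lookup ds i ⁻¹!) * multiplicity r (sorted ds)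
      weights ds = begin
        product (allFin n) (λ i → (lookup ds i ℕ.* r) ⁻¹!)
          ≈⟨ F∏.sum-cong (allFin n) (λ i → begin
               _ ≈⟨ *-identityˡ _ ⟨
               1# * (lookup ds i ℕ.* r) ⁻¹! ≈⟨ *-congʳ (⁻¹!-inverseˡ (lookup ds i)) ⟨
               _ ≈⟨ *-assoc _ _ _ ⟩
               _ ≡⟨ cong (λ d → lookup ds i ⁻¹! * (⟨ d ! ⟩ * (d ℕ.* r) ⁻¹!)) (≡.sym (count-sorted ds i)) ⟩
               _ ∎) ⟩
        _ ≈⟨ F∏.sum-∙ (allFin n) _ _ ⟩
        _ ∎

-- Splitting a word's contribution into loop and hyperedge terms; relabelling

module Expansion {c ℓ₁ ℓ₂ ℓ₃} (F : OrderedField c ℓ₁ ℓ₂ ℓ₃) where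

  open import Data.Fin.Subset using (_∈_; ⊤)
  open import Data.Fin.Subset.Properties using (∈⊤; ⊆-antisym)
  open import Data.List.Membership.Propositional using () renaming (find to find∈)
  open import Data.List.Membership.Propositional.Properties using (∈-map⁺; ∈-map⁻)
  open import Data.List.Relation.Unary.All as All using (All; []; _∷_)
  import Data.List.Relation.Unary.All.Properties as All
  open import Data.List.Relation.Unary.Any as Any using (Any)
  import Data.List.Relation.Unary.Any.Properties as Any
  open import Data.Nat.Base using (_!)
  open FiniteSums
  open Walks
  open Words
  open Evaluation F
  open TraceFormula F

  open import Algebra.Bundles using (CommutativeRing)

  open OrderedField F hiding (zero)
  open import Relation.Binary.Reasoning.Setoid (CommutativeRing.setoid field-commutativeRing)
  open import Algebra.Properties.CommutativeSemigroup (CommutativeRing.*-commutativeSemigroup field-commutativeRing) using (x∙yz≈y∙xz)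

  pow : Carrier → ℕ → Carrier
  pow x zero    = 1#
  pow x (suc n) = x * pow x n

  when-* : ∀ x b y → (x when b) * y ≈ (x * y when b)
  when-* x true  y = refl
  when-* x false y = zeroˡ y

  when-0 : ∀ {x} b → x ≈ 0# → (x when b) ≈ 0#
  when-0 true  eq = eq
  when-0 false eq = refl

  when-false : ∀ {p} {P : Set p} x (P? : Dec P) → ¬ P → (x when does P?) ≈ 0#
  when-false x P? ¬p rewrite dec-false P? ¬p = refl

  sum-select : ∀ {n p} {P : Fin n → Set p} (P? : ∀ i → Dec (P i)) i₀ → P i₀ → (∀ i → P i → i ≡ i₀) →
    ∀ f → sum (allFin n) (λ i → f i when does (P? i)) ≈ f i₀
  sum-select {n} P? i₀ p₀ unique f = trans
    (F∑.sum-cong (allFin n) λ i → reflexive (cong (f i when_)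
      (does-⇔ (mk⇔ (unique i) λ { ≡.refl → p₀ }) (P? i) (i ≟ i₀))))
    (F∑.sum-delta i₀ f)

  loopsAt? : ∀ {n r} i (w : Word n r) → Dec (LoopsAt i w)
  loopsAt? {r = r} i w = All.all? (λ ℓ → ≡-dec _≟_ (Vec.≡-dec _≟_) ℓ (loopLetter r i)) w
    where open import Data.Product.Properties using (≡-dec)

  loopCoeff : ∀ {n r} → ℕ → Fin n → Word n r → Carrier
  loopCoeff {r = r} N i w = multiplicity r (roots w) * ⟨ closedWalks N (wordArcs w) ⟩ when does (loopsAt? i w)

  module Weighted (β : Carrier) {n m} (H : Hypergraph n m) where

    -- The weighted adjacency tensor with its loop weights and its edge weight as parameters. For 𝒜
    -- they are α dᵢ and (1 - α)/(k - 1)!.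
    entry : ∀ {r} → (Fin n → Carrier) → Fin n → Vec (Fin n) r → Carrier
    entry x i γ = if does (isLoop? (i , γ)) then x i else β when does (IsEdge? H (support i γ))

    weight : ∀ {r} → (Fin n → Carrier) → Word n r → Carrier
    weight x w = product w λ (i , γ) → entry x i γ

    Kind : ∀ {r} → Letter n r → Set
    Kind ℓ = IsLoop ℓ ⊎ (∃[ e ] IsEdge H e ℓ)

    kind? : ∀ {r} (ℓ : Letter n r) → Dec (Kind ℓ)
    kind? (i , γ) = isLoop? (i , γ) ⊎-dec IsEdge? H (support i γ)

    -- The exponent of β is fixed at `suc r`, the number of edge letters that `shape` finds in every
    -- contributing word.
    edgeCoeff : ∀ {r} → ℕ → Fin m → Word n r → Carrier
    edgeCoeff {r} N e w =
      multiplicity r (roots w) * (pow β (suc r) * ⟨ closedWalks N (wordArcs w) ⟩) when does (edgeWord? H e w)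

    weight-kinds : ∀ {r} x (w : Word n r) → All Kind w →
      weight x w ≈ pow β (nonloops w) * product (loopRoots w) x
    weight-kinds x []            []           = sym (*-identityˡ _)
    weight-kinds x ((i , γ) ∷ w) (kind ∷ ks) with isLoop? (i , γ) | kind
    ... | yes loop | _                = trans (*-congˡ (weight-kinds x w ks)) (x∙yz≈y∙xz _ _ _)
    ... | no ¬loop | inj₁ loop        = ⊥-elim (¬loop loop)
    ... | no ¬loop | inj₂ is-edge rewrite dec-true (IsEdge? H (support i γ)) is-edge =
      trans (*-congˡ (weight-kinds x w ks)) (sym (*-assoc _ _ _))

    weight-dead : ∀ {r} x (w : Word n r) → ¬ All Kind w → weight x w ≈ 0#
    weight-dead x []            ¬ks = ⊥-elim (¬ks [])
    weight-dead x ((i , γ) ∷ w) ¬ks with isLoop? (i , γ)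
    ... | yes loop = trans (*-congˡ (weight-dead x w λ ks → ¬ks (inj₁ loop ∷ ks))) (zeroʳ _)
    ... | no ¬loop with IsEdge? H (support i γ)
    ... | yes is-edge = trans (*-congˡ (weight-dead x w λ ks → ¬ks (inj₂ is-edge ∷ ks))) (zeroʳ _)
    ... | no ¬edge = zeroˡ _

    weight-loops : ∀ {r} x i (w : Word n r) → LoopsAt i w → weight x w ≈ pow (x i) (length w)
    weight-loops x i []      []              = refl
    weight-loops {r} x i (_ ∷ w) (≡.refl ∷ all) =
      *-cong (reflexive (cong (if_then x i else (β when does (IsEdge? H (support i (replicate r i))))) (dec-true (isLoop? (loopLetter r i)) ≡.refl))) (weight-loops x i w all)

    module _ {r : ℕ} (2≤r : 2 ≤ r) (uniform : Uniform H (suc r)) (linear : Linear H) where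

      private
        1≤r : 1 ≤ r
        1≤r = ℕ.≤-trans (s≤s z≤n) 2≤r

        loops≁edge : ∀ {i e} {w : Word n r} → LoopsAt i w → ¬ EdgeWord H e w
        loops≁edge loops (_ , some) = case find∈ some of λ
          (ℓ , ℓ∈ , is-e) → edge-notLoop H 1≤r uniform {ℓ = ℓ} is-e
            (subst IsLoop (≡.sym (All.lookup loops ℓ∈)) ≡.refl)

        kinds-loops : ∀ {i} {w : Word n r} → LoopsAt i w → All Kind w
        kinds-loops = All.map λ { ≡.refl → inj₁ ≡.refl }

        kinds-edge : ∀ {e} {w : Word n r} → EdgeWord H e w → All Kind w
        kinds-edge {e} (all , _) = All.map (Sum.map₂ (e ,_)) all

        one-edge : ∀ {e e′} {w : Word n r} → EdgeWord H e w → EdgeWord H e′ w → e′ ≡ e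
        one-edge (all , _) (_ , some) with find∈ some
        ... | ℓ , ℓ∈ , is-e′ with All.lookup all ℓ∈
        ... | inj₁ loop = ⊥-elim (edge-notLoop H 1≤r uniform {ℓ = ℓ} is-e′ loop)
        ... | inj₂ is-e = edge-injective H (≡.trans is-e′ (≡.sym is-e))

      -- A word of contributing shape determines its vertex or its hyperedge, so a single summand
      -- survives on the right. For any other word an entry or the number of closed walks is 0, and
      -- every summand vanishes too.
      term-split : ∀ x N (w : Word n r) → 1 ≤ length w → length w ℕ.< suc r ℕ.+ suc r →
        term (entry x) N w ≈
        sum (allFin n) (λ i → loopCoeff N i w * pow (x i) (length w)) +
        sum (allFin m) (λ e → edgeCoeff N e w * product (loopRoots w) x)
      term-split x N w nonempty short with All.all? kind? w
      ... | no ¬ks = trans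
            (trans (*-congˡ (trans (*-congʳ (weight-dead x w ¬ks)) (zeroˡ _))) (zeroʳ _))
            (sym (trans (+-cong
              (F∑.sum-ε (allFin n) λ i → trans (*-congʳ (when-false _ (loopsAt? i w) (¬ks ∘ kinds-loops))) (zeroˡ _))
              (F∑.sum-ε (allFin m) λ e → trans (*-congʳ (when-false _ (edgeWord? H e w) (¬ks ∘ kinds-edge))) (zeroˡ _)))
              (+-identityʳ 0#)))
      ... | yes ks with closedWalks N (wordArcs w) ℕ.≟ 0
      ... | yes ≡0 = trans (zero₃ _ _)
            (sym (trans (+-cong
              (F∑.sum-ε (allFin n) λ i → trans (*-congʳ (when-0 (does (loopsAt? i w)) (zero₂ _))) (zeroˡ _))
              (F∑.sum-ε (allFin m) λ e → trans (*-congʳ (when-0 (does (edgeWord? H e w)) (zero₃ _ _))) (zeroˡ _)))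
              (+-identityʳ 0#)))
        where
        zero₂ : ∀ y → y * ⟨ closedWalks N (wordArcs w) ⟩ ≈ 0#
        zero₂ y = trans (*-congˡ (reflexive (cong ⟨_⟩ ≡0))) (zeroʳ y)
        zero₃ : ∀ y z → y * (z * ⟨ closedWalks N (wordArcs w) ⟩) ≈ 0#
        zero₃ y z = trans (*-congˡ (zero₂ z)) (zeroʳ y)
      ... | no ≢0 with shape H 2≤r uniform linear N w ks ≢0 nonempty short
      ... | loopsAt i loops = sym (begin
        _ ≈⟨ +-cong
              (trans (F∑.sum-cong (allFin n) λ j → when-* _ (does (loopsAt? j w)) _)
                     (sum-select (λ j → loopsAt? j w) i loops (λ j loops′ → unique nonempty loops loops′) _))
              (F∑.sum-ε (allFin m) λ e → trans (*-congʳ (when-false _ (edgeWord? H e w) (loops≁edge loops))) (zeroˡ _)) ⟩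
        M * C * pow (x i) (length w) + 0#  ≈⟨ +-identityʳ _ ⟩
        M * C * pow (x i) (length w)       ≈⟨ *-assoc _ _ _ ⟩
        M * (C * pow (x i) (length w))     ≈⟨ *-congˡ (*-comm _ _) ⟩
        M * (pow (x i) (length w) * C)     ≈⟨ *-congˡ (*-congʳ (weight-loops x i w loops)) ⟨
        term (entry x) N w                 ∎)
        where
        M C : Carrier
        M = multiplicity r (roots w)
        C = ⟨ closedWalks N (wordArcs w) ⟩
        unique : ∀ {w : Word n r} {i j} → 1 ≤ length w → LoopsAt i w → LoopsAt j w → j ≡ i
        unique {_ ∷ _} _ (≡.refl ∷ _) (eq ∷ _) = ≡.sym (cong proj₁ eq)
      ... | inEdge e ew full = sym (begin
        _ ≈⟨ +-cong
              (F∑.sum-ε (allFin n) λ i → trans (*-congʳ (when-false _ (loopsAt? i w) (λ loops → loops≁edge loops ew))) (zeroˡ _))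
              (trans (F∑.sum-cong (allFin m) λ e → when-* _ (does (edgeWord? H e w)) _)
                     (sum-select (λ e → edgeWord? H e w) e ew (λ e′ ew′ → one-edge ew ew′) _)) ⟩
        0# + M * (B * C) * X     ≈⟨ +-identityˡ _ ⟩
        M * (B * C) * X          ≈⟨ *-assoc _ _ _ ⟩
        M * (B * C * X)          ≈⟨ *-congˡ (trans (*-assoc _ _ _) (trans (*-congˡ (*-comm _ _)) (sym (*-assoc _ _ _)))) ⟩
        M * (B * X * C)          ≈⟨ *-congˡ (*-congʳ (trans (weight-kinds x w ks)
                                      (*-congʳ (reflexive (cong (pow β) full))))) ⟨
        term (entry x) N w       ∎)
        where
        M B C X : Carrier
        M = multiplicity r (roots w)
        B = pow β (suc r)
        C = ⟨ closedWalks N (wordArcs w) ⟩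
        X = product (loopRoots w) x

  mapLetter : ∀ {k n r} → (Fin k → Fin n) → Letter k r → Letter n r
  mapLetter ι (i , γ) = ι i , Vec.map ι γ

  mapWord : ∀ {k n r} → (Fin k → Fin n) → Word k r → Word n r
  mapWord ι = List.map (mapLetter ι)

  roots-map : ∀ {k n r} (ι : Fin k → Fin n) (w : Word k r) → roots (mapWord ι w) ≡ List.map ι (roots w)
  roots-map ι []      = ≡.refl
  roots-map ι (_ ∷ w) = cong (_ ∷_) (roots-map ι w)

  wordArcs-map : ∀ {k n r} (ι : Fin k → Fin n) (w : Word k r) → wordArcs (mapWord ι w) ≡ List.map (mapArc ι) (wordArcs w)
  wordArcs-map ι []            = ≡.refl
  wordArcs-map ι ((i , γ) ∷ w) = ≡.trans (cong₂ _++_ (arcs-map γ) (wordArcs-map ι w))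
    (≡.sym (List.map-++ (mapArc ι) (arcs i γ) (wordArcs w)))
    where
    arcs-map : ∀ {r} (γ : Vec _ r) → arcs (ι i) (Vec.map ι γ) ≡ List.map (mapArc ι) (arcs i γ)
    arcs-map []      = ≡.refl
    arcs-map (j ∷ γ) = cong (_ ∷_) (arcs-map γ)

  module Relabel {k n} (ι : Fin k → Fin n) (ι-inj : Injective _≡_ _≡_ ι) {r : ℕ} where

    restricts-letters : F∑.Restricts (mapLetter ι) (letters k r) (letters n r)
    restricts-letters = F∑.restricts-cartesian (allFin k) (allFin n) (tuples k r) (tuples n r) _,_ _,_
      (λ _ _ → ≡.refl) (λ { _ _ (i , γ) ≡.refl → (i , ≡.refl) , (γ , ≡.refl) })
      (F∑.restricts-allFin ι ι-inj) (F∑.restricts-tuples ι ι-inj r)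

    restricts-words : ∀ t → F∑.Restricts (mapWord {r = r} ι) (words k r t) (words n r t)
    restricts-words zero    f f-off = refl
    restricts-words (suc t) = F∑.restricts-cartesian (letters k r) (letters n r) (words k r t) (words n r t) _∷_ _∷_
      (λ _ _ → ≡.refl) (λ { _ _ (ℓ ∷ w) ≡.refl → (ℓ , ≡.refl) , (w , ≡.refl) })
      restricts-letters (restricts-words t)

    count-map : ∀ i σ → count (ι i) (List.map ι σ) ≡ count i σ
    count-map i []      = ≡.refl
    count-map i (j ∷ σ) = cong₂ ℕ._+_ (cong 𝟙 (does-injective ι ι-inj j i)) (count-map i σ)

    count-off : ∀ x → (∀ i → x ≢ ι i) → ∀ σ → count x (List.map ι σ) ≡ 0
    count-off x off []      = ≡.refl
    count-off x off (j ∷ σ) = cong₂ ℕ._+_ (cong 𝟙 (dec-false (ι j ≟ x) (off j ∘ ≡.sym))) (count-off x off σ)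

    -- A vertex off the image occurs 0 times and contributes the factor 0!/0! = 1.
    multiplicity-map : ∀ σ → multiplicity r (List.map ι σ) ≈ multiplicity r σ
    multiplicity-map σ = trans
      (F∏.restricts-allFin ι ι-inj _ λ x off → trans
        (reflexive (cong (λ d → ⟨ d ! ⟩ * (d ℕ.* r) ⁻¹!) (count-off x off σ)))
        (trans (*-comm _ _) (⁻¹!-inverseˡ 0)))
      (F∏.sum-cong (allFin k) λ i → reflexive (cong (λ d → ⟨ d ! ⟩ * (d ℕ.* r) ⁻¹!) (count-map i σ)))

    multiplicity-mapWord : ∀ (w : Word k r) → multiplicity r (roots (mapWord ι w)) ≈ multiplicity r (roots w)
    multiplicity-mapWord w = trans (reflexive (cong (multiplicity r) (roots-map ι w))) (multiplicity-map (roots w))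

    closedWalks-mapWord : ∀ N (w : Word k r) → closedWalks N (wordArcs (mapWord ι w)) ≡ closedWalks N (wordArcs w)
    closedWalks-mapWord N w = ≡.trans (cong (closedWalks N) (wordArcs-map ι w)) (closedWalks-map ι ι-inj N (wordArcs w))

    Vec-map-injective : ∀ {s} → Injective _≡_ _≡_ (Vec.map {n = s} ι)
    Vec-map-injective {x = []}    {[]}    eq = ≡.refl
    Vec-map-injective {x = _ ∷ _} {_ ∷ _} eq =
      cong₂ _∷_ (ι-inj (Vec.∷-injectiveˡ eq)) (Vec-map-injective (Vec.∷-injectiveʳ eq))

    isLoop-map : ∀ (ℓ : Letter k r) → IsLoop (mapLetter ι ℓ) ⇔ IsLoop ℓ
    isLoop-map (i , γ) = mk⇔
      (λ loop → Vec-map-injective (≡.trans loop (≡.sym (Vec.map-replicate ι i r))))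
      (λ { ≡.refl → Vec.map-replicate ι i r })

    loopsAt-map : ∀ i (w : Word k r) → LoopsAt (ι i) (mapWord ι w) ⇔ LoopsAt i w
    loopsAt-map i w = mk⇔
      (λ all → All.map (λ { {j , γ} eq → to eq }) (All.map⁻ all))
      (λ all → All.map⁺ (All.map (λ { ≡.refl → cong (ι i ,_) (Vec.map-replicate ι i r) }) all))
      where
      to : ∀ {j γ} → mapLetter ι (j , γ) ≡ loopLetter r (ι i) → (j , γ) ≡ loopLetter r i
      to {j} {γ} eq with ι-inj (cong proj₁ eq)
      ... | ≡.refl = cong (i ,_) (Equivalence.to (isLoop-map (i , γ)) (cong proj₂ eq))

    loopRoots-map : ∀ (w : Word k r) → loopRoots (mapWord ι w) ≡ List.map ι (loopRoots w)
    loopRoots-map []      = ≡.refl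
    loopRoots-map (ℓ ∷ w) rewrite does-⇔ (isLoop-map ℓ) (isLoop? (mapLetter ι ℓ)) (isLoop? ℓ) with does (isLoop? ℓ)
    ... | true  = cong (_ ∷_) (loopRoots-map w)
    ... | false = loopRoots-map w

    loopCoeff-map : ∀ N i (w : Word k r) → loopCoeff N (ι i) (mapWord ι w) ≈ loopCoeff N i w
    loopCoeff-map N i w = trans
      (reflexive (cong (_ when_) (does-⇔ (loopsAt-map i w) (loopsAt? (ι i) (mapWord ι w)) (loopsAt? i w))))
      (F∑.when-cong (does (loopsAt? i w)) (*-cong (multiplicity-mapWord w) (reflexive (cong ⟨_⟩ (closedWalks-mapWord N w)))))

  module _ {n m r} (H : Hypergraph n m) (e : Fin m) {ι : Fin (suc r) → Fin n} (en : Enumerates H e ι) where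

    open Enumerates en
    open Relabel ι injective {r}
    private K = oneEdge (suc r)

    isEdge-map : ∀ (ℓ : Letter (suc r) r) → IsEdge H e (mapLetter ι ℓ) ⇔ IsEdge K zero ℓ
    isEdge-map (i , γ) = mk⇔
      (λ eq → ⊆-antisym (λ {z} _ → ∈-⋃-singletons (i ∷ toList γ) (down eq z)) (λ _ → ∈⊤))
      (λ eq → ⊆-antisym (up eq)
        (λ {x} x∈ → case ∈-map⁻ ι (subst (x List.∈_) list-map (∈-⋃-singletons⁻ (ι i ∷ toList (Vec.map ι γ)) x∈)) of λ
          { (z , _ , ≡.refl) → inside z }))
      where
      list-map : ι i ∷ toList (Vec.map ι γ) ≡ List.map ι (i ∷ toList γ)
      list-map = cong (ι i ∷_) (Vec.toList-map ι γ)
      down : edge H e ≡ support (ι i) (Vec.map ι γ) → ∀ z → z List.∈ (i ∷ toList γ)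
      down eq z with ∈-map⁻ ι (subst (ι z List.∈_) list-map (∈-⋃-singletons⁻ _ (subst (ι z ∈_) eq (inside z))))
      ... | z′ , z′∈ , eq′ = subst (List._∈ _) (≡.sym (injective eq′)) z′∈
      up : ⊤ ≡ support i γ → ∀ {x} → x ∈ edge H e → x ∈ support (ι i) (Vec.map ι γ)
      up eq x∈ with surjective x∈
      ... | z , ≡.refl = ∈-⋃-singletons _ (subst (ι z List.∈_) (≡.sym list-map)
            (∈-map⁺ ι (∈-⋃-singletons⁻ (i ∷ toList γ) (subst (z ∈_) eq ∈⊤))))

    edgeWord-map : ∀ (w : Word (suc r) r) → EdgeWord H e (mapWord ι w) ⇔ EdgeWord K zero w
    edgeWord-map w = mk⇔
      (λ (all , some) →
        All.map (λ {ℓ} → Sum.map (to (isLoop-map ℓ)) (to (isEdge-map ℓ))) (All.map⁻ all) ,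
        Any.map (λ {ℓ} → to (isEdge-map ℓ)) (Any.map⁻ some))
      (λ (all , some) →
        All.map⁺ (All.map (λ {ℓ} → Sum.map (from (isLoop-map ℓ)) (from (isEdge-map ℓ))) all) ,
        Any.map⁺ (Any.map (λ {ℓ} → from (isEdge-map ℓ)) some))
      where open Equivalence

    -- Each factor is invariant under relabelling, so every hyperedge of every hypergraph has the
    -- coefficients of the model.
    edgeCoeff-map : ∀ β N (w : Word (suc r) r) →
      Weighted.edgeCoeff β H N e (mapWord ι w) ≈ Weighted.edgeCoeff β K N zero w
    edgeCoeff-map β N w = trans
      (reflexive (cong (_ when_) (does-⇔ (edgeWord-map w) (edgeWord? H e (mapWord ι w)) (edgeWord? K zero w))))
      (F∑.when-cong (does (edgeWord? K zero w)) (*-cong (multiplicity-mapWord w)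
        (*-congˡ (reflexive (cong ⟨_⟩ (closedWalks-mapWord N w))))))

-- The coefficients of a single vertex and of a single hyperedge

module EdgeContributions {c ℓ₁ ℓ₂ ℓ₃} (F : OrderedField c ℓ₁ ℓ₂ ℓ₃) where

  open import Data.Fin.Permutation using (Permutation′; transpose; _⟨$⟩ʳ_; _⟨$⟩ˡ_; inverseʳ)
  open import Data.Fin.Subset using (_∈_)
  open import Data.Fin.Subset.Properties using (∈⊤)
  open import Data.List.Membership.Propositional.Properties using (∈-cartesianProductWith⁻)
  open import Data.List.Membership.Propositional using () renaming (find to find∈)
  open import Data.List.Relation.Unary.All as All using (All; []; _∷_)
  import Data.List.Relation.Unary.All.Properties as All
  open import Data.List.Relation.Unary.Any using (Any; here; there)
  open FiniteSums
  open Walks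
  open Words
  open Permutations
  open Evaluation F
  open TraceFormula F
  open Expansion F

  open import Algebra.Bundles using (CommutativeRing)

  open OrderedField F hiding (zero)
  open import Relation.Binary.Reasoning.Setoid (CommutativeRing.setoid field-commutativeRing)

  length-words : ∀ n r t {w} → w List.∈ words n r t → length w ≡ t
  length-words n r zero    (here ≡.refl) = ≡.refl
  length-words n r (suc t) w∈
    with ℓ , w , _ , w∈′ , ≡.refl ← ∈-cartesianProductWith⁻ _∷_ (letters n r) (words n r t) w∈ =
    cong suc (length-words n r t w∈′)

  _≟ˡ_ : ∀ {n} (σ τ : List (Fin n)) → Dec (σ ≡ τ)
  _≟ˡ_ = List.≡-dec _≟_

  wordSum-0 : ∀ n s → wordSum n s (λ _ → 0#) ≈ 0#
  wordSum-0 n zero    = refl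
  wordSum-0 n (suc s) = F∑.sum-ε (allFin n) λ _ → wordSum-0 n s

  wordSum-select : ∀ {n} s (τ : List (Fin n)) → length τ ≡ s → ∀ f →
    wordSum n s (λ σ → f σ when does (τ ≟ˡ σ)) ≈ f τ
  wordSum-select     zero    []      ≡.refl f = refl
  wordSum-select {n} (suc s) (i ∷ τ) eq     f = begin
    sum (allFin n) (λ j → wordSum n s (λ σ → f (j ∷ σ) when does ((i ∷ τ) ≟ˡ (j ∷ σ))))
      ≈⟨ F∑.sum-cong (allFin n) step ⟩
    sum (allFin n) (λ j → f (j ∷ τ) when does (j ≟ i))
      ≈⟨ F∑.sum-delta i _ ⟩
    f (i ∷ τ) ∎
    where
    step : ∀ j → wordSum n s (λ σ → f (j ∷ σ) when does ((i ∷ τ) ≟ˡ (j ∷ σ))) ≈ (f (j ∷ τ) when does (j ≟ i))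
    step j with j ≟ i
    ... | yes ≡.refl = trans (wordSum-cong n s λ σ → reflexive (cong (f (i ∷ σ) when_)
            (does-⇔ (mk⇔ List.∷-injectiveʳ (cong (i ∷_))) ((i ∷ τ) ≟ˡ (i ∷ σ)) (τ ≟ˡ σ))))
            (wordSum-select s τ (ℕ.suc-injective eq) (λ σ → f (i ∷ σ)))
    ... | no j≢i = trans (wordSum-cong n s λ σ → when-false _ ((i ∷ τ) ≟ˡ (j ∷ σ)) (j≢i ∘ ≡.sym ∘ List.∷-injectiveˡ))
            (wordSum-0 n s)

  module _ {k n} {ι : Fin k → Fin n} where

    vec-preimage : ∀ {r} (γ : Vec (Fin n) r) → (∀ {j} → j List.∈ toList γ → ∃[ i ] j ≡ ι i) → ∃[ δ ] γ ≡ Vec.map ι δ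
    vec-preimage []      _ = [] , ≡.refl
    vec-preimage (j ∷ γ) f with f (here ≡.refl) | vec-preimage γ (f ∘ there)
    ... | i , ≡.refl | δ , ≡.refl = i ∷ δ , ≡.refl

    word-preimage : ∀ {r} (w : Word n r) →
      (∀ {i γ} → (i , γ) List.∈ w → ∀ {j} → j List.∈ (i ∷ toList γ) → ∃[ i ] j ≡ ι i) → ∃[ w′ ] w ≡ mapWord ι w′
    word-preimage []            _ = [] , ≡.refl
    word-preimage ((i , γ) ∷ w) f
      with f (here ≡.refl) (here ≡.refl) | vec-preimage γ (f (here ≡.refl) ∘ there) | word-preimage w (f ∘ there)
    ... | i′ , ≡.refl | δ , ≡.refl | w′ , ≡.refl = (i′ , δ) ∷ w′ , ≡.refl

  -- Computed on one vertex; relabelling makes it the coefficient of the t-th power of the loop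
  -- weight at every vertex.
  loopSum : ∀ r t N → Carrier
  loopSum r t N = sum (words 1 r t) (loopCoeff N zero)

  module OneEdge (β : Carrier) (r : ℕ) where

    private
      k : ℕ
      k = suc r
      K : Hypergraph k 1
      K = oneEdge k
    open Weighted β using (edgeCoeff)

    -- The contribution of one hyperedge as a polynomial in the loop weights `y` of its vertices.
    edgeSum : ℕ → ℕ → (Fin k → Carrier) → Carrier
    edgeSum t N y = sum (words k r t) (λ w → edgeCoeff K N zero w * product (loopRoots w) y)

    -- The coefficient of the monomial of J in edgeSum.
    loopsCoeff : ℕ → ℕ → List (Fin k) → Carrier
    loopsCoeff t N J = sum (words k r t) (λ w → edgeCoeff K N zero w when does (loopRoots w ≟ˡ J))

  module _ (β : Carrier) {r′ : ℕ} where

    private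
      r k : ℕ
      r = suc r′
      k = suc r
    open Weighted β
    open OneEdge β r

    -- Decided on the word, since vanishing of a field element is not decidable.
    edgeCoeff-inside : ∀ {n m} (H : Hypergraph n m) e N (w : Word n r) →
      (edgeCoeff H N e w ≈ 0#) ⊎
      (EdgeWord H e w × closedWalks N (wordArcs w) ≢ 0)
    edgeCoeff-inside H e N w = go (edgeWord? H e w) (closedWalks N (wordArcs w) ℕ.≟ 0)
      where
      go : Dec (EdgeWord H e w) → Dec (closedWalks N (wordArcs w) ≡ 0) → _
      go (no ¬ew) _        = inj₁ (when-false _ (edgeWord? H e w) ¬ew)
      go (yes ew) (no ≢0)  = inj₂ (ew , ≢0)
      go (yes ew) (yes ≡0) = inj₁ (when-0 (does (edgeWord? H e w))
        (trans (*-congˡ (trans (*-congˡ (reflexive (cong ⟨_⟩ ≡0))) (zeroʳ _))) (zeroʳ _)))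

    module _ {n m} (H : Hypergraph n m) (x : Fin n → Carrier) (N : ℕ) where

      loops-sum : ∀ t i → sum (words n r t) (λ w → loopCoeff N i w * pow (x i) (length w)) ≈ loopSum r t N * pow (x i) t
      loops-sum t i = begin
        sum (words n r t) (λ w → loopCoeff N i w * pow (x i) (length w))
          ≈⟨ F∑.sum-cong-∈ (words n r t) (λ w w∈ → trans
               (*-congˡ (reflexive (cong (pow (x i)) (length-words n r t w∈)))) (*-comm _ _)) ⟩
        sum (words n r t) (λ w → pow (x i) t * loopCoeff N i w)
          ≈⟨ sum-*ˡ (pow (x i) t) (words n r t) _ ⟨
        pow (x i) t * sum (words n r t) (loopCoeff N i)
          ≈⟨ *-congˡ (trans (Relabel.restricts-words ι ι-inj t _ off)
               (F∑.sum-cong (words 1 r t) (Relabel.loopCoeff-map ι ι-inj N zero))) ⟩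
        pow (x i) t * loopSum r t N
          ≈⟨ *-comm _ _ ⟩
        loopSum r t N * pow (x i) t ∎
        where
        ι : Fin 1 → Fin n
        ι _ = i
        ι-inj : Injective _≡_ _≡_ ι
        ι-inj {zero} {zero} _ = ≡.refl
        off : ∀ w → (∀ w′ → w ≢ mapWord ι w′) → loopCoeff N i w ≈ 0#
        off w out = when-false _ (loopsAt? i w) λ loops →
          let (w′ , eq) = word-preimage {ι = ι} w λ ℓ∈ j∈ → zero , vertex (All.lookup loops ℓ∈) j∈ in out w′ eq
          where
          vertex : ∀ {i′ γ j} → (i′ , γ) ≡ loopLetter r i → j List.∈ (i′ ∷ toList γ) → j ≡ i
          vertex ≡.refl (here eq) = eq
          vertex ≡.refl (there p) = ∈-toList-replicate r p

      -- By `EdgeWord-inside` a contributing word has all its vertices in `e`, hence is a relabelled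
      -- word of the model.
      edge-sum : ∀ t e {ι : Fin k → Fin n} → Enumerates H e ι →
        sum (words n r t) (λ w → edgeCoeff H N e w * product (loopRoots w) x) ≈ edgeSum t N (x ∘ ι)
      edge-sum t e {ι} en = begin
        sum (words n r t) (λ w → edgeCoeff H N e w * product (loopRoots w) x)
          ≈⟨ restricts-words t _ off ⟩
        sum (words k r t) (λ w → edgeCoeff H N e (mapWord ι w) * product (loopRoots (mapWord ι w)) x)
          ≈⟨ F∑.sum-cong (words k r t) (λ w → *-cong (edgeCoeff-map H e en β N w)
               (reflexive (≡.trans (cong (λ l → product l x) (loopRoots-map w)) (F∏.sum-map ι (loopRoots w) x)))) ⟩
        edgeSum t N (x ∘ ι) ∎
        where
        open Enumerates en
        open Relabel ι injective {r}
        off : ∀ w → (∀ w′ → w ≢ mapWord ι w′) → edgeCoeff H N e w * product (loopRoots w) x ≈ 0#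
        off w out with edgeCoeff-inside H e N w
        ... | inj₁ ≈0 = trans (*-congʳ ≈0) (zeroˡ _)
        ... | inj₂ (ew , ≢0) =
          let (w′ , eq) = word-preimage {ι = ι} w λ ℓ∈ j∈ → surjective (EdgeWord-inside H N ew ≢0 ℓ∈ j∈) in
          ⊥-elim (out w′ eq)

      total-expand : 2 ≤ r → Uniform H k → Linear H →
        (ιs : Fin m → Fin k → Fin n) → (∀ e → Enumerates H e (ιs e)) →
        ∀ t → 1 ≤ t → t ℕ.< k ℕ.+ k →
        sum (words n r t) (term (entry H x) N) ≈
        sum (allFin n) (λ i → loopSum r t N * pow (x i) t) + sum (allFin m) (λ e → edgeSum t N (x ∘ ιs e))
      total-expand 2≤r uniform linear ιs en t 1≤t t<2k = begin
        sum (words n r t) (term (entry H x) N)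
          ≈⟨ F∑.sum-cong-∈ (words n r t) (λ w w∈ → term-split H 2≤r uniform linear x N w
               (subst (1 ≤_) (≡.sym (length-words n r t w∈)) 1≤t)
               (subst (ℕ._< k ℕ.+ k) (≡.sym (length-words n r t w∈)) t<2k)) ⟩
        _ ≈⟨ F∑.sum-∙ (words n r t) _ _ ⟩
        _ ≈⟨ +-cong (F∑.sum-swap (words n r t) (allFin n) _) (F∑.sum-swap (words n r t) (allFin m) _) ⟩
        _ ≈⟨ +-cong (F∑.sum-cong (allFin n) (loops-sum t)) (F∑.sum-cong (allFin m) λ e → edge-sum t e (en e)) ⟩
        _ ∎

    private
      K : Hypergraph k 1
      K = oneEdge k

    module _ (2≤r : 2 ≤ r) (N t : ℕ) (t<2k : t ℕ.< k ℕ.+ k) where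

      -- `shape` is applied to the model itself; its alternative of loops alone contradicts the edge
      -- letter present.
      edgeCoeff-full : ∀ {w} → w List.∈ words k r t → (edgeCoeff K N zero w ≈ 0#) ⊎ (nonloops w ≡ k)
      edgeCoeff-full {w} w∈ with edgeCoeff-inside K zero N w
      ... | inj₁ ≈0 = inj₁ ≈0
      ... | inj₂ (ew@(all , some) , ≢0) with shape K 2≤r (oneEdge-uniform k) (oneEdge-linear k) N w
              (All.map (Sum.map₂ (zero ,_)) all) ≢0 (nonempty some)
              (subst (ℕ._< k ℕ.+ k) (≡.sym (length-words k r t w∈)) t<2k)
        where
        nonempty : ∀ {w : Word k r} → Any (IsEdge K zero) w → 1 ≤ length w
        nonempty (here _)  = s≤s z≤n
        nonempty (there _) = s≤s z≤n
      ... | inEdge _ _ full = inj₂ full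
      ... | loopsAt i loops with find∈ some
      ... | ℓ , ℓ∈ , is-e = ⊥-elim (edge-notLoop K (ℕ.≤-trans (s≤s z≤n) 2≤r) (oneEdge-uniform k) {zero} {ℓ} is-e
              (subst IsLoop (≡.sym (All.lookup loops ℓ∈)) ≡.refl))

      -- There is no room for k edge letters in a word of length `t`.
      edgeSum-short : t ℕ.< k → ∀ y → edgeSum t N y ≈ 0#
      edgeSum-short t<k y = trans
        (F∑.sum-cong-∈ (words k r t) {g = λ _ → 0#} λ w w∈ → Sum.[_,_]′ (λ ≈0 → trans (*-congʳ ≈0) (zeroˡ _))
          (λ full → ⊥-elim (ℕ.<-irrefl full (ℕ.≤-<-trans (ℕ.≤-trans
            (ℕ.m≤n+m (nonloops w) (length (loopRoots w))) (ℕ.≤-reflexive (loopRoots+nonloops w)))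
            (subst (ℕ._< k) (≡.sym (length-words k r t w∈)) t<k)))) (edgeCoeff-full w∈))
        (F∑.sum-ε (words k r t) λ _ → refl)

      -- Words are grouped by the list `J` of their loop roots. Of the s + k letters k are edge
      -- letters, so `J` has length `s`.
      edgeSum-monomials : ∀ s → t ≡ s ℕ.+ k → ∀ y →
        edgeSum t N y ≈ wordSum k s (λ J → loopsCoeff t N J * product J y)
      edgeSum-monomials s t≡s+k y = begin
        sum (words k r t) (λ w → edgeCoeff K N zero w * product (loopRoots w) y)
          ≈⟨ F∑.sum-cong-∈ (words k r t) (λ w w∈ → sym (group w w∈)) ⟩
        sum (words k r t) (λ w → wordSum k s (λ J → (edgeCoeff K N zero w when does (loopRoots w ≟ˡ J)) * product J y))
          ≈⟨ wordSum-sum k s (words k r t) _ ⟨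
        wordSum k s (λ J → sum (words k r t) (λ w → (edgeCoeff K N zero w when does (loopRoots w ≟ˡ J)) * product J y))
          ≈⟨ wordSum-cong k s (λ J → begin
               _ ≈⟨ F∑.sum-cong (words k r t) (λ w → *-comm _ _) ⟩
               _ ≈⟨ sum-*ˡ (product J y) (words k r t) _ ⟨
               _ ≈⟨ *-comm _ _ ⟩
               loopsCoeff t N J * product J y ∎) ⟩
        wordSum k s (λ J → loopsCoeff t N J * product J y) ∎
        where
        group : ∀ w → w List.∈ words k r t →
          wordSum k s (λ J → (edgeCoeff K N zero w when does (loopRoots w ≟ˡ J)) * product J y) ≈
          edgeCoeff K N zero w * product (loopRoots w) y
        group w w∈ with edgeCoeff-full w∈
        ... | inj₁ ≈0 = trans
                (wordSum-cong k s λ J → trans (*-congʳ (when-0 (does (loopRoots w ≟ˡ J)) ≈0)) (zeroˡ _))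
                (trans (wordSum-0 k s) (sym (trans (*-congʳ ≈0) (zeroˡ _))))
        ... | inj₂ full = trans (wordSum-cong k s λ J → when-* _ (does (loopRoots w ≟ˡ J)) _)
                (wordSum-select s (loopRoots w) (ℕ.+-cancelʳ-≡ k (length (loopRoots w)) s
                  (≡.trans (cong (length (loopRoots w) ℕ.+_) (≡.sym full))
                  (≡.trans (loopRoots+nonloops w) (≡.trans (length-words k r t w∈) t≡s+k)))) _)

    permutation-enumerates : (π : Permutation′ k) → Enumerates K zero (π ⟨$⟩ʳ_)
    permutation-enumerates π = record
      { injective  = permutation-injective π
      ; inside     = λ _ → ∈⊤
      ; surjective = λ {x} _ → π ⟨$⟩ˡ x , ≡.sym (inverseʳ π)
      }

    -- A permutation of the vertices is another enumeration of the only hyperedge, so relabelling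
    -- along it preserves every term.
    loopsCoeff-symmetric : ∀ t N (π : Permutation′ k) J → loopsCoeff t N (List.map (π ⟨$⟩ʳ_) J) ≈ loopsCoeff t N J
    loopsCoeff-symmetric t N π J = trans
      (restricts-words t _ λ w out → ⊥-elim
        (let (w′ , eq) = word-preimage {ι = ι} w (λ _ _ → surjective ∈⊤) in out w′ eq))
      (F∑.sum-cong (words k r t) λ w → trans
        (reflexive (cong (_ when_) (does-⇔ (mk⇔
          (λ eq → List.map-injective injective (≡.trans (≡.sym (loopRoots-map w)) eq))
          (λ eq → ≡.trans (loopRoots-map w) (cong (List.map ι) eq)))
          (loopRoots (mapWord ι w) ≟ˡ List.map ι J) (loopRoots w ≟ˡ J))))
        (F∑.when-cong (does (loopRoots w ≟ˡ J)) (edgeCoeff-map K zero (permutation-enumerates π) β N w)))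
      where
      ι : Fin k → Fin k
      ι = π ⟨$⟩ʳ_
      open Enumerates (permutation-enumerates π)
      open Relabel ι injective {r}

    loopsCoeff₁ : ∀ t N i → loopsCoeff t N (i ∷ []) ≈ loopsCoeff t N (zero ∷ [])
    loopsCoeff₁ t N i = trans (reflexive (cong (λ j → loopsCoeff t N (j ∷ [])) (≡.sym (transpose-left zero i))))
      (loopsCoeff-symmetric t N (transpose zero i) (zero ∷ []))

    loopsCoeff₂-diagonal : ∀ t N i → loopsCoeff t N (i ∷ i ∷ []) ≈ loopsCoeff t N (zero ∷ zero ∷ [])
    loopsCoeff₂-diagonal t N i = trans (reflexive (cong (λ j → loopsCoeff t N (j ∷ j ∷ [])) (≡.sym (transpose-left zero i))))
      (loopsCoeff-symmetric t N (transpose zero i) (zero ∷ zero ∷ []))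

    -- The symmetric group is transitive on ordered pairs of distinct vertices.
    loopsCoeff₂ : ∀ t N {i j} → i ≢ j → loopsCoeff t N (i ∷ j ∷ []) ≈ loopsCoeff t N (zero ∷ suc zero ∷ [])
    loopsCoeff₂ t N {i} {j} i≢j = let (π , π0 , π1) = moveTwo i≢j in trans
      (reflexive (cong₂ (λ a b → loopsCoeff t N (a ∷ b ∷ [])) (≡.sym π0) (≡.sym π1)))
      (loopsCoeff-symmetric t N π (zero ∷ suc zero ∷ []))

-- Signs in the ordered field and positivity of the leading coefficients

module Positivity {c ℓ₁ ℓ₂ ℓ₃} (F : OrderedField c ℓ₁ ℓ₂ ℓ₃) where

  open import Data.List.Membership.Propositional.Properties using (∈-cartesianProductWith⁺; ∈-allFin)
  open import Data.List.Relation.Unary.All using ([]; _∷_)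
  open import Data.List.Relation.Unary.Any using (here; there)
  open import Data.Nat.Base using (_!)
  open FiniteSums
  open Walks
  open Words
  open EulerCircuits
  open Evaluation F
  open TraceFormula F
  open Expansion F
  open EdgeContributions F

  open import Algebra.Bundles using (CommutativeRing)

  open OrderedField F hiding (zero)
  open import Algebra.Properties.Ring (CommutativeRing.ring field-commutativeRing) using (-‿involutive; -‿distribˡ-*; -0#≈0#)

  +-pos : ∀ {x y} → 0# < x → 0# < y → 0# < x + y
  +-pos {x} {y} 0<x 0<y = <-trans 0<y (<-respˡ-≈ (+-identityˡ y) (+-monoˡ-< y 0<x))

  +-monoʳ-< : ∀ {x y} z → x < y → z + x < z + y
  +-monoʳ-< z x<y = <-respˡ-≈ (+-comm _ z) (<-respʳ-≈ (+-comm _ z) (+-monoˡ-< z x<y))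

  -- A disjunction rather than the negation of `_<_`: sums of such terms can be analysed case by
  -- case, and images of natural numbers satisfy it.
  NonNegative : Carrier → Set _
  NonNegative x = x ≈ 0# ⊎ 0# < x

  +-nonneg : ∀ {x y} → NonNegative x → NonNegative y → NonNegative (x + y)
  +-nonneg (inj₁ x≈0) (inj₁ y≈0) = inj₁ (trans (+-cong x≈0 y≈0) (+-identityˡ 0#))
  +-nonneg (inj₁ x≈0) (inj₂ 0<y) = inj₂ (<-respʳ-≈ (sym (trans (+-congʳ x≈0) (+-identityˡ _))) 0<y)
  +-nonneg (inj₂ 0<x) (inj₁ y≈0) = inj₂ (<-respʳ-≈ (sym (trans (+-congˡ y≈0) (+-identityʳ _))) 0<x)
  +-nonneg (inj₂ 0<x) (inj₂ 0<y) = inj₂ (+-pos 0<x 0<y)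

  pos-+-nonneg : ∀ {x y} → 0# < x → NonNegative y → 0# < x + y
  pos-+-nonneg 0<x (inj₁ y≈0) = <-respʳ-≈ (sym (trans (+-congˡ y≈0) (+-identityʳ _))) 0<x
  pos-+-nonneg 0<x (inj₂ 0<y) = +-pos 0<x 0<y

  nonneg-+-pos : ∀ {x y} → NonNegative x → 0# < y → 0# < x + y
  nonneg-+-pos 0≤x 0<y = <-respʳ-≈ (+-comm _ _) (pos-+-nonneg 0<y 0≤x)

  sum-nonneg : ∀ {a} {A : Set a} (xs : List A) {f} → (∀ x → NonNegative (f x)) → NonNegative (sum xs f)
  sum-nonneg []       0≤f = inj₁ refl
  sum-nonneg (x ∷ xs) 0≤f = +-nonneg (0≤f x) (sum-nonneg xs 0≤f)

  sum-pos : ∀ {a} {A : Set a} {xs : List A} {f} → (∀ x → NonNegative (f x)) → ∀ {x} → x List.∈ xs → 0# < f x → 0# < sum xs f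
  sum-pos {xs = _ ∷ xs} 0≤f (here ≡.refl) 0<fx = pos-+-nonneg 0<fx (sum-nonneg xs 0≤f)
  sum-pos               0≤f (there x∈)    0<fx = nonneg-+-pos (0≤f _) (sum-pos 0≤f x∈ 0<fx)

  product-pos : ∀ {a} {A : Set a} (xs : List A) {f} → (∀ x → 0# < f x) → 0# < product xs f
  product-pos []       0<f = 0<1
  product-pos (x ∷ xs) 0<f = *-pos (0<f x) (product-pos xs 0<f)

  pow-pos : ∀ {x} n → 0# < x → 0# < pow x n
  pow-pos zero    0<x = 0<1
  pow-pos (suc n) 0<x = *-pos 0<x (pow-pos n 0<x)

  neg-pos : ∀ {x} → x < 0# → 0# < - x
  neg-pos {x} x<0 = <-respˡ-≈ (-‿inverseʳ x) (<-respʳ-≈ (+-identityˡ _) (+-monoˡ-< (- x) x<0))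

  -- Invertibility makes `x` apart from 0, hence positive or negative. If it were negative, - x y =
  -- -1 would be positive, against 0 < 1. This gives the sign of the inverse factorials, which are
  -- known only as inverses.
  inverse-pos : ∀ {x y} → 0# < y → x * y ≈ 1# → 0# < x
  inverse-pos {x} {y} 0<y xy≈1 with Equivalence.to #⇔<⊎> (invertible⇒# {x} {0#}
    (y , trans (*-congˡ (x-0≈x x)) (trans (*-comm _ _) xy≈1) , trans (*-congʳ (x-0≈x x)) xy≈1))
  ... | inj₂ 0<x = 0<x
  ... | inj₁ x<0 = ⊥-elim (<-irrefl refl (<-trans 0<1 (<-respˡ-≈ (-‿involutive 1#)
          (<-respʳ-≈ -0#≈0# -[-1]<-0))))
    where
    0<-1 : 0# < - 1#
    0<-1 = <-respʳ-≈ (trans (sym (-‿distribˡ-* x y)) (-‿cong xy≈1)) (*-pos (neg-pos x<0) 0<y)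
    -[-1]<-0 : - (- 1#) < - 0#
    -[-1]<-0 = <-respˡ-≈ (+-identityˡ _) (<-respʳ-≈ (trans (-‿inverseʳ (- 1#)) (sym -0#≈0#))
      (+-monoˡ-< (- (- 1#)) 0<-1))

  ⁻¹!-pos : ∀ n → 0# < n ⁻¹!
  ⁻¹!-pos n = inverse-pos (0<fromℕ F (n !) {{n ℕ.!≢0}}) (⁻¹!-inverseˡ n)

  fromℕ-pos : ∀ {n} → 0 ℕ.< n → 0# < ⟨ n ⟩
  fromℕ-pos {suc n} _ = 0<fromℕ F (suc n)

  fromℕ-nonneg : ∀ n → NonNegative ⟨ n ⟩
  fromℕ-nonneg zero    = inj₁ refl
  fromℕ-nonneg (suc n) = inj₂ (0<fromℕ F (suc n))

  multiplicity-pos : ∀ r {n} (σ : List (Fin n)) → 0# < multiplicity r σ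
  multiplicity-pos r {n} σ = product-pos (allFin n) λ i →
    *-pos (0<fromℕ F (count i σ !) {{count i σ ℕ.!≢0}}) (⁻¹!-pos (count i σ ℕ.* r))

  pos-*-nonneg : ∀ {x y} → 0# < x → NonNegative y → NonNegative (x * y)
  pos-*-nonneg 0<x (inj₁ y≈0) = inj₁ (trans (*-congˡ y≈0) (zeroʳ _))
  pos-*-nonneg 0<x (inj₂ 0<y) = inj₂ (*-pos 0<x 0<y)

  when-nonneg : ∀ {x} b → NonNegative x → NonNegative (x when b)
  when-nonneg true  0≤x = 0≤x
  when-nonneg false 0≤x = inj₁ refl

  when-pos : ∀ {p} {P : Set p} x (P? : Dec P) → P → 0# < x → 0# < (x when does P?)
  when-pos x P? p 0<x = subst (λ b → 0# < (x when b)) (≡.sym (dec-true P? p)) 0<x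

  ∈-tuples : ∀ {n r} (γ : Vec (Fin n) r) → γ List.∈ tuples n r
  ∈-tuples []      = here ≡.refl
  ∈-tuples (i ∷ γ) = ∈-cartesianProductWith⁺ _∷_ (∈-allFin i) (∈-tuples γ)

  ∈-words : ∀ {n r} (w : Word n r) → w List.∈ words n r (length w)
  ∈-words []            = here ≡.refl
  ∈-words ((i , γ) ∷ w) = ∈-cartesianProductWith⁺ _∷_
    (∈-cartesianProductWith⁺ _,_ (∈-allFin i) (∈-tuples γ)) (∈-words w)

  -- On a single vertex every ordering of the arcs is a closed walk, so the word of `t` loops has a
  -- positive term.
  loopSum-pos : ∀ r t N → 1 ≤ t → suc N ≡ t ℕ.* r → 0# < loopSum r t N
  loopSum-pos r t N 1≤t eq = sum-pos
    (λ w → when-nonneg (does (loopsAt? zero w)) (pos-*-nonneg (multiplicity-pos r (roots w)) (fromℕ-nonneg (closedWalks N (wordArcs w)))))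
    (subst (λ t → w₀ List.∈ words 1 r t) (List.length-replicate t) (∈-words w₀))
    (when-pos (multiplicity r (roots w₀) * ⟨ closedWalks N (wordArcs w₀) ⟩) (loopsAt? zero w₀) (all t)
      (*-pos (multiplicity-pos r (roots w₀)) (fromℕ-pos (0<closedWalks (walk (wordArcs w₀))
        (≡.trans (length-wordArcs w₀) (≡.trans (cong (ℕ._* r) (List.length-replicate t)) (≡.sym eq)))))))
    where
    w₀ : Word 1 r
    w₀ = List.replicate t (loopLetter r zero)
    all : ∀ t → LoopsAt zero (List.replicate t (loopLetter r zero))
    all zero    = []
    all (suc t) = ≡.refl ∷ all t
    walk : ∀ (v : List (Arc 1)) → Walk zero zero v
    walk []                  = []
    walk ((zero , zero) ∷ v) = zero ∷ walk v

  -- No term is negative, and the Euler circuit makes the term of `twoLoops` positive.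
  loopsCoeff-pos : ∀ {β} r′ N → 0# < β → suc N ≡ (2 ℕ.+ (2 ℕ.+ r′)) ℕ.* suc r′ →
    0# < OneEdge.loopsCoeff β (suc r′) (2 ℕ.+ (2 ℕ.+ r′)) N (zero ∷ suc zero ∷ [])
  loopsCoeff-pos {β} r′ N 0<β eq = sum-pos
    (λ w → when-nonneg (does (loopRoots w ≟ˡ _)) (when-nonneg (does (edgeWord? K zero w))
      (pos-*-nonneg (multiplicity-pos r (roots w)) (pos-*-nonneg (pow-pos k 0<β) (fromℕ-nonneg (circuits w))))))
    (subst (λ t → w₀ List.∈ words k r t) (length-twoLoops r′) (∈-words w₀))
    (when-pos (Weighted.edgeCoeff β K N zero w₀) (loopRoots w₀ ≟ˡ _)
      (twoLoops-loopRoots r′ (oneEdge-uniform k))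
      (when-pos (multiplicity r (roots w₀) * (pow β k * ⟨ circuits w₀ ⟩)) (edgeWord? K zero w₀) (twoLoops-edgeWord r′)
        (*-pos (multiplicity-pos r (roots w₀)) (*-pos (pow-pos k 0<β) (fromℕ-pos (twoLoops-closedWalks r′ N eq))))))
    where
    r k : ℕ
    r = suc r′
    k = suc r
    K = oneEdge k
    w₀ : Word k r
    w₀ = twoLoops r′
    circuits : Word k r → ℕ
    circuits w = closedWalks N (wordArcs w)

-- The traces of order at most k + 2

module LowTraces {c ℓ₁ ℓ₂ ℓ₃} (F : OrderedField c ℓ₁ ℓ₂ ℓ₃) where

  open import Data.Nat.Base using (_!; _∸_)
  open FiniteSums
  open Walks
  open Words
  open Degrees
  open Evaluation F
  open TraceFormula F
  open Expansion F
  open EdgeContributions F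

  open import Algebra.Bundles using (CommutativeRing; CommutativeMonoid)

  open OrderedField F hiding (zero)
  open import Relation.Binary.Reasoning.Setoid (CommutativeRing.setoid field-commutativeRing)
  open import Algebra.Properties.CommutativeSemigroup (CommutativeRing.*-commutativeSemigroup field-commutativeRing) using (interchange)

  open EdgeSum +-commutativeMonoid using (sum-edge)

  sum-incidences : ∀ {n m} (H : Hypergraph n m) (f : Fin n → Carrier) →
    sum (allFin m) (λ e → sum (allFin n) (λ i → f i when lookup (edge H e) i)) ≈
    sum (allFin n) (λ i → ⟨ degree H i ⟩ * f i)
  sum-incidences {n} {m} H f = trans (F∑.sum-swap (allFin m) (allFin n) _)
    (F∑.sum-cong (allFin n) λ i → begin
      sum (allFin m) (λ e → f i when lookup (edge H e) i)
        ≈⟨ F∑.sum-cong (allFin m) (λ e → sym (indicator (lookup (edge H e) i) (f i))) ⟩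
      sum (allFin m) (λ e → f i * ⟨ 𝟙 (lookup (edge H e) i) ⟩)
        ≈⟨ sum-*ˡ (f i) (allFin m) _ ⟨
      f i * sum (allFin m) (λ e → ⟨ 𝟙 (lookup (edge H e) i) ⟩)
        ≈⟨ *-congˡ (trans (sym (fromℕ-sum (allFin m) _)) (reflexive (cong ⟨_⟩ (≡.sym (degree≡∑ H i))))) ⟩
      f i * ⟨ degree H i ⟩
        ≈⟨ *-comm _ _ ⟩
      ⟨ degree H i ⟩ * f i ∎)
    where
    indicator : ∀ b y → y * ⟨ 𝟙 b ⟩ ≈ (y when b)
    indicator true  y = trans (*-congˡ fromℕ-1) (*-identityʳ y)
    indicator false y = zeroʳ y

  module _ {r′ : ℕ} (α : Carrier) where

    private
      r k : ℕ
      r = suc (suc r′)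
      k = suc r

    β : Carrier
    β = (1# - α) * r ⁻¹!

    loopWeight : ∀ {n m} → Hypergraph n m → Fin n → Carrier
    loopWeight H i = α * ⟨ degree H i ⟩

    open Weighted β using (entry)
    open OneEdge β r

    -- The degree part and the adjacency part have disjoint supports: the vertices of a loop form a
    -- singleton, which is no hyperedge.
    𝒜-entry : ∀ {n m} (H : Hypergraph n m) → Uniform H k → ∀ i γ → 𝒜 F k H α i γ ≈ entry H (loopWeight H) i γ
    𝒜-entry H uniform i γ = go (isLoop? (i , γ)) (IsEdge? H (support i γ))
      where
      deg adj : Bool → Carrier
      deg b = if b then ⟨ degree H i ⟩ else 0#
      adj b = if b then r ⁻¹! else 0#
      value : Bool → Bool → Carrier
      value b b′ = if b then loopWeight H i else (β when b′)
      go : (d : Dec (IsLoop (i , γ))) (d′ : Dec (∃[ e ] edge H e ≡ support i γ)) →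
        𝒜 F k H α i γ ≈ entry H (loopWeight H) i γ
      go (yes loop) _ = begin
        𝒜 F k H α i γ
          ≡⟨ cong₂ (λ b b′ → α * deg b + (1# - α) * adj b′) (dec-true (isLoop? (i , γ)) loop)
               (dec-false (IsEdge? H (support i γ)) (λ (e , is-e) → edge-notLoop H (s≤s z≤n) uniform {ℓ = i , γ} is-e loop)) ⟩
        α * ⟨ degree H i ⟩ + (1# - α) * 0#   ≈⟨ trans (+-congˡ (zeroʳ _)) (+-identityʳ _) ⟩
        loopWeight H i                       ≡⟨ cong (λ b → value b (does (IsEdge? H (support i γ)))) (≡.sym (dec-true (isLoop? (i , γ)) loop)) ⟩
        entry H (loopWeight H) i γ           ∎
      go (no ¬loop) d′ = begin
        𝒜 F k H α i γ
          ≡⟨ cong (λ b → α * deg b + (1# - α) * adj (does (IsEdge? H (support i γ)))) (dec-false (isLoop? (i , γ)) ¬loop) ⟩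
        α * 0# + (1# - α) * adj (does (IsEdge? H (support i γ)))
          ≈⟨ trans (+-congʳ (zeroʳ _)) (+-identityˡ _) ⟩
        (1# - α) * adj (does (IsEdge? H (support i γ)))
          ≈⟨ *-whenʳ (1# - α) (r ⁻¹!) (does (IsEdge? H (support i γ))) ⟩
        (β when does (IsEdge? H (support i γ)))
          ≡⟨ cong (λ b → value b (does (IsEdge? H (support i γ)))) (≡.sym (dec-false (isLoop? (i , γ)) ¬loop)) ⟩
        entry H (loopWeight H) i γ ∎

    -- The trace, without the factors depending on t and the order n only.
    wordTotal : ∀ {n m} → Hypergraph n m → ℕ → ℕ → Carrier
    wordTotal {n} H t N = sum (words n r t) (term (entry H (loopWeight H)) N)

    trace-total : ∀ {n m} (H : Hypergraph n m) → Uniform H k → ∀ d →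
      Trace.Tr F k {n} (𝒜 F k H α) (suc d) ≈
      ⟨ r ℕ.^ (n ∸ 1) ⟩ * (suc d ⁻¹! * wordTotal H (suc d) (suc r′ ℕ.+ d ℕ.* r))
    trace-total {n} H uniform d = trans (trace-words (suc r′) {n} (𝒜 F k H α) d)
      (*-congˡ (*-congˡ (F∑.sum-cong (words n r (suc d)) λ w → *-congˡ (*-congʳ
        (F∏.sum-cong w λ (i , γ) → 𝒜-entry H uniform i γ)))))

    powerSum : ∀ {n m} → Hypergraph n m → ℕ → Carrier
    powerSum {n} H t = sum (allFin n) (λ i → pow (loopWeight H i) t)

    module _ {n m} (H : Hypergraph n m) (uniform : Uniform H k) (linear : Linear H) (N : ℕ) where

      private
        ιs : Fin m → Fin k → Fin n
        ιs e = proj₁ (enumerate-edge H uniform e)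
        en : ∀ e → Enumerates H e (ιs e)
        en e = proj₂ (enumerate-edge H uniform e)
        x : Fin n → Carrier
        x = loopWeight H
        2≤r : 2 ≤ r
        2≤r = s≤s (s≤s z≤n)

        expand : ∀ t → 1 ≤ t → t ℕ.< k ℕ.+ k →
          wordTotal H t N ≈ loopSum r t N * powerSum H t + sum (allFin m) (λ e → edgeSum t N (x ∘ ιs e))
        expand t 1≤t t<2k = trans
          (total-expand β H x N 2≤r uniform linear ιs en t 1≤t t<2k)
          (+-congʳ (sym (sum-*ˡ _ (allFin n) _)))

        incidences : ∀ (f : Fin n → Carrier) → sum (allFin m) (λ e → sum (allFin k) (f ∘ ιs e)) ≈ sum (allFin n) (λ i → ⟨ degree H i ⟩ * f i)
        incidences f = trans (F∑.sum-cong (allFin m) λ e → sym (sum-edge H e (en e) f)) (sum-incidences H f)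

      total-short : ∀ t → 1 ≤ t → t ℕ.< k → wordTotal H t N ≈ loopSum r t N * powerSum H t
      total-short t 1≤t t<k = trans (expand t 1≤t t<2k)
        (trans (+-congˡ (F∑.sum-ε (allFin m) λ e → edgeSum-short β 2≤r N t t<2k t<k (x ∘ ιs e))) (+-identityʳ _))
        where
        t<2k : t ℕ.< k ℕ.+ k
        t<2k = ℕ.<-≤-trans t<k (ℕ.m≤m+n k k)

      private
        -- Two loops beside the k rootings stay within the range of `shape` because k ≥ 3.
        s+k<2k : ∀ s → s ≤ 2 → s ℕ.+ k ℕ.< k ℕ.+ k
        s+k<2k s s≤2 = ℕ.+-monoˡ-< k (ℕ.≤-<-trans s≤2 (s≤s (s≤s (s≤s z≤n))))

      total₀ : wordTotal H k N ≈ loopSum r k N * powerSum H k + sum (allFin m) (λ _ → loopsCoeff k N [])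
      total₀ = trans (expand k (s≤s z≤n) (s+k<2k 0 z≤n)) (+-congˡ (F∑.sum-cong (allFin m) λ e →
        trans (edgeSum-monomials β 2≤r N k (s+k<2k 0 z≤n) 0 ≡.refl (x ∘ ιs e)) (*-identityʳ _)))

      -- With one loop all vertices of a hyperedge have the same coefficient. Summed over the
      -- hyperedges, the weight of a vertex is counted as often as its degree, which is again a
      -- function of the degree sequence.
      total₁ : wordTotal H (suc k) N ≈ loopSum r (suc k) N * powerSum H (suc k) +
        loopsCoeff (suc k) N (zero ∷ []) * sum (allFin n) (λ i → ⟨ degree H i ⟩ * x i)
      total₁ = trans (expand (suc k) (s≤s z≤n) (s+k<2k 1 (s≤s z≤n))) (+-congˡ (begin
        sum (allFin m) (λ e → edgeSum (suc k) N (x ∘ ιs e))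
          ≈⟨ F∑.sum-cong (allFin m) (λ e → trans
               (edgeSum-monomials β 2≤r N (suc k) (s+k<2k 1 (s≤s z≤n)) 1 ≡.refl (x ∘ ιs e))
               (trans (F∑.sum-cong (allFin k) λ i → *-cong (loopsCoeff₁ β (suc k) N i) (*-identityʳ _))
                 (sym (sum-*ˡ _ (allFin k) _)))) ⟩
        sum (allFin m) (λ e → C * sum (allFin k) (x ∘ ιs e))
          ≈⟨ sum-*ˡ C (allFin m) _ ⟨
        C * sum (allFin m) (λ e → sum (allFin k) (x ∘ ιs e))
          ≈⟨ *-congˡ (incidences x) ⟩
        _ ∎))
        where
        C : Carrier
        C = loopsCoeff (suc k) N (zero ∷ [])

      -- The coefficients form the matrix with κ off the diagonal and κ + δ on it, so the quadratic
      -- form of a hyperedge is δ times the sum of squares plus κ times the square of the sum. Over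
      -- all hyperedges the first part depends on the degrees only; in the second, the loop weights
      -- on `e` add up to α times `edgeDegree H e`.
      total₂ : let K = λ J → loopsCoeff (2 ℕ.+ k) N J in
        wordTotal H (2 ℕ.+ k) N ≈
        (loopSum r (2 ℕ.+ k) N * powerSum H (2 ℕ.+ k) +
         (K (zero ∷ zero ∷ []) - K (zero ∷ suc zero ∷ [])) * sum (allFin n) (λ i → ⟨ degree H i ⟩ * (x i * x i))) +
        K (zero ∷ suc zero ∷ []) * (α * α) * ⟨ ∑ℕ (allFin m) (λ e → edgeDegree H e ℕ.* edgeDegree H e) ⟩
      total₂ = trans (expand (2 ℕ.+ k) (s≤s z≤n) (s+k<2k 2 (s≤s (s≤s z≤n)))) (trans (+-congˡ (begin
        sum (allFin m) (λ e → edgeSum (2 ℕ.+ k) N (x ∘ ιs e))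
          ≈⟨ F∑.sum-cong (allFin m) (λ e → trans
               (edgeSum-monomials β 2≤r N (2 ℕ.+ k) (s+k<2k 2 (s≤s (s≤s z≤n))) 2 ≡.refl (x ∘ ιs e))
               (quadratic (x ∘ ιs e))) ⟩
        sum (allFin m) (λ e → δ * sum (allFin k) (λ i → x (ιs e i) * x (ιs e i)) +
          κ * (sum (allFin k) (x ∘ ιs e) * sum (allFin k) (x ∘ ιs e)))
          ≈⟨ F∑.sum-∙ (allFin m) _ _ ⟩
        _ ≈⟨ +-cong (trans (sym (sum-*ˡ δ (allFin m) _)) (*-congˡ (incidences (λ i → x i * x i))))
               (F∑.sum-cong (allFin m) λ e → begin
                 _ ≈⟨ *-congˡ (*-cong (linear-part e) (linear-part e)) ⟩
                 κ * ((α * ⟨ edgeDegree H e ⟩) * (α * ⟨ edgeDegree H e ⟩))  ≈⟨ *-congˡ (interchange _ _ _ _) ⟩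
                 κ * ((α * α) * (⟨ edgeDegree H e ⟩ * ⟨ edgeDegree H e ⟩))  ≈⟨ *-assoc _ _ _ ⟨
                 κ * (α * α) * (⟨ edgeDegree H e ⟩ * ⟨ edgeDegree H e ⟩)    ≈⟨ *-congˡ (fromℕ-* (edgeDegree H e) (edgeDegree H e)) ⟨
                 κ * (α * α) * ⟨ edgeDegree H e ℕ.* edgeDegree H e ⟩        ∎) ⟩
        _ ≈⟨ +-congˡ (trans (sym (sum-*ˡ _ (allFin m) _)) (*-congˡ (sym (fromℕ-sum (allFin m) _)))) ⟩
        _ ∎)) (sym (+-assoc _ _ _)))
        where
        K : List (Fin k) → Carrier
        K J = loopsCoeff (2 ℕ.+ k) N J
        κ δ : Carrier
        κ = K (zero ∷ suc zero ∷ [])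
        -- The sign of δ is left open: its factor agrees for hypergraphs with the same degree
        -- sequence.
        δ = K (zero ∷ zero ∷ []) - κ
        linear-part : ∀ e → sum (allFin k) (x ∘ ιs e) ≈ α * ⟨ edgeDegree H e ⟩
        linear-part e = begin
          sum (allFin k) (λ j → α * ⟨ degree H (ιs e j) ⟩)   ≈⟨ sum-*ˡ α (allFin k) _ ⟨
          α * sum (allFin k) (λ j → ⟨ degree H (ιs e j) ⟩)   ≈⟨ *-congˡ (fromℕ-sum (allFin k) (λ j → degree H (ιs e j))) ⟨
          α * ⟨ ∑ℕ (allFin k) (λ j → degree H (ιs e j)) ⟩    ≡⟨ cong (λ d → α * ⟨ d ⟩) (≡.sym (∑ℕ-edge H e (en e) (degree H))) ⟩
          α * ⟨ edgeDegree H e ⟩                             ∎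
        coefficient : ∀ i j → K (i ∷ j ∷ []) ≈ κ + (δ when does (j ≟ i))
        coefficient i j with j ≟ i
        ... | yes ≡.refl = trans (loopsCoeff₂-diagonal β (2 ℕ.+ k) N i) (sym (begin
                κ + (K₀ - κ)     ≈⟨ +-congˡ (+-comm _ _) ⟩
                κ + (- κ + K₀)   ≈⟨ +-assoc _ _ _ ⟨
                κ - κ + K₀       ≈⟨ +-congʳ (-‿inverseʳ κ) ⟩
                0# + K₀          ≈⟨ +-identityˡ _ ⟩
                K₀               ∎))
          where
          K₀ : Carrier
          K₀ = K (zero ∷ zero ∷ [])
        ... | no j≢i = trans (loopsCoeff₂ β (2 ℕ.+ k) N (j≢i ∘ ≡.sym)) (sym (+-identityʳ κ))
        quadratic : ∀ y → sum (allFin k) (λ i → sum (allFin k) (λ j → K (i ∷ j ∷ []) * (y i * (y j * 1#)))) ≈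
          δ * sum (allFin k) (λ i → y i * y i) + κ * (sum (allFin k) y * sum (allFin k) y)
        quadratic y = begin
          _ ≈⟨ F∑.sum-cong (allFin k) (λ i → begin
               _ ≈⟨ F∑.sum-cong (allFin k) (λ j → trans
                      (*-cong (trans (coefficient i j) (+-comm _ _)) (*-congˡ (*-identityʳ _)))
                      (trans (distribʳ _ _ _) (+-congʳ (when-* δ (does (j ≟ i)) _)))) ⟩
               _ ≈⟨ F∑.sum-∙ (allFin k) _ _ ⟩
               _ ≈⟨ +-cong (F∑.sum-delta i _) (trans (sym (sum-*ˡ κ (allFin k) _)) (*-congˡ (sym (sum-*ˡ (y i) (allFin k) y)))) ⟩
               δ * (y i * y i) + κ * (y i * sum (allFin k) y) ∎) ⟩
          _ ≈⟨ F∑.sum-∙ (allFin k) _ _ ⟩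
          _ ≈⟨ +-cong (sym (sum-*ˡ δ (allFin k) _)) (trans (sym (sum-*ˡ κ (allFin k) _))
                 (*-congˡ (trans (F∑.sum-cong (allFin k) λ i → *-comm _ _) (trans (sym (sum-*ˡ _ (allFin k) y)) (*-comm _ _))))) ⟩
          _ ≈⟨ +-congˡ (*-congˡ (*-comm _ _)) ⟩
          _ ∎

-- From inequalities between degrees to the order by traces

module Comparison {c ℓ₁ ℓ₂ ℓ₃} (F : OrderedField c ℓ₁ ℓ₂ ℓ₃) where

  open import Data.Nat.Base using (_!; _∸_)
  open import Relation.Binary.Definitions using (tri<; tri≈; tri>)
  open FiniteSums
  open Walks
  open Degrees
  open Evaluation F
  open TraceFormula F
  open Expansion F
  open EdgeContributions F
  open Positivity F
  open LowTraces F

  open import Algebra.Bundles using (CommutativeRing; CommutativeMonoid)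

  open OrderedField F hiding (zero)
  open import Relation.Binary.Reasoning.Setoid (CommutativeRing.setoid field-commutativeRing)
  open import Algebra.Properties.CommutativeSemigroup (CommutativeRing.*-commutativeSemigroup field-commutativeRing) using (interchange)

  x<y⇒0<y-x : ∀ {x y} → x < y → 0# < y - x
  x<y⇒0<y-x {x} x<y = <-respˡ-≈ (-‿inverseʳ x) (+-monoˡ-< (- x) x<y)

  *-monoʳ-< : ∀ {c x y} → 0# < c → x < y → c * x < c * y
  *-monoʳ-< {c} {x} {y} 0<c x<y = <-respˡ-≈ (+-identityʳ _) (<-respʳ-≈ (begin
    c * x + c * (y - x)  ≈⟨ distribˡ c x (y - x) ⟨
    c * (x + (y - x))    ≈⟨ *-congˡ (begin
      x + (y - x)   ≈⟨ +-congˡ (+-comm _ _) ⟩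
      x + (- x + y) ≈⟨ +-assoc _ _ _ ⟨
      x - x + y     ≈⟨ +-congʳ (-‿inverseʳ x) ⟩
      0# + y        ≈⟨ +-identityˡ y ⟩
      y             ∎) ⟩
    c * y                ∎) (+-monoʳ-< (c * x) (*-pos 0<c (x<y⇒0<y-x x<y))))

  fromℕ-mono-< : ∀ {a b} → a ℕ.< b → ⟨ a ⟩ < ⟨ b ⟩
  fromℕ-mono-< {a} {b} a<b = <-respˡ-≈ (+-identityʳ _) (<-respʳ-≈
    (trans (sym (fromℕ-+ a (suc (b ∸ suc a)))) (reflexive (cong ⟨_⟩ (≡.trans (ℕ.+-suc a _) (ℕ.m+[n∸m]≡n a<b)))))
    (+-monoʳ-< ⟨ a ⟩ (0<fromℕ F (suc (b ∸ suc a)))))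

  -- A function of a degree in {1,2} is affine in the degree.
  sum-degree-12 : ∀ {n m} (H : Hypergraph n m) → (∀ i → degree H i ≡ 1 ⊎ degree H i ≡ 2) → ∀ (h : ℕ → Carrier) →
    sum (allFin n) (h ∘ degree H) ≈ sum (allFin n) (λ _ → h 1 - (h 2 - h 1)) + ⟨ degreeSum H id ⟩ * (h 2 - h 1)
  sum-degree-12 {n} H 1∨2 h = begin
    sum (allFin n) (h ∘ degree H)
      ≈⟨ F∑.sum-cong (allFin n) (λ i → affine (degree H i) (1∨2 i)) ⟩
    sum (allFin n) (λ i → (h 1 - δ) + δ * ⟨ degree H i ⟩)
      ≈⟨ F∑.sum-∙ (allFin n) _ _ ⟩
    _ ≈⟨ +-congˡ (trans (sym (sum-*ˡ δ (allFin n) _)) (trans (*-congˡ (sym (fromℕ-sum (allFin n) _))) (*-comm _ _))) ⟩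
    _ ∎
    where
    δ : Carrier
    δ = h 2 - h 1
    cancel : ∀ x y → (x - y) + y ≈ x
    cancel x y = trans (+-assoc _ _ _) (trans (+-congˡ (-‿inverseˡ y)) (+-identityʳ x))
    affine : ∀ a → a ≡ 1 ⊎ a ≡ 2 → h a ≈ (h 1 - δ) + δ * ⟨ a ⟩
    affine _ (inj₁ ≡.refl) = sym (trans (+-congˡ (trans (*-congˡ fromℕ-1) (*-identityʳ δ))) (cancel (h 1) δ))
    affine _ (inj₂ ≡.refl) = sym (begin
      (h 1 - δ) + δ * (1# + ⟨ 1 ⟩)      ≈⟨ +-congˡ (trans (distribˡ _ _ _) (+-cong (*-identityʳ δ) (trans (*-congˡ fromℕ-1) (*-identityʳ δ)))) ⟩
      (h 1 - δ) + (δ + δ)               ≈⟨ +-assoc _ _ _ ⟨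
      (h 1 - δ) + δ + δ                 ≈⟨ +-congʳ (cancel (h 1) δ) ⟩
      h 1 + (h 2 - h 1)                 ≈⟨ +-comm _ _ ⟩
      (h 2 - h 1) + h 1                 ≈⟨ cancel (h 2) (h 1) ⟩
      h 2                               ∎)

  module _ {r′ : ℕ} (α : Carrier) (0<α : 0# < α) (α<1 : α < 1#) {n m : ℕ} (X H : Hypergraph n m)
    (uniformX : Uniform X (suc (suc (suc r′)))) (uniformH : Uniform H (suc (suc (suc r′))))
    (linearX : Linear X) (linearH : Linear H)
    (degrees≡ : degreeSum X id ≡ degreeSum H id)
    (bound : 2 ℕ.+ suc (suc (suc r′)) ≤ n ℕ.* suc (suc r′) ℕ.^ (n ∸ 1) ∸ 1)
    where

    private
      r k : ℕ
      r = suc (suc r′)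
      k = suc r

      0<β : 0# < β {r′} α
      0<β = *-pos (x<y⇒0<y-x α<1) (⁻¹!-pos r)

      TrX TrH : ℕ → Carrier
      TrX = Trace.Tr F k {n} (𝒜 F k X α)
      TrH = Trace.Tr F k {n} (𝒜 F k H α)
      W : Hypergraph n m → ℕ → ℕ → Carrier
      W = wordTotal {r′} α

      Tr≈ : ∀ d → (∀ N → W X (suc d) N ≈ W H (suc d) N) → TrX (suc d) ≈ TrH (suc d)
      Tr≈ d eq = trans (trace-total α X uniformX d) (trans (*-congˡ (*-congˡ (eq (suc r′ ℕ.+ d ℕ.* r)))) (sym (trace-total α H uniformH d)))

      -- Strictness, unlike equality, depends on the right number of arcs: for any other `N` there
      -- are no closed walks and the leading coefficients vanish.
      Tr< : ∀ d → (∀ N → suc N ≡ suc d ℕ.* r → W X (suc d) N < W H (suc d) N) → TrX (suc d) < TrH (suc d)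
      Tr< d lt = <-respˡ-≈ (sym (trace-total α X uniformX d)) (<-respʳ-≈ (sym (trace-total α H uniformH d))
        (*-monoʳ-< (0<fromℕ F (r ℕ.^ (n ∸ 1)) {{ℕ.m^n≢0 r (n ∸ 1)}}) (*-monoʳ-< (⁻¹!-pos (suc d)) (lt _ ≡.refl))))

    -- Orders 1 and 2 lie below k, where hyperedges contribute nothing beyond the loop weights.
    precedes-by-degrees : degreeSum X (λ d → d ℕ.* d) ℕ.< degreeSum H (λ d → d ℕ.* d) → Precedes F k α X H
    precedes-by-degrees lt = ≡.refl , 2 , s≤s z≤n , ℕ.≤-trans (ℕ.m≤m+n 2 k) bound , equal , Tr< 1 less
      where
      power₁ : ∀ (H : Hypergraph n m) → powerSum {r′} α H 1 ≈ α * ⟨ degreeSum H id ⟩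
      power₁ H = trans (F∑.sum-cong (allFin n) λ i → *-identityʳ _)
        (trans (sym (sum-*ˡ α (allFin n) _)) (*-congˡ (sym (fromℕ-sum (allFin n) _))))
      power₂ : ∀ (H : Hypergraph n m) → powerSum {r′} α H 2 ≈ α * α * ⟨ degreeSum H (λ d → d ℕ.* d) ⟩
      power₂ H = trans (F∑.sum-cong (allFin n) λ i → trans (*-congˡ (*-identityʳ _))
          (trans (interchange _ _ _ _) (*-congˡ (sym (fromℕ-* (degree H i) (degree H i))))))
        (trans (sym (sum-*ˡ (α * α) (allFin n) _)) (*-congˡ (sym (fromℕ-sum (allFin n) _))))
      equal : ∀ t → t ℕ.< 2 → TrX t ≈ TrH t
      equal zero          _ = refl
      equal (suc zero)    _ = Tr≈ 0 λ N → trans (total-short α X uniformX linearX N 1 (s≤s z≤n) (s≤s (s≤s z≤n)))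
        (trans (*-congˡ (trans (power₁ X) (trans (*-congˡ (reflexive (cong ⟨_⟩ degrees≡))) (sym (power₁ H)))))
          (sym (total-short α H uniformH linearH N 1 (s≤s z≤n) (s≤s (s≤s z≤n)))))
      equal (suc (suc _)) (s≤s (s≤s ()))
      less : ∀ N → suc N ≡ 2 ℕ.* r → W X 2 N < W H 2 N
      less N eq = <-respˡ-≈ (sym (total-short α X uniformX linearX N 2 (s≤s z≤n) (s≤s (s≤s (s≤s z≤n)))))
        (<-respʳ-≈ (sym (total-short α H uniformH linearH N 2 (s≤s z≤n) (s≤s (s≤s (s≤s z≤n)))))
        (*-monoʳ-< (loopSum-pos r 2 N (s≤s z≤n) eq)
          (<-respˡ-≈ (sym (power₂ X)) (<-respʳ-≈ (sym (power₂ H)) (*-monoʳ-< (*-pos 0<α 0<α) (fromℕ-mono-< lt))))))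

    -- Every part of the totals is a sum over vertices of a function of the degree, or depends on
    -- the hypergraph through m alone, except the last part of `total₂`.
    precedes-by-edges : (∀ i → degree X i ≡ 1 ⊎ degree X i ≡ 2) → (∀ i → degree H i ≡ 1 ⊎ degree H i ≡ 2) →
      ∑ℕ (allFin m) (λ e → edgeDegree X e ℕ.* edgeDegree X e) ℕ.< ∑ℕ (allFin m) (λ e → edgeDegree H e ℕ.* edgeDegree H e) →
      Precedes F k α X H
    precedes-by-edges X12 H12 lt =
      ≡.refl , 2 ℕ.+ k , s≤s z≤n , bound , equal , Tr< (suc k) less
      where
      -- By affineness such a sum is fixed by the number of vertices and the sum of the degrees.
      same : ∀ (h : ℕ → Carrier) → sum (allFin n) (h ∘ degree X) ≈ sum (allFin n) (h ∘ degree H)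
      same h = trans (sum-degree-12 X X12 h) (trans (+-congˡ (*-congʳ (reflexive (cong ⟨_⟩ degrees≡)))) (sym (sum-degree-12 H H12 h)))
      same-power : ∀ t → powerSum {r′} α X t ≈ powerSum {r′} α H t
      same-power t = same (λ d → pow (α * ⟨ d ⟩) t)
      equal-W : ∀ t → 1 ≤ t → t ℕ.< 2 ℕ.+ k → ∀ N → W X t N ≈ W H t N
      equal-W t 1≤t t<k+2 N with ℕ.<-cmp t k
      ... | tri< t<k _ _ = trans (total-short α X uniformX linearX N t 1≤t t<k)
              (trans (*-congˡ (same-power t)) (sym (total-short α H uniformH linearH N t 1≤t t<k)))
      ... | tri≈ _ ≡.refl _ = trans (total₀ α X uniformX linearX N)
              (trans (+-congʳ (*-congˡ (same-power k))) (sym (total₀ α H uniformH linearH N)))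
      ... | tri> _ _ k<t with ≡.refl ← ℕ.≤-antisym (ℕ.s≤s⁻¹ t<k+2) k<t = trans (total₁ α X uniformX linearX N)
              (trans (+-cong (*-congˡ (same-power (suc k))) (*-congˡ (same (λ d → ⟨ d ⟩ * (α * ⟨ d ⟩)))))
                (sym (total₁ α H uniformH linearH N)))
      equal : ∀ t → t ℕ.< 2 ℕ.+ k → TrX t ≈ TrH t
      equal zero    _  = refl
      equal (suc d) lt = Tr≈ d (equal-W (suc d) (s≤s z≤n) lt)
      less : ∀ N → suc N ≡ (2 ℕ.+ k) ℕ.* r → W X (2 ℕ.+ k) N < W H (2 ℕ.+ k) N
      less N eq = <-respˡ-≈ (sym (trans (total₂ α X uniformX linearX N) (+-congʳ
            (+-cong (*-congˡ (same-power (2 ℕ.+ k))) (*-congˡ (same (λ d → ⟨ d ⟩ * ((α * ⟨ d ⟩) * (α * ⟨ d ⟩)))))))))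
        (<-respʳ-≈ (sym (total₂ α H uniformH linearH N))
        (+-monoʳ-< _ (*-monoʳ-< (*-pos (loopsCoeff-pos (suc r′) N 0<β eq) (*-pos 0<α 0<α)) (fromℕ-mono-< lt))))

-- The cyclic successor

module CyclicSuccessor where

  open import Data.Fin.Base using (toℕ; inject₁)
  open import Data.Fin.Properties using (toℕ-injective; toℕ<n; toℕ-fromℕ<; toℕ-inject₁; toℕ-fromℕ)
  open import Data.Nat.Base using (_<_; _%_)
  open import Data.Nat.DivMod using (m<n⇒m%n≡m; n%n≡0; m%n<n)
  open import Relation.Binary.PropositionalEquality using (sym; trans)

  -- Arguments about `next` split along this alternative instead of computing with remainders.
  next-cases : ∀ {n} (i : Fin n) →
    (suc (toℕ i) < n × toℕ (next i) ≡ suc (toℕ i)) ⊎ (suc (toℕ i) ≡ n × toℕ (next i) ≡ 0)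
  next-cases {suc n} i with suc (toℕ i) ℕ.<? suc n
  ... | yes lt = inj₁ (lt , trans (toℕ-fromℕ< (m%n<n (suc (toℕ i)) (suc n))) (m<n⇒m%n≡m lt))
  ... | no ≮ with eq ← ℕ.≤-antisym (toℕ<n i) (ℕ.≮⇒≥ ≮) =
    inj₂ (eq , trans (toℕ-fromℕ< (m%n<n (suc (toℕ i)) (suc n))) (trans (cong (_% suc n) eq) (n%n≡0 (suc n))))

  next-inject₁ : ∀ {n} (i : Fin n) → next (inject₁ i) ≡ suc i
  next-inject₁ {n} i with next-cases (inject₁ i)
  ... | inj₁ (_ , eq) = toℕ-injective (trans eq (cong suc (toℕ-inject₁ i)))
  ... | inj₂ (eq , _) = ⊥-elim (ℕ.<-irrefl (trans (sym (toℕ-inject₁ i)) (ℕ.suc-injective eq)) (toℕ<n i))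

  next-fromℕ : ∀ n → next (Fin.fromℕ n) ≡ zero
  next-fromℕ n with next-cases (Fin.fromℕ n)
  ... | inj₁ (lt , _) = ⊥-elim (ℕ.<-irrefl (cong suc (toℕ-fromℕ n)) lt)
  ... | inj₂ (_ , eq) = toℕ-injective eq

  next-injective : ∀ {n} {i j : Fin n} → next i ≡ next j → i ≡ j
  next-injective {i = i} {j} eq with next-cases i | next-cases j
  ... | inj₁ (_ , p) | inj₁ (_ , q) = toℕ-injective (ℕ.suc-injective (trans (sym p) (trans (cong toℕ eq) q)))
  ... | inj₂ (p , _) | inj₂ (q , _) = toℕ-injective (ℕ.suc-injective (trans p (sym q)))
  ... | inj₁ (_ , p) | inj₂ (_ , q) with () ← trans (sym p) (trans (cong toℕ eq) q)
  ... | inj₂ (_ , p) | inj₁ (_ , q) with () ← trans (sym p) (trans (cong toℕ eq) q)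

  next-surjective : ∀ {n} (j : Fin n) → ∃[ i ] next i ≡ j
  next-surjective {suc n} zero    = Fin.fromℕ n , next-fromℕ n
  next-surjective {suc n} (suc j) = inject₁ j , next-inject₁ j

  next-≢ : ∀ {n} → 2 ≤ n → (i : Fin n) → next i ≢ i
  next-≢ 2≤n i eq with next-cases i
  ... | inj₁ (_ , p) = ℕ.<-irrefl (trans (sym (cong toℕ eq)) p) ℕ.≤-refl
  ... | inj₂ (p , q) = ℕ.<-irrefl (trans (cong suc (trans (sym q) (cong toℕ eq))) p) 2≤n

  next²-≢ : ∀ {n} → 3 ≤ n → (i : Fin n) → next (next i) ≢ i
  next²-≢ 3≤n i eq with next-cases i | next-cases (next i)
  ... | inj₁ (_ , p) | inj₁ (_ , q) = ℕ.<-irrefl (trans (sym (cong toℕ eq)) (trans q (cong suc p))) (ℕ.m<n⇒m<1+n ℕ.≤-refl)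
  ... | inj₁ (_ , p) | inj₂ (q , q′) = ℕ.<-irrefl
          (trans (cong (λ z → suc (suc z)) (trans (sym q′) (cong toℕ eq))) (trans (cong suc (sym p)) q)) 3≤n
  ... | inj₂ (p , p′) | inj₁ (q , q′) = ℕ.<-irrefl
          (trans (cong suc (trans (sym (trans q′ (cong suc p′))) (cong toℕ eq))) p) 3≤n
  ... | inj₂ (p , p′) | inj₂ (q , q′) = ℕ.<-irrefl (trans (cong suc (sym p′)) q) (ℕ.<-≤-trans (s≤s (s≤s z≤n)) 3≤n)

-- The hypercycle: uniform, linear, unicyclic, and its degrees

module Hypercycle where

  open import Data.Fin.Base using (toℕ; combine; remQuot)
  open import Data.Fin.Induction using (<-weakInduction)
  open import Data.Fin.Properties
    using (combine-remQuot; remQuot-combine; combine-injective; toℕ-injective)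
  open import Data.Fin.Subset using (∣_∣; _∈_; _∩_)
  open import Data.Fin.Subset.Properties using (x∈p∩q⁻)
  open import Data.Nat.Base using (_<_)
  open import Relation.Binary.Construct.Closure.ReflexiveTransitive using (Star; ε; _◅_; _◅◅_)
  open import Relation.Binary.PropositionalEquality using (refl; sym; trans)
  open FiniteSums
  open Walks using (module ℕ∑; ∑ℕ)
  open Words
  open Degrees
  open CyclicSuccessor

  does-true : ∀ {a} {A : Set a} (d : Dec A) → does d ≡ true → A
  does-true (yes a) _ = a

  atMostOne : ∀ {n} {S : Data.Fin.Subset.Subset n} → (∀ {x y} → x ∈ S → y ∈ S → x ≡ y) → ∣ S ∣ ≤ 1
  atMostOne {S = S} unique with enumerate S
  ... | ι , inj , ins , _ with ∣ S ∣
  ... | zero          = z≤n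
  ... | suc zero      = s≤s z≤n
  ... | suc (suc _)   with () ← inj {zero} {suc zero} (unique (ins zero) (ins (suc zero)))

  module _ {r′ m : ℕ} (3≤k : 3 ≤ suc (suc (suc r′))) (3≤m : 3 ≤ m) where

    private
      r k : ℕ
      r = suc (suc r′)
      k = suc r

    X : Hypergraph (m ℕ.* r) m
    X = hypercycle {k} {m} 3≤k 3≤m

    point : Fin m → Fin r → Fin (m ℕ.* r)
    point = combine

    point-surjective : ∀ v → ∃[ j ] ∃[ s ] v ≡ point j s
    point-surjective v = proj₁ (remQuot {m} r v) , proj₂ (remQuot {m} r v) , sym (combine-remQuot {m} r v)

    ∈X⇔ : ∀ i j s → point j s ∈ edge X i ⇔ (j ≡ i ⊎ (j ≡ next i × s ≡ zero))
    ∈X⇔ i j s = mk⇔ to from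
      where
      is : does (InHyperedge? k m i (point j s)) ≡ lookup (edge X i) (point j s)
      is = sym (Vec.lookup∘tabulate _ (point j s))
      to : point j s ∈ edge X i → j ≡ i ⊎ (j ≡ next i × s ≡ zero)
      to p = subst (λ (j , s) → j ≡ i ⊎ (j ≡ next i × s ≡ zero)) (remQuot-combine {m} j s)
        (Sum.map₂ (Product.map₂ toℕ-injective) (does-true (InHyperedge? k m i (point j s)) (trans is (∈⇒lookup p))))
      from : j ≡ i ⊎ (j ≡ next i × s ≡ zero) → point j s ∈ edge X i
      from q = lookup⇒∈ (trans (sym is) (dec-true (InHyperedge? k m i (point j s))
        (subst (λ (j , s) → j ≡ i ⊎ (j ≡ next i × toℕ s ≡ 0)) (sym (remQuot-combine {m} j s))
          (Sum.map₂ (Product.map₂ (cong toℕ)) q))))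

    ∈X : ∀ {i j s} → j ≡ i ⊎ (j ≡ next i × s ≡ zero) → point j s ∈ edge X i
    ∈X = Equivalence.from (∈X⇔ _ _ _)

    X∋ : ∀ {i j s} → point j s ∈ edge X i → j ≡ i ⊎ (j ≡ next i × s ≡ zero)
    X∋ = Equivalence.to (∈X⇔ _ _ _)

    -- Slot 0 is the vertex shared with the next hyperedge, slot 1 the one shared with the previous;
    -- the isomorphism built later relies on this order.
    edgePoint : Fin m → Fin k → Fin (m ℕ.* r)
    edgePoint i zero    = point (next i) zero
    edgePoint i (suc s) = point i s

    2≤m : 2 ≤ m
    2≤m = ℕ.≤-trans (s≤s (s≤s z≤n)) 3≤m

    X-enumerates : ∀ i → Enumerates X i (edgePoint i)
    X-enumerates i = record
      { injective  = inj _ _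
      ; inside     = λ { zero → ∈X (inj₂ (refl , refl)) ; (suc s) → ∈X (inj₁ refl) }
      ; surjective = sur
      }
      where
      inj : ∀ s t → edgePoint i s ≡ edgePoint i t → s ≡ t
      inj zero    zero    eq = refl
      inj zero    (suc t) eq = ⊥-elim (next-≢ 2≤m i (proj₁ (combine-injective _ _ _ _ eq)))
      inj (suc s) zero    eq = ⊥-elim (next-≢ 2≤m i (sym (proj₁ (combine-injective _ _ _ _ eq))))
      inj (suc s) (suc t) eq = cong suc (proj₂ (combine-injective i s i t eq))
      sur : ∀ {v} → v ∈ edge X i → ∃[ s ] v ≡ edgePoint i s
      sur {v} p with point-surjective v
      ... | j , s , refl with X∋ p
      ... | inj₁ refl          = suc s , refl
      ... | inj₂ (refl , refl) = zero , refl

    X-uniform : Uniform X k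
    X-uniform i = trans (∣∣≡∑ (edge X i)) (trans (∑ℕ-edge X i (X-enumerates i) (λ _ → 1))
      (trans (∑-const (allFin k) 1) (trans (ℕ.*-identityʳ _) (List.length-tabulate {n = k} id))))

    -- A common point cannot belong to both hyperedges in the same way, `next` being injective; so
    -- it is a vertex of the cycle, and one hyperedge follows the other.
    shared : ∀ {i i′ j s} → i ≢ i′ → point j s ∈ edge X i → point j s ∈ edge X i′ →
      s ≡ zero × ((j ≡ i × j ≡ next i′) ⊎ (j ≡ next i × j ≡ i′))
    shared i≢i′ p q with X∋ p | X∋ q
    ... | inj₁ refl          | inj₁ eq            = ⊥-elim (i≢i′ eq)
    ... | inj₁ refl          | inj₂ (eq , s≡0)    = s≡0 , inj₁ (refl , eq)
    ... | inj₂ (refl , s≡0) | inj₁ eq            = s≡0 , inj₂ (refl , eq)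
    ... | inj₂ (refl , _)   | inj₂ (eq , _)      = ⊥-elim (i≢i′ (next-injective eq))

    X-linear : Linear X
    X-linear {i} {i′} i≢i′ = atMostOne λ {x} {y} x∈ y∈ → same x y
      (x∈p∩q⁻ (edge X i) (edge X i′) x∈) (x∈p∩q⁻ (edge X i) (edge X i′) y∈)
      where
      same : ∀ x y → x ∈ edge X i × x ∈ edge X i′ → y ∈ edge X i × y ∈ edge X i′ → x ≡ y
      same x y (x∈ , x∈′) (y∈ , y∈′) with point-surjective x | point-surjective y
      ... | j , s , refl | l , t , refl with shared i≢i′ x∈ x∈′ | shared i≢i′ y∈ y∈′
      ... | refl , inj₁ (refl , _)  | refl , inj₁ (refl , _)  = refl
      ... | refl , inj₂ (refl , _)  | refl , inj₂ (refl , _)  = refl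
      -- Two different common vertices would make `i′` both the successor and the predecessor of
      -- `i`, as in a cycle of length 2.
      ... | refl , inj₁ (refl , p)  | refl , inj₂ (refl , q)  = ⊥-elim (next²-≢ 3≤m i (trans (cong next q) (sym p)))
      ... | refl , inj₂ (refl , q)  | refl , inj₁ (refl , p)  = ⊥-elim (next²-≢ 3≤m i (trans (cong next q) (sym p)))

    -- Ascending from `i` reaches the last index, whose successor is 0; ordinary induction from
    -- there reaches every index.
    next-induction : ∀ {m} {P : Fin m → Set} → (∀ i → P i → P (next i)) → ∀ {i} → P i → ∀ j → P j
    next-induction {suc m} {P} step {i} Pi = <-weakInduction P P0 (λ j Pj → subst P (next-inject₁ j) (step _ Pj))
      where
      open import Data.Fin.Induction using (<-weakInduction-startingFrom)
      open import Data.Fin.Properties using (≤fromℕ)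
      P0 : P zero
      P0 = subst P (next-fromℕ m) (step _ (<-weakInduction-startingFrom P Pi
        (λ j Pj → subst P (next-inject₁ j) (step _ Pj)) (≤fromℕ i)))

    X-connected : Connected X
    X-connected x y with point-surjective x | point-surjective y
    ... | j , s , refl | l , t , refl = toRoot ◅◅ next-induction {P = λ l → Star (Adjacent X) (point j zero) (point l zero)}
        (λ i path → path ◅◅ ((i , ∈X (inj₁ refl) , ∈X (inj₂ (refl , refl))) ◅ ε)) ε l ◅◅ fromRoot
      where
      toRoot : Star (Adjacent X) (point j s) (point j zero)
      toRoot = (j , ∈X (inj₁ refl) , ∈X (inj₁ refl)) ◅ ε
      fromRoot : Star (Adjacent X) (point l zero) (point l t)
      fromRoot = (l , ∈X (inj₁ refl) , ∈X (inj₁ refl)) ◅ ε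

    X-cycle : Cycle X
    X-cycle = record
      { len       = m
      ; 2≤len     = 2≤m
      ; vtx       = λ i → point i zero
      ; hedge     = id
      ; vtx-inj   = λ eq → proj₁ (combine-injective _ _ _ _ eq)
      ; hedge-inj = id
      ; vtx∈      = λ i → ∈X (inj₁ refl)
      ; next-vtx∈ = λ i → ∈X (inj₂ (refl , refl))
      }

    -- A vertex of `C` lies in two hyperedges, so it is one of the m cycle vertices. The two
    -- distinct ends of a hyperedge of `C` are therefore both of its cycle vertices, and `C` goes on
    -- to the next hyperedge; by cyclic induction it takes all of them.
    X-unique : ∀ C → SameCycle X X-cycle C
    X-unique C v i = mk⇔ to from
      where
      open Cycle C
      -- Each end of a hyperedge of C also lies in a neighbouring hyperedge of C.
      end : ∀ a → vtx a ≡ point (hedge a) zero ⊎ vtx a ≡ point (next (hedge a)) zero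
      end a with next-surjective a
      ... | b , refl with point-surjective (vtx (next b)) | next-vtx∈ b | vtx∈ (next b)
      ... | j , s , eq | p | q
          with shared (λ e → next-≢ 2≤len b (sym (hedge-inj e))) (subst (_∈ _) eq p) (subst (_∈ _) eq q)
      ... | refl , inj₁ (_ , refl) = inj₂ eq
      ... | refl , inj₂ (_ , refl) = inj₁ eq
      end′ : ∀ a → vtx (next a) ≡ point (hedge a) zero ⊎ vtx (next a) ≡ point (next (hedge a)) zero
      end′ a with point-surjective (vtx (next a)) | next-vtx∈ a | vtx∈ (next a)
      ... | j , s , eq | p | q
          with shared (λ e → next-≢ 2≤len a (sym (hedge-inj e))) (subst (_∈ _) eq p) (subst (_∈ _) eq q)
      ... | refl , inj₁ (refl , _) = inj₁ eq
      ... | refl , inj₂ (refl , _) = inj₂ eq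
      distinct : ∀ a → vtx a ≢ vtx (next a)
      distinct a eq = next-≢ 2≤len a (sym (vtx-inj eq))
      OnC : Fin m → Set
      OnC i = ∃[ a ] i ≡ hedge a
      onVertex : ∀ {j} b → vtx b ≡ point j zero → OnC j
      onVertex {j} b eq with next-surjective b
      ... | a , refl with shared (λ e → next-≢ 2≤len a (sym (hedge-inj e)))
              (subst (_∈ _) eq (next-vtx∈ a)) (subst (_∈ _) eq (vtx∈ (next a)))
      ... | _ , inj₁ (p , _) = a , p
      ... | _ , inj₂ (_ , p) = next a , p
      step : ∀ i → OnC i → OnC (next i)
      step _ (a , refl) with end a | end′ a
      ... | inj₂ eq | _       = onVertex a eq
      ... | inj₁ _  | inj₂ eq = onVertex (next a) eq
      ... | inj₁ p  | inj₁ q  = ⊥-elim (distinct a (trans p (sym q)))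
      start : Fin len
      start = Fin.fromℕ< (ℕ.≤-trans (s≤s z≤n) 2≤len)
      onC : ∀ i → OnC i
      onC = next-induction step {hedge start} (start , refl)
      to : Cycle.Traverses X-cycle v i → Cycle.Traverses C v i
      to (_ , refl , ends) with onC i
      ... | a , refl = a , refl , ends′ ends
        where
        ends′ : v ≡ point (hedge a) zero ⊎ v ≡ point (next (hedge a)) zero → v ≡ vtx a ⊎ v ≡ vtx (next a)
        ends′ e with end a | end′ a
        ends′ (inj₁ e) | inj₁ p | _      = inj₁ (trans e (sym p))
        ends′ (inj₁ e) | inj₂ _ | inj₁ q = inj₂ (trans e (sym q))
        ends′ (inj₁ e) | inj₂ p | inj₂ q = ⊥-elim (distinct a (trans p (sym q)))
        ends′ (inj₂ e) | inj₂ p | _      = inj₁ (trans e (sym p))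
        ends′ (inj₂ e) | inj₁ _ | inj₂ q = inj₂ (trans e (sym q))
        ends′ (inj₂ e) | inj₁ p | inj₁ q = ⊥-elim (distinct a (trans p (sym q)))
      from : Cycle.Traverses C v i → Cycle.Traverses X-cycle v i
      from (a , refl , inj₁ refl) = hedge a , refl , end a
      from (a , refl , inj₂ refl) = hedge a , refl , end′ a

    X-linearUnicyclic : LinearUnicyclic k X
    X-linearUnicyclic = X-uniform , X-linear , X-connected , X-cycle , X-unique

    private
      ∑-𝟙≟ : ∀ i → ∑ℕ (allFin m) (λ e → 𝟙 (does (e ≟ i))) ≡ 1
      ∑-𝟙≟ i = ℕ∑.sum-delta i (λ _ → 1)

    degree-point-suc : ∀ j s → degree X (point j (suc s)) ≤ 1
    degree-point-suc j s = subst (_≤ 1) (sym (degree≡∑ X (point j (suc s))))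
      (ℕ.≤-trans (∑-mono (allFin m) bound) (ℕ.≤-reflexive (∑-𝟙≟ j)))
      where
      bound : ∀ e → 𝟙 (lookup (edge X e) (point j (suc s))) ≤ 𝟙 (does (e ≟ j))
      bound e with lookup (edge X e) (point j (suc s)) in eq
      ... | false = z≤n
      ... | true with X∋ (lookup⇒∈ eq)
      ... | inj₁ refl rewrite dec-true (e ≟ e) refl = ℕ.≤-refl
      ... | inj₂ (_ , ())

    degree-point : ∀ j s → degree X (point j s) ≤ 2
    degree-point j s = subst (_≤ 2) (sym (degree≡∑ X (point j s)))
      (ℕ.≤-trans (∑-mono (allFin m) bound) (ℕ.≤-reflexive
        (trans (ℕ∑.sum-∙ (allFin m) _ _) (cong₂ ℕ._+_ (∑-𝟙≟ j) (∑-𝟙≟ p)))))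
      where
      p : Fin m
      p = proj₁ (next-surjective j)
      bound : ∀ e → 𝟙 (lookup (edge X e) (point j s)) ≤ 𝟙 (does (e ≟ j)) ℕ.+ 𝟙 (does (e ≟ p))
      bound e with lookup (edge X e) (point j s) in eq
      ... | false = z≤n
      ... | true with X∋ (lookup⇒∈ eq)
      ... | inj₁ refl rewrite dec-true (e ≟ e) refl = s≤s z≤n
      ... | inj₂ (j≡ , _) with refl ← next-injective (trans (sym j≡) (sym (proj₂ (next-surjective j))))
            rewrite dec-true (p ≟ p) refl = ℕ.m≤n+m 1 _

    -- Two cycle vertices count at most 2 each, the k - 2 inserted ones at most 1 each. An upper
    -- bound is enough, as the sum of squares is to be small.
    X-edgeDegree : ∀ i → edgeDegree X i ≤ 2 ℕ.+ k
    X-edgeDegree i = subst (_≤ 2 ℕ.+ k) (sym (trans (∑ℕ-edge X i (X-enumerates i) (degree X))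
        (trans (ℕ∑.sum-allFin-suc r (degree X ∘ edgePoint i))
          (cong (degree X (point (next i) zero) ℕ.+_) (ℕ∑.sum-allFin-suc (suc r′) (degree X ∘ point i))))))
      (ℕ.≤-trans (ℕ.+-mono-≤ (degree-point (next i) zero) (ℕ.+-mono-≤ (degree-point i zero)
        (∑-mono (allFin (suc r′)) (degree-point-suc i))))
      (ℕ.≤-reflexive (cong (4 ℕ.+_) (trans (∑-const (allFin (suc r′)) 1) (trans (ℕ.*-identityʳ _) (List.length-tabulate {n = suc r′} id))))))

-- The number of vertices of a unicyclic hypergraph

module UnicyclicOrder where

  open import Data.Fin.Base using (inject₁; fromℕ<)
  open import Data.Fin.Properties using (any?)
  open import Data.Fin.Relation.Unary.Top using (view; ‵fromℕ; ‵inject₁)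
  open import Data.Fin.Subset using (Subset; ∣_∣; _∈_; _∩_; _∪_; ⋃)
  open import Data.Fin.Subset.Properties
    using (x∈p∩q⁻; x∈p∩q⁺; x∈p∪q⁻; x∈p∪q⁺; _∈?_; ∉⊥; ∈⊤; ∣⊤∣≡n; ⊆-antisym)
  open import Data.List.Membership.Propositional using () renaming (find to find∈)
  open import Data.List.Membership.Propositional.Properties
    using (∈-allFin; ∈-++⁺ˡ; ∈-++⁻; ∈-∃++; ∈-lookup)
  open import Data.List.Relation.Binary.Permutation.Propositional as Perm using (_↭_)
  import Data.List.Relation.Binary.Permutation.Propositional.Properties as Perm
  open import Data.List.Relation.Unary.All as All using (All; []; _∷_)
  open import Data.List.Relation.Unary.AllPairs as AllPairs using (AllPairs; []; _∷_)
  import Data.List.Relation.Unary.AllPairs.Properties as AllPairs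
  open import Data.List.Relation.Unary.Any as Any using (Any; here; there)
  open import Data.List.Relation.Unary.Unique.Propositional.Properties using (allFin⁺)
  open import Data.Nat.Base using (_<_; _+_; _*_)
  open import Relation.Binary.Construct.Closure.ReflexiveTransitive using (Star; ε; _◅_)
  open import Relation.Binary.PropositionalEquality using (refl; sym; trans)
  open Words using (enumerate)
  open CyclicSuccessor

  ∣∪∣+∣∩∣ : ∀ {n} (p q : Subset n) → ∣ p ∪ q ∣ + ∣ p ∩ q ∣ ≡ ∣ p ∣ + ∣ q ∣
  ∣∪∣+∣∩∣ []          []          = refl
  ∣∪∣+∣∩∣ (true ∷ p)  (true ∷ q)  = cong suc (trans (ℕ.+-suc _ _) (trans (cong suc (∣∪∣+∣∩∣ p q)) (sym (ℕ.+-suc _ _))))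
  ∣∪∣+∣∩∣ (true ∷ p)  (false ∷ q) = cong suc (∣∪∣+∣∩∣ p q)
  ∣∪∣+∣∩∣ (false ∷ p) (true ∷ q)  = trans (cong suc (∣∪∣+∣∩∣ p q)) (sym (ℕ.+-suc _ _))
  ∣∪∣+∣∩∣ (false ∷ p) (false ∷ q) = ∣∪∣+∣∩∣ p q

  data Size {n} (S : Subset n) : Set where
    one   : ∣ S ∣ ≡ 1 → (∀ {x y} → x ∈ S → y ∈ S → x ≡ y) → Size S
    two   : ∣ S ∣ ≡ 2 → ∀ {x y} → x ∈ S → y ∈ S → x ≢ y → Size S
    three : ∀ {x y z} → x ∈ S → y ∈ S → z ∈ S → x ≢ y → x ≢ z → y ≢ z → Size S

  size : ∀ {n} {S : Subset n} {x} → x ∈ S → Size S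
  size {S = S} x∈ with enumerate S
  ... | ι , inj , ins , sur = go ∣ S ∣ refl ι inj ins sur
    where
    go : ∀ s → ∣ S ∣ ≡ s → (ι : Fin s → Fin _) → (∀ {i j} → ι i ≡ ι j → i ≡ j) → (∀ i → ι i ∈ S) →
      (∀ {x} → x ∈ S → ∃[ i ] x ≡ ι i) → Size S
    go zero    eq ι inj ins sur with () ← proj₁ (sur x∈)
    go (suc zero) eq ι inj ins sur = one eq λ y∈ z∈ → case sur y∈ , sur z∈ of λ
      { ((zero , p) , (zero , q)) → trans p (sym q) }
    go (suc (suc zero)) eq ι inj ins sur = two eq (ins zero) (ins (suc zero)) (λ e → case inj e of λ ())
    go (suc (suc (suc s))) eq ι inj ins sur =
      three (ins zero) (ins (suc zero)) (ins (suc (suc zero)))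
        (λ e → case inj e of λ ()) (λ e → case inj e of λ ()) (λ e → case inj e of λ ())

  lookup-injective : ∀ {a b} {A : Set a} {B : Set b} (f : A → B) {l : List A} → AllPairs (λ s t → f s ≢ f t) l →
    ∀ i j → f (List.lookup l i) ≡ f (List.lookup l j) → i ≡ j
  lookup-injective f (ps ∷ pss) zero    zero    eq = refl
  lookup-injective f (ps ∷ pss) zero    (suc j) eq = ⊥-elim (All.lookup ps (∈-lookup j) eq)
  lookup-injective f (ps ∷ pss) (suc i) zero    eq = ⊥-elim (All.lookup ps (∈-lookup i) (sym eq))
  lookup-injective f (ps ∷ pss) (suc i) (suc j) eq = cong suc (lookup-injective f pss i j eq)

  module _ {n m} (H : Hypergraph n m) where

    Step : Set
    Step = Fin n × Fin m

    -- The list holds the vertex at which each step begins, so a closed path lists its starting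
    -- vertex only once, as `Cycle` does.
    data Path : Fin n → Fin n → List Step → Set where
      []  : ∀ {x} → Path x x []
      _∷_ : ∀ {x y z g l} → x ∈ edge H g × z ∈ edge H g → Path z y l → Path x y ((x , g) ∷ l)

    path-snoc : ∀ {x z y g l} → Path x z l → z ∈ edge H g × y ∈ edge H g → Path x y (l ++ (z , g) ∷ [])
    path-snoc []      s = s ∷ []
    path-snoc (t ∷ p) s = t ∷ path-snoc p s

    path-∈ : ∀ {x y l} → Path x y l → All (λ (v , g) → v ∈ edge H g) l
    path-∈ []            = []
    path-∈ ((v∈ , _) ∷ p) = v∈ ∷ path-∈ p

    after : ∀ {x y l} → Path x y l → Fin (length l) → Fin n
    after (_∷_ {z = z} _ p) zero    = z
    after (_ ∷ p)           (suc i) = after p i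

    after-∈ : ∀ {x y l} (p : Path x y l) i → after p i ∈ edge H (proj₂ (List.lookup l i))
    after-∈ ((_ , z∈) ∷ p) zero    = z∈
    after-∈ (_ ∷ p)        (suc i) = after-∈ p i

    after-inject₁ : ∀ {x y s l} (p : Path x y (s ∷ l)) (i : Fin (length l)) → after p (inject₁ i) ≡ proj₁ (List.lookup l i)
    after-inject₁ (_ ∷ _ ∷ p) zero    = refl
    after-inject₁ (_ ∷ t ∷ p) (suc i) = after-inject₁ (t ∷ p) i

    after-last : ∀ {x y s l} (p : Path x y (s ∷ l)) → after p (Fin.fromℕ (length l)) ≡ y
    after-last (_ ∷ [])    = refl
    after-last (_ ∷ t ∷ p) = after-last (t ∷ p)

    DistinctVertices DistinctEdges : List Step → Set
    DistinctVertices = AllPairs (λ s t → proj₁ s ≢ proj₁ t)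
    DistinctEdges    = AllPairs (λ s t → proj₂ s ≢ proj₂ t)

    closedPath⇒cycle : ∀ {x s t l} → Path x x (s ∷ t ∷ l) → DistinctVertices (s ∷ t ∷ l) → DistinctEdges (s ∷ t ∷ l) → Cycle H
    closedPath⇒cycle {x} {s} {t} {l} p vs es = record
      { len       = length cl
      ; 2≤len     = s≤s (s≤s z≤n)
      ; vtx       = proj₁ ∘ List.lookup cl
      ; hedge     = proj₂ ∘ List.lookup cl
      ; vtx-inj   = lookup-injective proj₁ vs _ _
      ; hedge-inj = lookup-injective proj₂ es _ _
      ; vtx∈      = λ i → All.lookup (path-∈ p) (∈-lookup i)
      ; next-vtx∈ = λ i → subst (_∈ edge H (proj₂ (List.lookup cl i))) (after-next i) (after-∈ p i)
      }
      where
      cl : List Step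
      cl = s ∷ t ∷ l
      start : ∀ {y l} → Path x y (s ∷ l) → x ≡ proj₁ s
      start (_ ∷ _) = refl
      after-next : ∀ i → after p i ≡ proj₁ (List.lookup cl (next i))
      after-next i with view i
      ... | ‵fromℕ     = trans (after-last p) (trans (start p) (cong (proj₁ ∘ List.lookup cl) (sym (next-fromℕ _))))
      ... | ‵inject₁ j = trans (after-inject₁ p j) (cong (proj₁ ∘ List.lookup cl) (sym (next-inject₁ j)))

    span : List (Fin m) → Subset n
    span es = ⋃ (List.map (edge H) es)

    ∈-span : ∀ {x g es} → g List.∈ es → x ∈ edge H g → x ∈ span es
    ∈-span (here refl) x∈ = x∈p∪q⁺ (inj₁ x∈)
    ∈-span (there g∈)  x∈ = x∈p∪q⁺ (inj₂ (∈-span g∈ x∈))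

    span-∈ : ∀ {x} es → x ∈ span es → ∃[ g ] (g List.∈ es × x ∈ edge H g)
    span-∈ []       x∈ = ⊥-elim (∉⊥ x∈)
    span-∈ (g ∷ es) x∈ with x∈p∪q⁻ (edge H g) (span es) x∈
    ... | inj₁ x∈g = g , here refl , x∈g
    ... | inj₂ x∈′ with span-∈ es x∈′
    ... | h , h∈ , x∈h = h , there h∈ , x∈h

    -- `vs` compares only the vertices at which steps begin; `fresh` adds that the end is none of
    -- them, so the path can be closed up.
    record SimplePath (es : List (Fin m)) (x y : Fin n) : Set where
      field
        steps  : List Step
        path   : Path x y steps
        vs     : DistinctVertices steps
        gs     : DistinctEdges steps
        fresh  : All (λ s → proj₁ s ≢ y) steps
        within : All (λ s → proj₂ s List.∈ es) steps

      vertices-in-span : All (λ s → proj₁ s ∈ span es) steps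
      vertices-in-span = All.zipWith (λ (g∈ , v∈) → ∈-span g∈ v∈) (within , path-∈ path)

    direct : ∀ {es f x y} → f List.∈ es → x ∈ edge H f → y ∈ edge H f → x ≢ y → SimplePath es x y
    direct f∈ x∈ y∈ x≢y = record
      { steps = _ ; path = (x∈ , y∈) ∷ [] ; vs = [] ∷ [] ; gs = [] ∷ [] ; fresh = x≢y ∷ [] ; within = f∈ ∷ [] }

    module _ {es : List (Fin m)} {f : Fin m} (f∉es : ¬ (f List.∈ es)) where

      private
        avoids : ∀ {l : List Step} → All (λ s → proj₂ s List.∈ es) l → All (λ s → proj₂ s ≢ f) l
        avoids = All.map λ { g∈ refl → f∉es g∈ }

        outside : ∀ {x} {l : List Step} → ¬ (x ∈ span es) → All (λ s → proj₁ s ∈ span es) l → All (λ s → proj₁ s ≢ x) l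
        outside x∉ = All.map λ { v∈ refl → x∉ v∈ }

      extendʳ : ∀ {x z y} → SimplePath es x z → z ∈ span es → z ∈ edge H f → y ∈ edge H f → ¬ (y ∈ span es) → SimplePath (f ∷ es) x y
      extendʳ {z = z} P z∈U z∈f y∈f y∉U = record
        { steps  = steps ++ (z , f) ∷ []
        ; path   = path-snoc path (z∈f , y∈f)
        ; vs     = AllPairs.++⁺ vs ([] ∷ []) (All.map (_∷ []) fresh)
        ; gs     = AllPairs.++⁺ gs ([] ∷ []) (All.map (_∷ []) (avoids within))
        ; fresh  = All.++⁺ (outside y∉U vertices-in-span) ((λ { refl → y∉U z∈U }) ∷ [])
        ; within = All.++⁺ (All.map there within) (here refl ∷ [])
        }
        where
        open SimplePath P
        import Data.List.Relation.Unary.All.Properties as All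

      extendˡ : ∀ {x z y} → SimplePath es z y → y ∈ span es → z ∈ edge H f → x ∈ edge H f → ¬ (x ∈ span es) → SimplePath (f ∷ es) x y
      extendˡ {x} P y∈U z∈f x∈f x∉U = record
        { steps  = (x , f) ∷ steps
        ; path   = (x∈f , z∈f) ∷ path
        ; vs     = All.map (λ ≢x eq → ≢x (sym eq)) (outside x∉U vertices-in-span) ∷ vs
        ; gs     = All.map (λ ≢f eq → ≢f (sym eq)) (avoids within) ∷ gs
        ; fresh  = (λ { refl → x∉U y∈U }) ∷ fresh
        ; within = here refl ∷ All.map there within
        }
        where open SimplePath P

      weaken : ∀ {x y} → SimplePath es x y → SimplePath (f ∷ es) x y
      weaken P = record { SimplePath P ; within = All.map there (SimplePath.within P) }

      -- A hyperedge outside `es` closes a simple path in `es` to a cycle. Recording its ends at `f`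
      -- makes cycles through `f` with different ends distinguishable.
      closeUp : ∀ {x y} → SimplePath es x y → x ≢ y → x ∈ edge H f → y ∈ edge H f →
        Σ[ C ∈ Cycle H ] ((∀ i → Cycle.hedge C i List.∈ (f ∷ es)) × Cycle.Traverses C x f × Cycle.Traverses C y f ×
          (∀ v → Cycle.Traverses C v f → v ≡ x ⊎ v ≡ y))
      closeUp {x} {y} record { steps = [] ; path = [] } x≢y x∈ y∈ = ⊥-elim (x≢y refl)
      closeUp {x} {y} record { steps = s ∷ l ; path = p@(_ ∷ _) ; vs = vs ; gs = gs ; fresh = fresh ; within = within } x≢y x∈ y∈ =
        C , hedges , (zero , refl , inj₂ (cong (proj₁ ∘ List.lookup cl) (sym (next-inject₁ zero)))) , (zero , refl , inj₁ refl) , only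
        where
        cl : List Step
        cl = (y , f) ∷ s ∷ l
        C : Cycle H
        C = closedPath⇒cycle ((y∈ , x∈) ∷ p) (All.map (λ ≢y eq → ≢y (sym eq)) fresh ∷ vs)
              (All.map (λ ≢f eq → ≢f (sym eq)) (avoids within) ∷ gs)
        hedges : ∀ i → Cycle.hedge C i List.∈ (f ∷ es)
        hedges zero    = here refl
        hedges (suc i) = there (All.lookup within (∈-lookup i))
        only : ∀ v → Cycle.Traverses C v f → v ≡ x ⊎ v ≡ y
        only v (i , f≡ , ends) with refl ← Cycle.hedge-inj C {zero} {i} f≡ = case ends of λ where
          (inj₁ eq) → inj₂ eq
          (inj₂ eq) → inj₁ (trans eq (cong (proj₁ ∘ List.lookup cl) (next-inject₁ zero)))

    module _ {k} (2≤k : 2 ≤ k) (uniform : Uniform H k) (unicyclic : Unicyclic H) where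

      private
        connected : Connected H
        connected = proj₁ unicyclic
        same : ∀ C C′ → SameCycle H C C′
        same C C′ x e = mk⇔ (to (proj₂ (proj₂ unicyclic) C′ x e) ∘ from (proj₂ (proj₂ unicyclic) C x e))
          (to (proj₂ (proj₂ unicyclic) C x e) ∘ from (proj₂ (proj₂ unicyclic) C′ x e))
          where open Equivalence

      -- The Euler characteristic of the incidence graph, which has `∣ span es ∣ + length es`
      -- vertices and `k * length es` edges: 1 for a tree, 0 with one cycle.
      data Balance (es : List (Fin m)) : Set where
        tree  : ∣ span es ∣ + length es ≡ suc (k * length es) →
                (∀ (C : Cycle H) → ¬ (∀ i → Cycle.hedge C i List.∈ es)) → Balance es
        cycle : ∣ span es ∣ + length es ≡ k * length es →
                Σ[ C ∈ Cycle H ] (∀ i → Cycle.hedge C i List.∈ es) → Balance es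

      -- `paths` supplies the path that a new hyperedge meeting the span twice closes to a cycle.
      record Stage (es : List (Fin m)) : Set where
        field
          root    : ∃[ x ] x ∈ span es
          paths   : ∀ {x y} → x ∈ span es → y ∈ span es → x ≢ y → SimplePath es x y
          balance : Balance es

      nonempty : ∀ e → ∃[ z ] z ∈ edge H e
      nonempty e with enumerate (edge H e)
      ... | ι , _ , ins , _ = ι i , ins i
        where
        i : Fin ∣ edge H e ∣
        i = fromℕ< (ℕ.≤-trans (s≤s z≤n) (subst (2 ≤_) (sym (uniform e)) 2≤k))

      stage₁ : ∀ e → Stage (e ∷ [])
      stage₁ e = record
        { root    = Product.map₂ (∈-span {es = e ∷ []} (here refl)) (nonempty e)
        ; paths   = λ x∈ y∈ → direct (here refl) (inE x∈) (inE y∈)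
        ; balance = tree
            (trans (ℕ.+-comm _ 1) (cong suc (trans (cong ∣_∣ (⊆-antisym inE (∈-span {es = e ∷ []} (here refl))))
              (trans (uniform e) (sym (ℕ.*-identityʳ k))))))
            λ C all → next-≢ (Cycle.2≤len C) (first C) (Cycle.hedge-inj C (trans (only (all _)) (sym (only (all (first C))))))
        }
        where
        only : ∀ {g} → g List.∈ (e ∷ []) → g ≡ e
        only (here eq) = eq
        first : ∀ (C : Cycle H) → Fin (Cycle.len C)
        first C = fromℕ< (ℕ.≤-trans (s≤s z≤n) (Cycle.2≤len C))
        inE : ∀ {x} → x ∈ span (e ∷ []) → x ∈ edge H e
        inE x∈ with span-∈ (e ∷ []) x∈
        ... | _ , here refl , x∈e = x∈e

      module _ {es : List (Fin m)} {f : Fin m} (f∉es : ¬ (f List.∈ es)) {x₀ : Fin n} (x₀∈f : x₀ ∈ edge H f) (x₀∈U : x₀ ∈ span es) (stage : Stage es) where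

        open Stage stage
        private
          U : Subset n
          U = span es

          -- A path between an old and a new vertex passes through the attachment vertex `x₀`.
          newPaths : ∀ {x y} → x ∈ span (f ∷ es) → y ∈ span (f ∷ es) → x ≢ y → SimplePath (f ∷ es) x y
          newPaths {x} {y} x∈ y∈ x≢y with x ∈? U | y ∈? U
          ... | yes x∈U | yes y∈U = weaken f∉es (paths x∈U y∈U x≢y)
          ... | no x∉U | no y∉U = direct (here refl) (inF x∉U x∈) (inF y∉U y∈) x≢y
            where
            inF : ∀ {x} → ¬ (x ∈ U) → x ∈ span (f ∷ es) → x ∈ edge H f
            inF x∉U x∈ = case x∈p∪q⁻ (edge H f) U x∈ of λ { (inj₁ p) → p ; (inj₂ q) → ⊥-elim (x∉U q) }
          ... | yes x∈U | no y∉U with x ≟ x₀ | x∈p∪q⁻ (edge H f) U y∈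
          ... | _        | inj₂ y∈U = ⊥-elim (y∉U y∈U)
          ... | yes refl | inj₁ y∈f = direct (here refl) x₀∈f y∈f x≢y
          ... | no x≢x₀  | inj₁ y∈f = extendʳ f∉es (paths x∈U x₀∈U x≢x₀) x₀∈U x₀∈f y∈f y∉U
          newPaths {x} {y} x∈ y∈ x≢y | no x∉U | yes y∈U with y ≟ x₀ | x∈p∪q⁻ (edge H f) U x∈
          ... | _        | inj₂ x∈U = ⊥-elim (x∉U x∈U)
          ... | yes refl | inj₁ x∈f = direct (here refl) x∈f x₀∈f x≢y
          ... | no y≢x₀  | inj₁ x∈f = extendˡ f∉es (paths x₀∈U y∈U (y≢x₀ ∘ sym)) y∈U x₀∈f x∈f x∉U

          grow : ∀ {s} → ∣ edge H f ∩ U ∣ ≡ s → s + (∣ span (f ∷ es) ∣ + length (f ∷ es)) ≡ suc (k + (∣ U ∣ + length es))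
          grow {s} eq = trans (cong (s +_) (ℕ.+-suc _ _)) (trans (ℕ.+-suc s _) (cong suc
            (trans (sym (ℕ.+-assoc s _ _)) (trans (cong (_+ length es)
              (trans (ℕ.+-comm s _) (trans (cong (∣ span (f ∷ es) ∣ +_) (sym eq)) (trans (∣∪∣+∣∩∣ (edge H f) U) (cong (_+ ∣ U ∣) (uniform f))))))
              (ℕ.+-assoc k _ _)))))

          k*suc : k + k * length es ≡ k * length (f ∷ es)
          k*suc = sym (ℕ.*-suc k (length es))

          cycleThrough : ∀ {x y} → x ∈ edge H f ∩ U → y ∈ edge H f ∩ U → x ≢ y → _
          cycleThrough x∈ y∈ x≢y = closeUp f∉es
            (paths (proj₂ (x∈p∩q⁻ (edge H f) U x∈)) (proj₂ (x∈p∩q⁻ (edge H f) U y∈)) x≢y) x≢y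
            (proj₁ (x∈p∩q⁻ (edge H f) U x∈)) (proj₁ (x∈p∩q⁻ (edge H f) U y∈))

          -- Both ends of `f` in such a cycle also lie in a neighbouring hyperedge of the cycle,
          -- hence in the old span, where `f` has only one vertex.
          noCycleThrough : (∀ {x y} → x ∈ edge H f ∩ U → y ∈ edge H f ∩ U → x ≡ y) →
            ∀ (C : Cycle H) → (∀ i → Cycle.hedge C i List.∈ (f ∷ es)) → ∀ i → Cycle.hedge C i List.∈ es
          noCycleThrough unique C all i with all i
          ... | there g∈ = g∈
          ... | here i↦f = ⊥-elim (next-≢ 2≤len i (sym (vtx-inj (unique
                  (x∈p∩q⁺ (subst (λ g → vtx i ∈ edge H g) i↦f (vtx∈ i) , left))
                  (x∈p∩q⁺ (subst (λ g → vtx (next i) ∈ edge H g) i↦f (next-vtx∈ i) , ∈-span (other (next i) (next-≢ 2≤len i)) (vtx∈ (next i))))))))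
            where
            open Cycle C
            other : ∀ j → j ≢ i → hedge j List.∈ es
            other j j≢i with all j
            ... | there g∈ = g∈
            ... | here j↦f = ⊥-elim (j≢i (hedge-inj (trans j↦f (sym i↦f))))
            left : vtx i ∈ U
            left with next-surjective i
            ... | j , eq = ∈-span (other j λ j≡i → next-≢ 2≤len i (trans (cong next (sym j≡i)) eq))
                    (subst (λ i → vtx i ∈ edge H (hedge j)) eq (next-vtx∈ j))

          -- Meeting the span in one vertex keeps the Euler characteristic; in two, it lowers it by
          -- one and closes a cycle. Done twice, this gives a cycle through `f` beside one that
          -- avoids `f`; three common vertices give two cycles with different ends at `f`.
          -- Uniqueness excludes both.
          newBalance : Balance (f ∷ es)
          newBalance with size (x∈p∩q⁺ {p = edge H f} {q = U} (x₀∈f , x₀∈U)) | balance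
          ... | one card unique | tree eq acyclic = tree
                (trans (ℕ.suc-injective (grow card)) (trans (cong (k +_) eq) (trans (ℕ.+-suc k _) (cong suc k*suc))))
                (λ C all → acyclic C (noCycleThrough unique C all))
          ... | one card unique | cycle eq (C , all) = cycle
                (trans (ℕ.suc-injective (grow card)) (trans (cong (k +_) eq) k*suc))
                (C , there ∘ all)
          ... | two card x∈ y∈ x≢y | tree eq acyclic = cycle
                (ℕ.suc-injective (trans (ℕ.suc-injective (grow card)) (trans (cong (k +_) eq) (trans (ℕ.+-suc k _) (cong suc k*suc)))))
                (Product.map₂ proj₁ (cycleThrough x∈ y∈ x≢y))
          ... | two _ x∈ y∈ x≢y | cycle _ old = ⊥-elim (clash x∈ y∈ x≢y old)
            where
            clash : ∀ {x y} → x ∈ edge H f ∩ U → y ∈ edge H f ∩ U → x ≢ y → ¬ (Σ[ C ∈ Cycle H ] (∀ i → Cycle.hedge C i List.∈ es))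
            clash x∈ y∈ x≢y (C , all) with cycleThrough x∈ y∈ x≢y
            ... | C′ , _ , tr , _ with Equivalence.to (same C′ C _ _) tr
            ... | i , eq , _ = f∉es (subst (List._∈ es) (sym eq) (all i))
          ... | three x∈ y∈ z∈ x≢y x≢z y≢z | _ with cycleThrough x∈ y∈ x≢y | cycleThrough x∈ z∈ x≢z
          ... | C , _ , _ , _ , only | C′ , _ , _ , tr , _ with only _ (Equivalence.to (same C′ C _ _) tr)
          ... | inj₁ z≡x = ⊥-elim (x≢z (sym z≡x))
          ... | inj₂ z≡y = ⊥-elim (y≢z (sym z≡y))

        stage-suc : Stage (f ∷ es)
        stage-suc = record
          { root    = Product.map₂ (λ x∈ → x∈p∪q⁺ (inj₂ x∈)) root
          ; paths   = newPaths
          ; balance = newBalance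
          }

      -- Otherwise the span would be closed under adjacency, and connectedness would put the
      -- hyperedge `f` inside it.
      meets : ∀ {es rest} → Stage es → es ++ rest ↭ allFin m → ∀ {f} → f List.∈ rest →
        Any (λ f → ∃[ x ] (x ∈ edge H f × x ∈ span es)) rest
      meets {es} {rest} stage p {f} f∈ with Any.any? (λ f → any? (λ x → (x ∈? edge H f) ×-dec (x ∈? span es))) rest
        where open import Relation.Nullary.Decidable using (_×-dec_)
      ... | yes some = some
      ... | no none = ⊥-elim (none (List.lose f∈ (z , z∈f , closed (connected x z) x∈U)))
        where
        x = proj₁ (Stage.root stage)
        x∈U = proj₂ (Stage.root stage)
        z = proj₁ (nonempty f)
        z∈f = proj₂ (nonempty f)
        closed : ∀ {x z} → Star (Adjacent H) x z → x ∈ span es → z ∈ span es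
        closed ε x∈ = x∈
        closed ((e , v∈ , w∈) ◅ path) x∈ with ∈-++⁻ es (Perm.∈-resp-↭ (Perm.↭-sym p) (∈-allFin e))
        ... | inj₁ e∈es   = closed path (∈-span e∈es w∈)
        ... | inj₂ e∈rest = ⊥-elim (none (List.lose e∈rest (_ , v∈ , x∈)))

      complete : ∀ t {es rest} → length rest ≡ t → Stage es → es ++ rest ↭ allFin m → ∃[ es′ ] (Stage es′ × es′ ↭ allFin m)
      complete zero    {es} {[]} refl stage p = es , stage , subst (_↭ allFin m) (List.++-identityʳ es) p
      complete (suc t) {es} {e ∷ rest₀} eq stage p
        with f , f∈ , x , x∈f , x∈U ← find∈ (meets stage p (here refl))
        with r₁ , r₂ , split ← ∈-∃++ f∈ =
        complete t {f ∷ es} {r₁ ++ r₂} (ℕ.suc-injective (trans (sym (trans (cong length split) (length-insert r₁))) eq))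
          (stage-suc f∉es x∈f x∈U stage) p′
        where
        open import Data.List.Relation.Binary.Permutation.Setoid.Properties (≡.setoid (Fin m)) using (Unique-resp-↭)
        length-insert : ∀ r₁ → length (r₁ ++ f ∷ r₂) ≡ suc (length (r₁ ++ r₂))
        length-insert []       = refl
        length-insert (_ ∷ r₁) = cong suc (length-insert r₁)
        p′ : f ∷ es ++ r₁ ++ r₂ ↭ allFin m
        p′ = Perm.trans (Perm.↭-sym (Perm.trans
          (Perm.++⁺ˡ es (Perm.shift f r₁ r₂)) (Perm.shift f es (r₁ ++ r₂))))
          (subst (λ rest → es ++ rest ↭ allFin m) split p)
        f∉es : ¬ (f List.∈ es)
        f∉es f∈es with fresh ∷ _ ← Unique-resp-↭ (Perm.↭⇒↭ₛ (Perm.↭-sym p′)) (allFin⁺ m) =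
          All.lookup fresh (∈-++⁺ˡ f∈es) refl

      vertex-in-edge : Fin m → ∀ x → ∃[ e ] x ∈ edge H e
      vertex-in-edge e x with connected x (proj₁ (nonempty e))
      ... | ε                 = e , proj₂ (nonempty e)
      ... | (g , x∈g , _) ◅ _ = g , x∈g

      -- The last stage spans all vertices and contains all hyperedges, hence also the cycle of `H`,
      -- so it is not a tree.
      order+size : Fin m → n + m ≡ k * m
      order+size e with r₁ , r₂ , eq ← ∈-∃++ (∈-allFin e)
        with es , stage , p ← complete _ refl (stage₁ e)
          (subst (e ∷ r₁ ++ r₂ ↭_) (sym eq) (Perm.↭-sym (Perm.shift e r₁ r₂))) = conclude (Stage.balance stage)
        where
        covers : ∀ g → g List.∈ es
        covers g = Perm.∈-resp-↭ (Perm.↭-sym p) (∈-allFin g)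
        ∣span∣ : ∣ span es ∣ ≡ n
        ∣span∣ = trans (cong ∣_∣ (⊆-antisym (λ _ → ∈⊤) (λ {x} _ →
          let (g , x∈g) = vertex-in-edge e x in ∈-span (covers g) x∈g))) (∣⊤∣≡n n)
        ∣es∣ : length es ≡ m
        ∣es∣ = trans (Perm.↭-length p) (List.length-tabulate {n = m} id)
        conclude : Balance es → n + m ≡ k * m
        conclude (tree _ acyclic) = ⊥-elim (acyclic (proj₁ (proj₂ unicyclic)) (λ i → covers _))
        conclude (cycle eq _)     = trans (sym (cong₂ _+_ ∣span∣ ∣es∣)) (trans eq (cong (k *_) ∣es∣))

-- Recognition of the hypercycle by its degrees

module Recognition where

  open import Data.Fin.Base using (fromℕ<; remQuot)
  open import Data.Fin.Permutation using (_⟨$⟩ʳ_; _⟨$⟩ˡ_; inverseʳ; ↔⇒≡)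
  open import Data.Fin.Properties using (remQuot-combine)
  open import Data.Fin.Subset using (∣_∣; _∈_)
  open import Data.Nat.Base using (_<_; _+_; _*_)
  open import Function.Bundles using (_↔_; mk↔ₛ′)
  open import Relation.Binary.Construct.Closure.ReflexiveTransitive using (Star; ε; _◅_)
  open import Relation.Binary.PropositionalEquality using (refl; sym; trans)
  open FiniteSums
  open Walks using (module ℕ∑; ∑ℕ)
  open Words
  open Degrees
  open CyclicSuccessor
  open Permutations
  open Hypercycle

  module _ {n m} (H : Hypergraph n m) where

    private
      ∑-𝟙≟ : ∀ {n} (i : Fin n) → ∑ℕ (allFin n) (λ e → 𝟙 (does (e ≟ i))) ≡ 1
      ∑-𝟙≟ i = ℕ∑.sum-delta i (λ _ → 1)

    twoEdges : ∀ {x e f} → x ∈ edge H e → x ∈ edge H f → e ≢ f → 2 ≤ degree H x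
    twoEdges {x} {e} {f} x∈e x∈f e≢f = subst (2 ≤_) (sym (degree≡∑ H x))
      (ℕ.≤-trans (ℕ.≤-reflexive (sym (trans (ℕ∑.sum-∙ (allFin m) _ _) (cong₂ _+_ (∑-𝟙≟ e) (∑-𝟙≟ f)))))
        (∑-mono (allFin m) bound))
      where
      bound : ∀ g → 𝟙 (does (g ≟ e)) + 𝟙 (does (g ≟ f)) ≤ 𝟙 (lookup (edge H g) x)
      bound g with g ≟ e | g ≟ f
      ... | yes refl | yes refl = ⊥-elim (e≢f refl)
      ... | yes refl | no _     = ℕ.≤-reflexive (cong 𝟙 (sym (∈⇒lookup x∈e)))
      ... | no _     | yes refl = ℕ.≤-reflexive (cong 𝟙 (sym (∈⇒lookup x∈f)))
      ... | no _     | no _     = z≤n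

    threeEdges : ∀ {x e f g} → x ∈ edge H e → x ∈ edge H f → x ∈ edge H g → e ≢ f → e ≢ g → f ≢ g → 3 ≤ degree H x
    threeEdges {x} {e} {f} {g} x∈e x∈f x∈g e≢f e≢g f≢g = subst (3 ≤_) (sym (degree≡∑ H x))
      (ℕ.≤-trans (ℕ.≤-reflexive (sym (trans (ℕ∑.sum-∙ (allFin m) _ _)
          (cong₂ _+_ (∑-𝟙≟ e) (trans (ℕ∑.sum-∙ (allFin m) _ _) (cong₂ _+_ (∑-𝟙≟ f) (∑-𝟙≟ g)))))))
        (∑-mono (allFin m) bound))
      where
      bound : ∀ h → 𝟙 (does (h ≟ e)) + (𝟙 (does (h ≟ f)) + 𝟙 (does (h ≟ g))) ≤ 𝟙 (lookup (edge H h) x)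
      bound h with h ≟ e | h ≟ f | h ≟ g
      ... | yes refl | yes refl | _        = ⊥-elim (e≢f refl)
      ... | yes refl | no _     | yes refl = ⊥-elim (e≢g refl)
      ... | no _     | yes refl | yes refl = ⊥-elim (f≢g refl)
      ... | yes refl | no _     | no _     = ℕ.≤-reflexive (cong 𝟙 (sym (∈⇒lookup x∈e)))
      ... | no _     | yes refl | no _     = ℕ.≤-reflexive (cong 𝟙 (sym (∈⇒lookup x∈f)))
      ... | no _     | no _     | yes refl = ℕ.≤-reflexive (cong 𝟙 (sym (∈⇒lookup x∈g)))
      ... | no _     | no _     | no _     = z≤n

    1≤degree : ∀ {x e} → x ∈ edge H e → 1 ≤ degree H x
    1≤degree {x} {e} x∈e = subst (1 ≤_) (sym (degree≡∑ H x))
      (ℕ.≤-trans (ℕ.≤-reflexive (cong 𝟙 (sym (∈⇒lookup x∈e)))) (term≤∑ (∈-allFin e)))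
      where open import Data.List.Membership.Propositional.Properties using (∈-allFin)

    -- All k vertices count at least 1, and three of them one more.
    edgeDegree-three : ∀ {k} → Uniform H k → ∀ {e x y z} → x ∈ edge H e → y ∈ edge H e → z ∈ edge H e →
      2 ≤ degree H x → 2 ≤ degree H y → 2 ≤ degree H z → x ≢ y → x ≢ z → y ≢ z → 3 + k ≤ edgeDegree H e
    edgeDegree-three {k} uniform {e} {x} {y} {z} x∈ y∈ z∈ dx dy dz x≢y x≢z y≢z =
      ℕ.≤-trans (ℕ.≤-reflexive (sym total)) (∑-mono (allFin n) bound)
      where
      f : Fin n → ℕ
      f i = (𝟙 (does (i ≟ x)) + (𝟙 (does (i ≟ y)) + 𝟙 (does (i ≟ z)))) + 𝟙 (lookup (edge H e) i)
      total : ∑ℕ (allFin n) f ≡ 3 + k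
      total = trans (ℕ∑.sum-∙ (allFin n) _ _) (cong₂ _+_
        (trans (ℕ∑.sum-∙ (allFin n) _ _) (cong₂ _+_ (∑-𝟙≟ x) (trans (ℕ∑.sum-∙ (allFin n) _ _) (cong₂ _+_ (∑-𝟙≟ y) (∑-𝟙≟ z)))))
        (trans (sym (∣∣≡∑ (edge H e))) (uniform e)))
      bound : ∀ i → f i ≤ (degree H i ℕ∑.when lookup (edge H e) i)
      bound i with i ≟ x | i ≟ y | i ≟ z
      ... | yes refl | yes refl | _        = ⊥-elim (x≢y refl)
      ... | yes refl | no _     | yes refl = ⊥-elim (x≢z refl)
      ... | no _     | yes refl | yes refl = ⊥-elim (y≢z refl)
      ... | yes refl | no _     | no _     rewrite ∈⇒lookup x∈ = dx
      ... | no _     | yes refl | no _     rewrite ∈⇒lookup y∈ = dy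
      ... | no _     | no _     | yes refl rewrite ∈⇒lookup z∈ = dz
      ... | no _     | no _     | no _     with lookup (edge H e) i in eq
      ... | false = z≤n
      ... | true  = 1≤degree (lookup⇒∈ eq)

    module _ {r′ : ℕ} (uniform : Uniform H (suc (suc (suc r′)))) (connected : Connected H) (C : Cycle H)
      (degree≤2 : ∀ i → degree H i ≤ 2) (edgeDegree≡ : ∀ e → edgeDegree H e ≡ 2 + suc (suc (suc r′))) where

      private
        r k : ℕ
        r = suc (suc r′)
        k = suc r
      open Cycle C

      private
        prev : Fin len → Fin len
        prev i = proj₁ (next-surjective i)

        vtx∈prev : ∀ i → vtx i ∈ edge H (hedge (prev i))
        vtx∈prev i = subst (λ j → vtx j ∈ edge H (hedge (prev i))) (proj₂ (next-surjective i)) (next-vtx∈ (prev i))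

        hedge≢prev : ∀ i → hedge i ≢ hedge (prev i)
        hedge≢prev i eq = next-≢ 2≤len (prev i) (trans (proj₂ (next-surjective i)) (hedge-inj eq))

        hedge≢next : ∀ i → hedge i ≢ hedge (next i)
        hedge≢next i eq = next-≢ 2≤len i (sym (hedge-inj eq))

        vtx≢next : ∀ i → vtx (next i) ≢ vtx i
        vtx≢next i eq = next-≢ 2≤len i (vtx-inj eq)

        vtx-degree : ∀ i → 2 ≤ degree H (vtx i)
        vtx-degree i = twoEdges (vtx∈ i) (vtx∈prev i) (hedge≢prev i)

        -- The two cycle vertices already have degree 2 or more; a third such vertex would raise
        -- `edgeDegree` above k + 2.
        ends : ∀ {z} i → z ∈ edge H (hedge i) → 2 ≤ degree H z → z ≡ vtx i ⊎ z ≡ vtx (next i)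
        ends {z} i z∈ dz with z ≟ vtx i | z ≟ vtx (next i)
        ... | yes eq | _      = inj₁ eq
        ... | no _   | yes eq = inj₂ eq
        ... | no z≢  | no z≢′ = ⊥-elim (ℕ.<-irrefl (sym (edgeDegree≡ (hedge i)))
                (edgeDegree-three uniform (vtx∈ i) (next-vtx∈ i) z∈ (vtx-degree i) (vtx-degree (next i)) dz
                  (vtx≢next i ∘ sym) (z≢ ∘ sym) (z≢′ ∘ sym)))

        OnC : Fin m → Set
        OnC f = ∃[ i ] f ≡ hedge i

        twoOnly : ∀ {x f i j} → hedge i ≢ hedge j → x ∈ edge H (hedge i) → x ∈ edge H (hedge j) → x ∈ edge H f → OnC f
        twoOnly {x} {f} {i} {j} i≢j x∈i x∈j x∈f with f ≟ hedge i | f ≟ hedge j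
        ... | yes eq | _      = i , eq
        ... | no _   | yes eq = j , eq
        ... | no f≢i | no f≢j = ⊥-elim (ℕ.<-irrefl refl (ℕ.≤-trans (threeEdges x∈f x∈i x∈j f≢i f≢j i≢j) (degree≤2 x)))

        -- If `f` differs from `hedge i`, then `x` has degree at least 2 and is an end of `hedge i`.
        -- Two hyperedges of the cycle meet there already, so `f` is one of them.
        onC-step : ∀ {x f} i → x ∈ edge H (hedge i) → x ∈ edge H f → OnC f
        onC-step {x} {f} i x∈i x∈f with f ≟ hedge i
        ... | yes eq = i , eq
        ... | no f≢i with ends i x∈i (twoEdges x∈f x∈i f≢i)
        ... | inj₁ refl = twoOnly (hedge≢prev i) (vtx∈ i) (vtx∈prev i) x∈f
        ... | inj₂ refl = twoOnly (hedge≢next i) (next-vtx∈ i) (vtx∈ (next i)) x∈f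

        i₀ : Fin len
        i₀ = fromℕ< (ℕ.≤-trans (s≤s z≤n) 2≤len)

        vertex-onC : ∀ x → ∃[ i ] x ∈ edge H (hedge i)
        vertex-onC x = walk (i₀ , vtx∈ i₀) (connected (vtx i₀) x)
          where
          walk : ∀ {v x} → ∃[ i ] v ∈ edge H (hedge i) → Star (Adjacent H) v x → ∃[ i ] x ∈ edge H (hedge i)
          walk on ε = on
          walk (i , v∈) ((e , v∈e , w∈e) ◅ path) =
            let (j , e≡) = onC-step i v∈ v∈e in walk (j , subst (λ e → _ ∈ edge H e) e≡ w∈e) path

        edge-onC : ∀ f → OnC f
        edge-onC f with proj₁ (enumerate-edge H uniform f) zero
          | Enumerates.inside (proj₂ (enumerate-edge H uniform f)) zero
        ... | z | z∈f = onC-step (proj₁ (vertex-onC z)) (proj₂ (vertex-onC z)) z∈f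

        hedge-bijection : Fin len ↔ Fin m
        hedge-bijection = mk↔ₛ′ hedge (proj₁ ∘ edge-onC) (λ f → sym (proj₂ (edge-onC f)))
          (λ i → hedge-inj (sym (proj₂ (edge-onC (hedge i)))))

        -- An enumeration of the i-th hyperedge that agrees with edgePoint of the
        -- hypercycle on the two vertices of the cycle.
        enum : ∀ i → Σ[ ι ∈ (Fin k → Fin n) ] (Enumerates H (hedge i) ι × ι zero ≡ vtx (next i) × ι (suc zero) ≡ vtx i)
        enum i with enumerate-edge H uniform (hedge i)
        ... | ι , en with Enumerates.surjective en (next-vtx∈ i) | Enumerates.surjective en (vtx∈ i)
        ... | a , eqa | b , eqb with moveTwo {i = a} {b} (λ a≡b → vtx≢next i (trans eqa (trans (cong ι a≡b) (sym eqb))))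
        ... | π , π0 , π1 = ι ∘ (π ⟨$⟩ʳ_) , record
            { injective  = permutation-injective π ∘ Enumerates.injective en
            ; inside     = Enumerates.inside en ∘ (π ⟨$⟩ʳ_)
            ; surjective = λ x∈ → let (j , eq) = Enumerates.surjective en x∈ in
                π ⟨$⟩ˡ j , trans eq (cong ι (sym (inverseʳ π)))
            } , trans (cong ι π0) (sym eqa) , trans (cong ι π1) (sym eqb)

        ι : Fin len → Fin k → Fin n
        ι i = proj₁ (enum i)
        ι-en : ∀ i → Enumerates H (hedge i) (ι i)
        ι-en i = proj₁ (proj₂ (enum i))
        ι0 : ∀ i → ι i zero ≡ vtx (next i)
        ι0 i = proj₁ (proj₂ (proj₂ (enum i)))
        ι1 : ∀ i → ι i (suc zero) ≡ vtx i
        ι1 i = proj₂ (proj₂ (proj₂ (enum i)))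

        -- A vertex in two hyperedges is an end of `hedge i`, and the other end occupies slot 0.
        shared-zero : ∀ {i j s t} → i ≢ j → ι i (suc s) ≡ ι j (suc t) → ι i (suc s) ≡ vtx i
        shared-zero {i} {j} {s} {t} i≢j eq
          with ends i (Enumerates.inside (ι-en i) (suc s)) (twoEdges (Enumerates.inside (ι-en i) (suc s))
                 (subst (_∈ edge H (hedge j)) (sym eq) (Enumerates.inside (ι-en j) (suc t))) (i≢j ∘ hedge-inj))
        ... | inj₁ p = p
        ... | inj₂ p with () ← Enumerates.injective (ι-en i) {suc s} {zero} (trans p (sym (ι0 i)))

        ι-injective : ∀ i j s t → ι i (suc s) ≡ ι j (suc t) → i ≡ j × s ≡ t
        ι-injective i j s t eq with i ≟ j
        ... | yes refl with refl ← Enumerates.injective (ι-en i) {suc s} {suc t} eq = refl , refl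
        ... | no i≢j = ⊥-elim (i≢j (vtx-inj (trans (sym (shared-zero i≢j eq)) (trans eq (shared-zero (i≢j ∘ sym) (sym eq))))))

      module _ (3≤k : 3 ≤ k) where

        private
          -- Both sides are read through the t-th vertex of the i-th hyperedge; `ι≡f` says that the
          -- two readings agree.
          isomorphic : (3≤len : 3 ≤ len) → H ≅ hypercycle {k} {len} 3≤k 3≤len
          isomorphic 3≤len = record
            { onVertices = mk↔ₛ′ g f (λ v → f-injective (f∘g (f v))) f∘g
            ; onEdges    = mk↔ₛ′ (proj₁ ∘ edge-onC) hedge (λ i → hedge-inj (sym (proj₂ (edge-onC (hedge i)))))
                             (λ f → sym (proj₂ (edge-onC f)))
            ; incidence  = λ x e → let (i , e≡) = edge-onC e in mk⇔
                (λ x∈ → case Enumerates.surjective (ι-en i) (subst (λ e → x ∈ edge H e) e≡ x∈) of λ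
                   (t , x≡) → subst (_∈ edge Y i) (sym (f-injective (trans (f∘g x) (trans x≡ (ι≡f i t)))))
                     (Enumerates.inside (X-enumerates 3≤k 3≤len i) t))
                (λ gx∈ → case Enumerates.surjective (X-enumerates 3≤k 3≤len i) gx∈ of λ
                   (t , gx≡) → subst₂′ (sym e≡) (trans (ι≡f i t) (trans (cong f (sym gx≡)) (f∘g x)))
                     (Enumerates.inside (ι-en i) t))
            }
            where
            Y : Hypergraph (len * r) len
            Y = hypercycle {k} {len} 3≤k 3≤len
            f : Fin (len * r) → Fin n
            f v = let (j , s) = remQuot {len} r v in ι j (suc s)
            f-point : ∀ j s → f (point 3≤k 3≤len j s) ≡ ι j (suc s)
            f-point j s = cong (λ (j , s) → ι j (suc s)) (remQuot-combine {len} j s)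
            f-injective : ∀ {u v} → f u ≡ f v → u ≡ v
            f-injective {u} {v} eq with point-surjective 3≤k 3≤len u | point-surjective 3≤k 3≤len v
            ... | j , s , refl | l , t , refl
              with refl , refl ← ι-injective j l s t (trans (sym (f-point j s)) (trans eq (f-point l t))) = refl
            ι≡f : ∀ i t → ι i t ≡ f (edgePoint 3≤k 3≤len i t)
            ι≡f i zero    = trans (ι0 i) (trans (sym (ι1 (next i))) (sym (f-point (next i) zero)))
            ι≡f i (suc s) = sym (f-point i s)
            f-surjective : ∀ x → ∃[ v ] f v ≡ x
            f-surjective x with vertex-onC x
            ... | i , x∈ with Enumerates.surjective (ι-en i) x∈
            ... | t , x≡ = edgePoint 3≤k 3≤len i t , trans (sym (ι≡f i t)) (sym x≡)
            g : Fin n → Fin (len * r)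
            g = proj₁ ∘ f-surjective
            f∘g : ∀ x → f (g x) ≡ x
            f∘g = proj₂ ∘ f-surjective
            subst₂′ : ∀ {x y e e′} → e′ ≡ e → x ≡ y → x ∈ edge H e′ → y ∈ edge H e
            subst₂′ refl refl p = p

        ≅-hypercycle : (3≤m : 3 ≤ m) → H ≅ hypercycle {k} {m} 3≤k 3≤m
        -- The hypercycle is built on the length of the cycle, which equals `m` only through the
        -- bijection with the hyperedges.
        ≅-hypercycle = subst (λ l → (3≤l : 3 ≤ l) → H ≅ hypercycle {k} {l} 3≤k 3≤l) (↔⇒≡ hedge-bijection) isomorphic

-- The hypercycle against the other members of the class

open import Data.Fin.Base using (fromℕ<)
open import Data.Fin.Properties using (any?)
open import Data.Fin.Subset using (_∈_)
open import Data.List.Membership.Propositional.Properties using (∈-allFin)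
open import Data.List.Relation.Unary.Any using (here; there)
open import Data.Nat.Base using (_+_; _*_; _∸_)
open import Data.Nat.Tactic.RingSolver using (solve-∀)
open import Relation.Binary.PropositionalEquality using (refl; sym; trans)
open import Relation.Nullary using (¬?)
open import Relation.Nullary.Decidable using (decidable-stable)
open FiniteSums
open Walks using (module ℕ∑; ∑ℕ)
open Words
open Degrees
open Hypercycle
open UnicyclicOrder
open Recognition
open Comparison

∑-mono-< : ∀ {a} {A : Set a} {xs : List A} {f g : A → ℕ} → (∀ x → f x ≤ g x) →
  ∀ {x} → x List.∈ xs → f x ℕ.< g x → ∑ℕ xs f ℕ.< ∑ℕ xs g
∑-mono-< {xs = _ ∷ xs} le (here refl) lt = ℕ.+-mono-<-≤ lt (∑-mono xs le)
∑-mono-< le (there x∈) lt = ℕ.+-mono-≤-< (le _) (∑-mono-< le x∈ lt)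

0<a*a : ∀ a → a ≢ 0 → 0 ℕ.< a * a
0<a*a zero    a≢0 = ⊥-elim (a≢0 refl)
0<a*a (suc a) _   = s≤s z≤n

-- (D − c)² ≥ 0
square-≤ : ∀ c D → c * D + c * D ≤ D * D + c * c × (D ≢ c → c * D + c * D ℕ.< D * D + c * c)
square-≤ c D with ℕ.≤-total c D
... | inj₁ c≤D with a , refl ← ℕ.m≤n⇒∃[o]m+o≡n c≤D =
  ℕ.≤-trans (ℕ.m≤m+n _ (a * a)) (ℕ.≤-reflexive (eq c a)) ,
  λ D≢c → ℕ.<-≤-trans (ℕ.m<m+n _ (0<a*a a λ { refl → D≢c (ℕ.+-identityʳ c) })) (ℕ.≤-reflexive (eq c a))
  where
  eq : ∀ c a → c * (c + a) + c * (c + a) + a * a ≡ (c + a) * (c + a) + c * c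
  eq = solve-∀
... | inj₂ D≤c with a , refl ← ℕ.m≤n⇒∃[o]m+o≡n D≤c =
  ℕ.≤-trans (ℕ.m≤m+n _ (a * a)) (ℕ.≤-reflexive (eq D a)) ,
  λ D≢c → ℕ.<-≤-trans (ℕ.m<m+n _ (0<a*a a λ { refl → D≢c (sym (ℕ.+-identityʳ D)) })) (ℕ.≤-reflexive (eq D a))
  where
  eq : ∀ D a → (D + a) * D + (D + a) * D + a * a ≡ D * D + (D + a) * (D + a)
  eq = solve-∀

-- (d − 1)(d − 2) ≥ 0
degree-≤ : ∀ {d} → 1 ≤ d → 3 * d ≤ d * d + 2
degree-< : ∀ {d} → 3 ≤ d → 3 * d ℕ.< d * d + 2
degree-≤ {suc zero}          _ = ℕ.≤-refl
degree-≤ {suc (suc zero)}    _ = ℕ.≤-refl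
degree-≤ {suc (suc (suc d))} _ = ℕ.<⇒≤ (degree-< (s≤s (s≤s (s≤s z≤n))))
degree-< {suc zero}          (s≤s ())
degree-< {suc (suc zero)}    (s≤s (s≤s ()))
degree-< {suc (suc (suc d))} _ = ℕ.<-≤-trans (ℕ.m<m+n _ (s≤s z≤n)) (ℕ.≤-reflexive (eq d))
  where
  eq : ∀ d → 3 * (3 + d) + (2 + (3 * d + d * d)) ≡ (3 + d) * (3 + d) + 2
  eq = solve-∀

1∨2 : ∀ {d} → 1 ≤ d → d ≤ 2 → d ≡ 1 ⊎ d ≡ 2
1∨2 {suc zero}       _ _ = inj₁ refl
1∨2 {suc (suc zero)} _ _ = inj₂ refl
1∨2 {suc (suc (suc d))} _ (s≤s (s≤s ()))

degree-12 : ∀ {d} → d ≡ 1 ⊎ d ≡ 2 → d * d + 2 ≡ 3 * d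
degree-12 (inj₁ refl) = refl
degree-12 (inj₂ refl) = refl

module _ {n m : ℕ} (H : Hypergraph n m) where

  ∑-triple : ∑ℕ (allFin n) (λ i → 3 * degree H i) ≡ 3 * degreeSum H id
  ∑-triple = ∑-*ˡ 3 (allFin n) (degree H)

  ∑-squares+2 : ∑ℕ (allFin n) (λ i → degree H i * degree H i + 2) ≡ degreeSum H (λ d → d * d) + n * 2
  ∑-squares+2 = trans (ℕ∑.sum-∙ (allFin n) _ _) (cong (degreeSum H (λ d → d * d) +_)
    (trans (∑-const (allFin n) 2) (cong (_* 2) (List.length-tabulate {n = n} id))))

  -- Equality in (d - 1)(d - 2) ≥ 0, summed over the vertices.
  squares-12 : (∀ i → degree H i ≡ 1 ⊎ degree H i ≡ 2) → degreeSum H (λ d → d * d) + n * 2 ≡ 3 * degreeSum H id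
  squares-12 deg12 = trans (sym ∑-squares+2) (trans (ℕ∑.sum-cong (allFin n) (degree-12 ∘ deg12)) ∑-triple)

theorem5p6 : ∀ {c ℓ₁ ℓ₂ ℓ₃} (F : OrderedField c ℓ₁ ℓ₂ ℓ₃) →
    let open OrderedField F in
    ∀ {k m : ℕ} (3≤k : 3 ≤ k) (3≤m : 3 ≤ m) (α : Carrier) → 0# < α → α < 1# →
    IsFirst F k α (LinearUnicyclic k) (hypercycle 3≤k 3≤m)
theorem5p6 F {suc zero} (s≤s ())
theorem5p6 F {suc (suc zero)} (s≤s (s≤s ()))
theorem5p6 F {k@(suc (suc (suc r′)))} {m} 3≤k 3≤m α 0<α α<1 = X-linearUnicyclic 3≤k 3≤m , first
  where
  r : ℕ
  r = suc (suc r′)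
  Y : Hypergraph (m * r) m
  Y = hypercycle 3≤k 3≤m

  Y12 : ∀ v → degree Y v ≡ 1 ⊎ degree Y v ≡ 2
  Y12 v with point-surjective 3≤k 3≤m v
  ... | j , s , refl = 1∨2 (1≤degree Y (∈X 3≤k 3≤m {j} {j} {s} (inj₁ refl))) (degree-point 3≤k 3≤m j s)

  -- The order of the deciding trace must be admissible: the number m r of vertices alone is at
  -- least 3 r = 3 + k + 2 r′.
  bound : 2 + k ≤ m * r * r ℕ.^ (m * r ∸ 1) ∸ 1
  bound = ℕ.≤-trans (ℕ.∸-monoˡ-≤ 1 (begin
    3 + k                          ≤⟨ ℕ.m≤m+n (3 + k) (r′ + r′) ⟩
    3 + k + (r′ + r′)              ≡⟨ eq r′ ⟩
    3 * r                          ≤⟨ ℕ.*-monoˡ-≤ r 3≤m ⟩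
    m * r                          ≡⟨ ℕ.*-identityʳ (m * r) ⟨
    m * r * 1                      ≤⟨ ℕ.*-monoʳ-≤ (m * r) (ℕ.m^n>0 r (m * r ∸ 1)) ⟩
    m * r * r ℕ.^ (m * r ∸ 1)      ∎)) ℕ.≤-refl
    where
    open ℕ.≤-Reasoning
    eq : ∀ a → 3 + (3 + a) + (a + a) ≡ 3 * (2 + a)
    eq = solve-∀

  first : ∀ {n} (H : Hypergraph n m) → LinearUnicyclic k H → ¬ (H ≅ Y) → Precedes F k α Y H
  first {n} H (uniform , linear , unicyclic@(connected , C , _)) H≇Y = go order
    where
    e₀ : Fin m
    e₀ = fromℕ< (ℕ.≤-trans (s≤s z≤n) 3≤m)
    order : m * r ≡ n
    order = sym (ℕ.+-cancelʳ-≡ m n (m * r) (trans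
      (order+size H (s≤s (s≤s z≤n)) uniform unicyclic e₀) (eq r′ m)))
      where
      eq : ∀ a m → (3 + a) * m ≡ m * (2 + a) + m
      eq = solve-∀
    -- Matching on the equation gives both hypergraphs the same type of vertices.
    go : m * r ≡ n → Precedes F k α Y H
    go refl with any? (λ i → 3 ℕ.≤? degree H i)
    -- The sum of (d - 1)(d - 2) is 0 for the hypercycle and positive here. Order and degree sum
    -- agree, so the sum of squares is larger.
    ... | yes (i , 3≤d) = precedes-by-degrees F α 0<α α<1 Y H (X-uniform 3≤k 3≤m) uniform (X-linear 3≤k 3≤m) linear
            degrees≡ bound (ℕ.+-cancelʳ-< (m * r * 2) _ _ (begin-strict
              degreeSum Y (λ d → d * d) + m * r * 2        ≡⟨ squares-12 Y Y12 ⟩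
              3 * degreeSum Y id                           ≡⟨ cong (3 *_) degrees≡ ⟩
              3 * degreeSum H id                           ≡⟨ ∑-triple H ⟨
              ∑ℕ (allFin (m * r)) (λ i → 3 * degree H i)   <⟨ ∑-mono-< (degree-≤ ∘ 1≤d) (∈-allFin i) (degree-< 3≤d) ⟩
              _                                            ≡⟨ ∑-squares+2 H ⟩
              degreeSum H (λ d → d * d) + m * r * 2        ∎))
      where
      open ℕ.≤-Reasoning
      degrees≡ : degreeSum Y id ≡ degreeSum H id
      degrees≡ = trans (degree-sum Y (X-uniform 3≤k 3≤m)) (sym (degree-sum H uniform))
      1≤d : ∀ i → 1 ≤ degree H i
      1≤d i = 1≤degree H (proj₂ (vertex-in-edge H (s≤s (s≤s z≤n)) uniform unicyclic e₀ i))
    ... | no ≱3 with any? (λ e → ¬? (edgeDegree H e ℕ.≟ 2 + k))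
    ... | no all≡ = ⊥-elim (H≇Y (≅-hypercycle H uniform connected C
            (λ i → ℕ.≤-pred (ℕ.≰⇒> (λ 3≤d → ≱3 (i , 3≤d))))
            (λ e → decidable-stable (edgeDegree H e ℕ.≟ 2 + k) (λ ≢ → all≡ (e , ≢))) 3≤k 3≤m))
    -- The `D e` have mean c, so the sum of (D e - c)² is the excess of their sum of squares over m
    -- c², and the chosen `e` makes it positive. For the hypercycle that sum is at most m c².
    ... | yes (e , D≢) = precedes-by-edges F α 0<α α<1 Y H (X-uniform 3≤k 3≤m) uniform (X-linear 3≤k 3≤m) linear
            degrees≡ bound Y12 H12 (ℕ.≤-<-trans
              (ℕ.≤-trans (∑-mono (allFin m) (λ e → ℕ.*-mono-≤ (X-edgeDegree 3≤k 3≤m e) (X-edgeDegree 3≤k 3≤m e)))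
                (ℕ.≤-reflexive (∑m (c * c))))
              (ℕ.+-cancelʳ-< (m * (c * c)) _ _ (begin-strict
                m * (c * c) + m * (c * c)                            ≡⟨ regroup m c ⟩
                c * (m * c) + c * (m * c)                            ≡⟨ cong (λ s → c * s + c * s) ∑D ⟨
                c * ∑ℕ (allFin m) D + c * ∑ℕ (allFin m) D            ≡⟨ cong₂ _+_ (∑-*ˡ c (allFin m) D) (∑-*ˡ c (allFin m) D) ⟨
                _                                                    ≡⟨ ℕ∑.sum-∙ (allFin m) _ _ ⟨
                ∑ℕ (allFin m) (λ e → c * D e + c * D e)              <⟨ ∑-mono-< (λ e → proj₁ (square-≤ c (D e))) (∈-allFin e)
                                                                          (proj₂ (square-≤ c (D e)) D≢) ⟩
                ∑ℕ (allFin m) (λ e → D e * D e + c * c)              ≡⟨ ℕ∑.sum-∙ (allFin m) _ _ ⟩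
                _                                                    ≡⟨ cong (∑ℕ (allFin m) (λ e → D e * D e) +_) (∑m (c * c)) ⟩
                ∑ℕ (allFin m) (λ e → D e * D e) + m * (c * c)        ∎)))
      where
      open ℕ.≤-Reasoning
      degrees≡ : degreeSum Y id ≡ degreeSum H id
      degrees≡ = trans (degree-sum Y (X-uniform 3≤k 3≤m)) (sym (degree-sum H uniform))
      c : ℕ
      c = 2 + k
      D : Fin m → ℕ
      D = edgeDegree H
      H12 : ∀ i → degree H i ≡ 1 ⊎ degree H i ≡ 2
      H12 i = 1∨2 (1≤degree H (proj₂ (vertex-in-edge H (s≤s (s≤s z≤n)) uniform unicyclic e₀ i)))
        (ℕ.≤-pred (ℕ.≰⇒> (λ 3≤d → ≱3 (i , 3≤d))))
      ∑m : ∀ a → ∑ℕ (allFin m) (λ _ → a) ≡ m * a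
      ∑m a = trans (∑-const (allFin m) a) (cong (_* a) (List.length-tabulate {n = m} id))
      regroup : ∀ m c → m * (c * c) + m * (c * c) ≡ c * (m * c) + c * (m * c)
      regroup = solve-∀
      ∑D : ∑ℕ (allFin m) D ≡ m * c
      -- With n = m r, the sum of squared degrees 3 m k - 2 n is m (k + 2).
      ∑D = trans (edgeDegree-sum H) (ℕ.+-cancelʳ-≡ (m * r * 2) _ _
        (trans (squares-12 H H12) (trans (cong (3 *_) (degree-sum H uniform)) (eq r′ m))))
        where
        eq : ∀ a m → 3 * (m * (3 + a)) ≡ m * (2 + (3 + a)) + m * (2 + a) * 2
        eq = solve-∀
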